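{- Let $F$ be a subfield of $\mathbb{R}$. The theories $T[F]$ and $T[F]^*$ prove exactly the same sentences involving only the symbols $0,1,+,\times,<$.
   Context: For $a\in F$, $f_a(x)=ax$. $T_{\mathrm{add}}[F]$ is the set of sentences true in $(\mathbb{R},0,1,+,-,<,(f_a)_{a\in F})$, $T_{\mathrm{mult}}[F]$ the set of sentences true in $(\mathbb{R},0,1,\times,\div,<,(f_a)_{a\in F})$ with $x\div0=0$, and $T[F]=T_{\mathrm{add}}[F]\cup T_{\mathrm{mult}}[F]$. $T[F]^*$ is the theory in the language $\{0,1,+,\times,<\}\cup\{c_a:a\in F\}$ ($c_a$ constant symbols) with axioms: (1) $0,+,<$ form an ordered abelian group; (2) the positive elements form a divisible ordered abelian group under $\times$ with identity $1$ and order $<$; (3a) $c_{a+b}=c_a+c_b$, (3b) $c_{ab}=c_a\times c_b$, (3c) $0<c_a$ for $a>0$; (4a) $c_{a+b}\times x=(c_a\times x)+(c_b\times x)$, (4b) $c_a\times(x+y)=(c_a\times x)+(c_a\times y)$, for all $a,b\in F$ and all $x,y$.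
   Formalization: T[F]* is given two extra axioms, the rules of signs (−x)z = −(xz) and z(−x) = −(zx); with only axioms (1)–(4) products of negative elements are unconstrained and commutativity of ×, provable in T[F], is not provable in T[F]*. -}

module Defs where

open import Level using (0ℓ)
open import Algebra.Bundles using (CommutativeRing)
open import Data.Empty using (⊥)
open import Data.Fin using (Fin; zero; suc)
open import Data.List using (List; []; _∷_; map)
open import Data.List.Membership.Propositional using (_∈_)
open import Data.Nat using (ℕ; zero; suc)
open import Data.Product using (Σ; ∃; _×_; _,_; proj₁; proj₂)
open import Data.Sum using (_⊎_; inj₁; inj₂)
open import Data.Vec using (Vec; []; _∷_; lookup)
open import Function using (id)
open import Relation.Binary.Core using (Rel)
open import Relation.Binary.Structures using (IsStrictTotalOrder)
open import Relation.Nullary using (¬_; yes; no)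

-- The real field enters through its characterisation, up to isomorphism, as
-- the complete ordered field.  Equality is a setoid equality, so that the
-- usual constructions of the reals qualify without quotient types.
record CompleteOrderedField : Set₁ where
  field
    commutativeRing : CommutativeRing 0ℓ 0ℓ

  open CommutativeRing commutativeRing public

  infix 4 _<_ _≤_
  field
    _<_                : Rel Carrier 0ℓ
    isStrictTotalOrder : IsStrictTotalOrder _≈_ _<_

  open IsStrictTotalOrder isStrictTotalOrder public using (compare; _≟_; _<?_)

  _≤_ : Rel Carrier 0ℓ
  x ≤ y = ¬ (y < x)

  UpperBound : (Carrier → Set) → Carrier → Set
  UpperBound P b = ∀ x → P x → x ≤ b

  field
    0<1      : 0# < 1#
    +-mono-< : ∀ x y z → x < y → x + z < y + z
    *-pos    : ∀ x y → 0# < x → 0# < y → 0# < x * y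
    inverse  : ∀ x → ¬ (x ≈ 0#) → ∃ λ y → x * y ≈ 1#
    supremum : (P : Carrier → Set) → ∃ P → ∃ (UpperBound P) →
               ∃ λ s → UpperBound P s × (∀ b → UpperBound P b → s ≤ b)

  infixl 7 _÷_
  _÷_ : Carrier → Carrier → Carrier
  x ÷ y with y ≟ 0#
  ... | yes _   = 0#
  ... | no  y≉0 = x * proj₁ (inverse y y≉0)

record Subfield (R : CompleteOrderedField) : Set₁ where
  open CompleteOrderedField R
  field
    Member    : Carrier → Set
    resp-≈    : ∀ {a b} → a ≈ b → Member a → Member b
    0-closed  : Member 0#
    1-closed  : Member 1#
    +-closed  : ∀ {a b} → Member a → Member b → Member (a + b)
    neg-closed : ∀ {a} → Member a → Member (- a)
    *-closed  : ∀ {a b} → Member a → Member b → Member (a * b)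
    inv-closed : ∀ {a b} → Member a → a * b ≈ 1# → Member b

  Element : Set
  Element = Σ Carrier Member

  ⌊_⌋ : Element → Carrier
  ⌊_⌋ = proj₁

-- Function symbols of arity 0, 1 and 2.  Every language has, in addition,
-- equality and the binary relation symbol <.
record Language : Set₁ where
  field
    Fun₀ Fun₁ Fun₂ : Set

open Language

-- De Bruijn: Term L n has its free variables among # 0, …, # (n-1).
data Term (L : Language) (n : ℕ) : Set where
  #_   : Fin n → Term L n
  con  : Fun₀ L → Term L n
  app₁ : Fun₁ L → Term L n → Term L n
  app₂ : Fun₂ L → Term L n → Term L n → Term L n

infix  6 _≐_ _≺_
infixr 4 _⇒_

data Formula (L : Language) : ℕ → Set where
  _≐_ _≺_ : ∀ {n} → Term L n → Term L n → Formula L n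
  ⊥′      : ∀ {n} → Formula L n
  _⇒_     : ∀ {n} → Formula L n → Formula L n → Formula L n
  ∀′      : ∀ {n} → Formula L (suc n) → Formula L n

-- The logic is classical, so the other connectives are abbreviations.
infix  5 ¬′_
infixr 4 _∧′_ _∨′_

¬′_ : ∀ {L n} → Formula L n → Formula L n
¬′ φ = φ ⇒ ⊥′

_∧′_ _∨′_ : ∀ {L n} → Formula L n → Formula L n → Formula L n
φ ∧′ ψ = ¬′ (φ ⇒ ¬′ ψ)
φ ∨′ ψ = (¬′ φ) ⇒ ψ

∃′ : ∀ {L n} → Formula L (suc n) → Formula L n
∃′ φ = ¬′ ∀′ (¬′ φ)

Sentence : Language → Set
Sentence L = Formula L 0

Theory : Language → Set₁
Theory L = Sentence L → Set

substTerm : ∀ {L m n} → (Fin m → Term L n) → Term L m → Term L n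
substTerm σ (# i)        = σ i
substTerm σ (con c)      = con c
substTerm σ (app₁ f t)   = app₁ f (substTerm σ t)
substTerm σ (app₂ f t u) = app₂ f (substTerm σ t) (substTerm σ u)

wkTerm : ∀ {L n} → Term L n → Term L (suc n)
wkTerm = substTerm (λ i → # (suc i))

lift : ∀ {L m n} → (Fin m → Term L n) → Fin (suc m) → Term L (suc n)
lift σ zero    = # zero
lift σ (suc i) = wkTerm (σ i)

subst : ∀ {L m n} → (Fin m → Term L n) → Formula L m → Formula L n
subst σ (t ≐ u) = substTerm σ t ≐ substTerm σ u
subst σ (t ≺ u) = substTerm σ t ≺ substTerm σ u
subst σ ⊥′      = ⊥′
subst σ (φ ⇒ ψ) = subst σ φ ⇒ subst σ ψ
subst σ (∀′ φ)  = ∀′ (subst (lift σ) φ)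

wk : ∀ {L n} → Formula L n → Formula L (suc n)
wk = subst (λ i → # (suc i))

fromSentence : ∀ {L n} → Sentence L → Formula L n
fromSentence = subst (λ ())

single : ∀ {L n} → Term L n → Fin (suc n) → Term L n
single t zero    = t
single t (suc i) = # i

infix 8 _[_]
_[_] : ∀ {L n} → Formula L (suc n) → Term L n → Formula L n
φ [ t ] = subst (single t) φ

-- Classical natural deduction from the axioms T, with the side assumptions Γ.
infix 2 _∣_⊢_
data _∣_⊢_ {L : Language} (T : Theory L) :
           ∀ {n} → List (Formula L n) → Formula L n → Set where
  axiom : ∀ {n} {Γ : List (Formula L n)} {σ} → T σ → T ∣ Γ ⊢ fromSentence σ
  hyp   : ∀ {n} {Γ : List (Formula L n)} {φ} → φ ∈ Γ → T ∣ Γ ⊢ φ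
  ⇒-I   : ∀ {n} {Γ : List (Formula L n)} {φ ψ} →
          T ∣ φ ∷ Γ ⊢ ψ → T ∣ Γ ⊢ φ ⇒ ψ
  ⇒-E   : ∀ {n} {Γ : List (Formula L n)} {φ ψ} →
          T ∣ Γ ⊢ φ ⇒ ψ → T ∣ Γ ⊢ φ → T ∣ Γ ⊢ ψ
  raa   : ∀ {n} {Γ : List (Formula L n)} {φ} →
          T ∣ (¬′ φ) ∷ Γ ⊢ ⊥′ → T ∣ Γ ⊢ φ
  ∀-I   : ∀ {n} {Γ : List (Formula L n)} {φ} →
          T ∣ map wk Γ ⊢ φ → T ∣ Γ ⊢ ∀′ φ
  ∀-E   : ∀ {n} {Γ : List (Formula L n)} {φ} →
          T ∣ Γ ⊢ ∀′ φ → (t : Term L n) → T ∣ Γ ⊢ φ [ t ]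
  ≐-I   : ∀ {n} {Γ : List (Formula L n)} (t : Term L n) → T ∣ Γ ⊢ t ≐ t
  ≐-E   : ∀ {n} {Γ : List (Formula L n)} {t u : Term L n} (φ : Formula L (suc n)) →
          T ∣ Γ ⊢ t ≐ u → T ∣ Γ ⊢ φ [ t ] → T ∣ Γ ⊢ φ [ u ]

infix 2 _⊢_
_⊢_ : ∀ {L} → Theory L → Sentence L → Set
T ⊢ φ = T ∣ [] ⊢ φ

record Translation (L M : Language) : Set where
  field
    fun₀ : Fun₀ L → Fun₀ M
    fun₁ : Fun₁ L → Fun₁ M
    fun₂ : Fun₂ L → Fun₂ M

module _ {L M : Language} (h : Translation L M) where
  open Translation h

  translateTerm : ∀ {n} → Term L n → Term M n
  translateTerm (# i)        = # i
  translateTerm (con c)      = con (fun₀ c)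
  translateTerm (app₁ f t)   = app₁ (fun₁ f) (translateTerm t)
  translateTerm (app₂ f t u) = app₂ (fun₂ f) (translateTerm t) (translateTerm u)

  translate : ∀ {n} → Formula L n → Formula M n
  translate (t ≐ u) = translateTerm t ≐ translateTerm u
  translate (t ≺ u) = translateTerm t ≺ translateTerm u
  translate ⊥′      = ⊥′
  translate (φ ⇒ ψ) = translate φ ⇒ translate ψ
  translate (∀′ φ)  = ∀′ (translate φ)

-- Tarski semantics in the reals.  As only ⊥, ⇒ and ∀ are primitive and the
-- atoms are decidable, truth is stable under double negation, so this is
-- classical truth even though the metatheory is constructive.
module _ (R : CompleteOrderedField) where
  open CompleteOrderedField R

  record Interpretation (L : Language) : Set where
    field
      ⟦_⟧₀ : Fun₀ L → Carrier
      ⟦_⟧₁ : Fun₁ L → Carrier → Carrier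
      ⟦_⟧₂ : Fun₂ L → Carrier → Carrier → Carrier

module Truth {R : CompleteOrderedField} {L : Language} (I : Interpretation R L) where
  open CompleteOrderedField R
  open Interpretation I

  value : ∀ {n} → Vec Carrier n → Term L n → Carrier
  value ρ (# i)        = lookup ρ i
  value ρ (con c)      = ⟦ c ⟧₀
  value ρ (app₁ f t)   = ⟦ f ⟧₁ (value ρ t)
  value ρ (app₂ f t u) = ⟦ f ⟧₂ (value ρ t) (value ρ u)

  Holds : ∀ {n} → Vec Carrier n → Formula L n → Set
  Holds ρ (t ≐ u) = value ρ t ≈ value ρ u
  Holds ρ (t ≺ u) = value ρ t < value ρ u
  Holds ρ ⊥′      = ⊥
  Holds ρ (φ ⇒ ψ) = Holds ρ φ → Holds ρ ψ
  Holds ρ (∀′ φ)  = ∀ x → Holds (x ∷ ρ) φ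

  True : Theory L
  True σ = Holds [] σ

data Const : Set where
  `0 `1 : Const

data AddOp : Set where
  `+ `- : AddOp

data MultOp : Set where
  `× `÷ : MultOp

data RingOp : Set where
  `+ `× : RingOp

ringLanguage : Language
ringLanguage = record { Fun₀ = Const ; Fun₁ = ⊥ ; Fun₂ = RingOp }

module _ {R : CompleteOrderedField} (F : Subfield R) where
  open CompleteOrderedField R using (_≈_; _<_; _+_; _*_; _-_; _÷_; 0#; 1#)
  open Subfield F

  -- The unary symbols are the f_a, for a in F.
  addLanguage multLanguage combinedLanguage : Language
  addLanguage      = record { Fun₀ = Const ; Fun₁ = Element ; Fun₂ = AddOp }
  multLanguage     = record { Fun₀ = Const ; Fun₁ = Element ; Fun₂ = MultOp }
  combinedLanguage = record { Fun₀ = Const ; Fun₁ = Element ; Fun₂ = AddOp ⊎ MultOp }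

  -- inj₂ a is the constant symbol c_a.
  starLanguage : Language
  starLanguage = record { Fun₀ = Const ⊎ Element ; Fun₁ = ⊥ ; Fun₂ = RingOp }

  add⊆combined : Translation addLanguage combinedLanguage
  add⊆combined = record { fun₀ = id ; fun₁ = id ; fun₂ = inj₁ }

  mult⊆combined : Translation multLanguage combinedLanguage
  mult⊆combined = record { fun₀ = id ; fun₁ = id ; fun₂ = inj₂ }

  ring⊆combined : Translation ringLanguage combinedLanguage
  ring⊆combined = record
    { fun₀ = id
    ; fun₁ = λ ()
    ; fun₂ = λ { `+ → inj₁ `+ ; `× → inj₂ `× }
    }

  ring⊆star : Translation ringLanguage starLanguage
  ring⊆star = record { fun₀ = inj₁ ; fun₁ = λ () ; fun₂ = id }

  constant : Const → CompleteOrderedField.Carrier R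
  constant `0 = 0#
  constant `1 = 1#

  addReals : Interpretation R addLanguage
  addReals = record
    { ⟦_⟧₀ = constant
    ; ⟦_⟧₁ = λ a x → ⌊ a ⌋ * x
    ; ⟦_⟧₂ = λ { `+ x y → x + y ; `- x y → x - y }
    }

  multReals : Interpretation R multLanguage
  multReals = record
    { ⟦_⟧₀ = constant
    ; ⟦_⟧₁ = λ a x → ⌊ a ⌋ * x
    ; ⟦_⟧₂ = λ { `× x y → x * y ; `÷ x y → x ÷ y }
    }

  Tadd : Theory addLanguage
  Tadd = Truth.True addReals

  Tmult : Theory multLanguage
  Tmult = Truth.True multReals

  data T[_] : Theory combinedLanguage where
    add  : ∀ {σ} → Tadd σ → T[_] (translate add⊆combined σ)
    mult : ∀ {σ} → Tmult σ → T[_] (translate mult⊆combined σ)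

  infixl 7 _⊗_
  infixl 6.5 _⊕_

  _⊕_ _⊗_ : ∀ {n} → Term starLanguage n → Term starLanguage n → Term starLanguage n
  _⊕_ = app₂ `+
  _⊗_ = app₂ `×

  𝟎 𝟏 : ∀ {n} → Term starLanguage n
  𝟎 = con (inj₁ `0)
  𝟏 = con (inj₁ `1)

  c : ∀ {n} → Element → Term starLanguage n
  c a = con (inj₂ a)

  pow : ∀ {n} → Term starLanguage n → ℕ → Term starLanguage n
  pow t zero    = 𝟏
  pow t (suc k) = t ⊗ pow t k

  Pos : ∀ {n} → Term starLanguage n → Formula starLanguage n
  Pos t = 𝟎 ≺ t

  Form : ℕ → Set
  Form = Formula starLanguage

  Tm : ℕ → Set
  Tm = Term starLanguage

  ∀₁ : (Tm 1 → Form 1) → Form 0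
  ∀₁ φ = ∀′ (φ (# zero))

  ∀₂ : (Tm 2 → Tm 2 → Form 2) → Form 0
  ∀₂ φ = ∀′ (∀′ (φ (# suc zero) (# zero)))

  ∀₃ : (Tm 3 → Tm 3 → Tm 3 → Form 3) → Form 0
  ∀₃ φ = ∀′ (∀′ (∀′ (φ (# suc (suc zero)) (# suc zero) (# zero))))

  ∀∃ : (Tm 2 → Tm 2 → Form 2) → Form 0
  ∀∃ φ = ∀′ (∃′ (φ (# suc zero) (# zero)))

  -- The symbols c_{a+b} and c_{ab} appear as c d for any d ≈ a + b, d ≈ a * b:
  -- distinct representatives of one element of F then have provably equal
  -- constants.
  data T[_]* : Theory starLanguage where
    +-assoc   : T[_]* (∀₃ λ x y z → (x ⊕ y) ⊕ z ≐ x ⊕ (y ⊕ z))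
    +-comm    : T[_]* (∀₂ λ x y → x ⊕ y ≐ y ⊕ x)
    +-identity : T[_]* (∀₁ λ x → x ⊕ 𝟎 ≐ x)
    +-inverse : T[_]* (∀∃ λ x y → x ⊕ y ≐ 𝟎)
    <-irrefl  : T[_]* (∀₁ λ x → ¬′ (x ≺ x))
    <-trans   : T[_]* (∀₃ λ x y z → x ≺ y ⇒ y ≺ z ⇒ x ≺ z)
    <-total   : T[_]* (∀₂ λ x y → x ≺ y ∨′ x ≐ y ∨′ y ≺ x)
    +-mono    : T[_]* (∀₃ λ x y z → x ≺ y ⇒ x ⊕ z ≺ y ⊕ z)

    ×-closed  : T[_]* (∀₂ λ x y → Pos x ⇒ Pos y ⇒ Pos (x ⊗ y))
    ×-assoc   : T[_]* (∀₃ λ x y z → Pos x ⇒ Pos y ⇒ Pos z ⇒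
                                    (x ⊗ y) ⊗ z ≐ x ⊗ (y ⊗ z))
    ×-comm    : T[_]* (∀₂ λ x y → Pos x ⇒ Pos y ⇒ x ⊗ y ≐ y ⊗ x)
    1-pos     : T[_]* (Pos 𝟏)
    ×-identity : T[_]* (∀₁ λ x → Pos x ⇒ x ⊗ 𝟏 ≐ x)
    ×-inverse : T[_]* (∀∃ λ x y → Pos x ⇒ (Pos y ∧′ x ⊗ y ≐ 𝟏))
    ×-mono    : T[_]* (∀₃ λ x y z → Pos x ⇒ Pos y ⇒ Pos z ⇒
                                    x ≺ y ⇒ x ⊗ z ≺ y ⊗ z)
    ×-divisible : ∀ k → T[_]* (∀∃ λ x y → Pos x ⇒ (Pos y ∧′ pow y (suc k) ≐ x))

    -- The rules of signs.  The group axioms above concern positive elements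
    -- only; these determine the remaining products from them.  Without them
    -- the axioms would not even yield x × y = y × x (for F = ℚ, redefine
    -- x × y as 0 in the reals for negative irrational x), which holds in T[F].
    ×-signˡ   : T[_]* (∀₃ λ x y z → x ⊕ y ≐ 𝟎 ⇒ (x ⊗ z) ⊕ (y ⊗ z) ≐ 𝟎)
    ×-signʳ   : T[_]* (∀₃ λ x y z → x ⊕ y ≐ 𝟎 ⇒ (z ⊗ x) ⊕ (z ⊗ y) ≐ 𝟎)

    c-+       : ∀ a b d → ⌊ d ⌋ ≈ ⌊ a ⌋ + ⌊ b ⌋ → T[_]* (c d ≐ c a ⊕ c b)
    c-×       : ∀ a b d → ⌊ d ⌋ ≈ ⌊ a ⌋ * ⌊ b ⌋ → T[_]* (c d ≐ c a ⊗ c b)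
    c-pos     : ∀ a → 0# < ⌊ a ⌋ → T[_]* (Pos (c a))

    c-distribʳ : ∀ a b d → ⌊ d ⌋ ≈ ⌊ a ⌋ + ⌊ b ⌋ →
                 T[_]* (∀₁ λ x → c d ⊗ x ≐ (c a ⊗ x) ⊕ (c b ⊗ x))
    c-distribˡ : ∀ a → T[_]* (∀₂ λ x y → c a ⊗ (x ⊕ y) ≐ (c a ⊗ x) ⊕ (c a ⊗ y))

{-# OPTIONS --safe #-}

-- Reading c_a as f_a(1) turns the axioms of T[F]* into theorems of T[F].
-- Conversely, consider the generic model of T[F]*: worlds are finite lists of
-- assumptions, elements are closed terms with new constants, and a ring
-- sentence is forced exactly when it is derivable.  There f_a is x ↦ c_a × x,
-- x − y is x + c_{-1} × y, and quotients exist after passing to larger worlds,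
-- so derivations from T[F] are sound as soon as the axioms of T[F] are forced.
-- Now the additive and the multiplicative theory are complete.  Both reduce to
-- quantifier elimination in a divisible ordered module: the additive group
-- with scalars from F, and, once the signs of the variables are fixed, the
-- positive elements with natural numbers as scalars, acting by powers.  The
-- elimination does not depend on the model and ends in comparisons of elements
-- of F, and the reals are one of the models; so what is true in the reals is
-- forced in the generic model.

module Submission where

open import Defs
open import Algebra.Bundles using (CommutativeMonoid; AbelianGroup)
import Algebra.Properties.AbelianGroup
import Algebra.Properties.CommutativeMonoid.Mult
import Algebra.Properties.Ring
import Algebra.Solver.CommutativeMonoid
import Algebra.Solver.Ring.NaturalCoefficients.Default
open import Data.Bool using (Bool; true; false; not; _∧_; _∨_)
open import Data.Empty using (⊥; ⊥-elim)
open import Data.Fin using (Fin; zero; suc)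
open import Data.List using (List; []; _∷_; _++_; length; map)
import Data.List as List
open import Data.List.Membership.Propositional using (_∈_)
open import Data.List.Membership.Propositional.Properties using (∈-map⁺; ∈-map⁻)
open import Data.List.Relation.Unary.All using (All; []; _∷_)
import Data.List.Relation.Unary.All.Properties as All
open import Data.List.Relation.Unary.Any using (here; there)
open import Data.Nat using (ℕ; zero; suc)
import Data.Nat as ℕ
import Data.Nat.Properties as ℕ
open import Data.Product using (∃; _×_; _,_; proj₁; proj₂)
open import Data.Sum using (_⊎_; inj₁; inj₂; map₂; reduce)
open import Data.Unit using (⊤; tt)
open import Data.Vec using (Vec; []; _∷_; lookup)
open import Function using (_∘_; id; mk⇔)
open import Function.Bundles using (_⇔_)
open import Level using (0ℓ)
open import Relation.Binary.Definitions using (tri<; tri≈; tri>)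
import Relation.Binary.Reasoning.Setoid
open import Relation.Binary.Structures using (IsStrictTotalOrder)
open import Relation.Nullary using (¬_; yes; no)
open import Relation.Nullary.Decidable using (decidable-stable)
import Relation.Binary.PropositionalEquality as ≡
open ≡ using (_≡_; refl; _≗_)

open Language

-- The metatheory is constructive, so neither the completeness theorem of first-order logic nor an
-- arbitrary classical model of T[F]* is at hand. This is why models are Kripke frames whose
-- absurdity may be inhabited, and why everything forced has to be stable under `◇`: case
-- distinctions and witnesses are found in larger worlds and may be used whenever the goal is
-- stable. No axiom of T[F] contains both + and ×, yet a derivation may mix the two languages
-- freely, and neither completeness result says anything about mixed sentences. It suffices that one
-- structure interprets both languages and forces the axioms of either; soundness takes care of the
-- mixing. The laws of × are assumed for positive elements only. The completeness of the reals
-- enters once, through the existence of k-th roots, which makes the positive reals divisible.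

-- Substitution, replacement of constants, and transport of derivations

substTerm-cong : ∀ {L m n} {σ τ : Fin m → Term L n} → σ ≗ τ → substTerm σ ≗ substTerm τ
substTerm-cong e (# i)        = e i
substTerm-cong e (con k)      = refl
substTerm-cong e (app₁ f t)   = ≡.cong (app₁ f) (substTerm-cong e t)
substTerm-cong e (app₂ f t u) = ≡.cong₂ (app₂ f) (substTerm-cong e t) (substTerm-cong e u)

substTerm-∘ : ∀ {L k m n} (τ : Fin m → Term L n) (σ : Fin k → Term L m) →
              substTerm τ ∘ substTerm σ ≗ substTerm (substTerm τ ∘ σ)
substTerm-∘ τ σ (# i)        = refl
substTerm-∘ τ σ (con k)      = refl
substTerm-∘ τ σ (app₁ f t)   = ≡.cong (app₁ f) (substTerm-∘ τ σ t)
substTerm-∘ τ σ (app₂ f t u) = ≡.cong₂ (app₂ f) (substTerm-∘ τ σ t) (substTerm-∘ τ σ u)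

substTerm-id : ∀ {L n} (t : Term L n) → substTerm #_ t ≡ t
substTerm-id (# i)        = refl
substTerm-id (con k)      = refl
substTerm-id (app₁ f t)   = ≡.cong (app₁ f) (substTerm-id t)
substTerm-id (app₂ f t u) = ≡.cong₂ (app₂ f) (substTerm-id t) (substTerm-id u)

lift-cong : ∀ {L m n} {σ τ : Fin m → Term L n} → σ ≗ τ → lift σ ≗ lift τ
lift-cong e zero    = refl
lift-cong e (suc i) = ≡.cong wkTerm (e i)

substTerm-wkTerm : ∀ {L m n} (τ : Fin m → Term L n) (t : Term L m) →
                   substTerm (lift τ) (wkTerm t) ≡ wkTerm (substTerm τ t)
substTerm-wkTerm τ t = ≡.trans (substTerm-∘ (lift τ) (λ i → # suc i) t) (≡.sym (substTerm-∘ (λ i → # suc i) τ t))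

substTerm-lift : ∀ {L k m n} (τ : Fin m → Term L n) (σ : Fin k → Term L m) →
                 substTerm (lift τ) ∘ lift σ ≗ lift (substTerm τ ∘ σ)
substTerm-lift τ σ zero    = refl
substTerm-lift τ σ (suc i) = substTerm-wkTerm τ (σ i)

single-wkTerm : ∀ {L n} (t u : Term L n) → substTerm (single t) (wkTerm u) ≡ u
single-wkTerm t u = ≡.trans (substTerm-∘ (single t) (λ i → # suc i) u) (substTerm-id u)

-- Simultaneous replacement of the variables (by σ) and of the constants (by κ).
-- Plain substitution, interpretation of one language in another and
-- generalisation over a constant are all instances.
module Replacement {L M : Language} (fun₁ : Fun₁ L → Fun₁ M) (fun₂ : Fun₂ L → Fun₂ M) where

  Constants : ℕ → Set
  Constants m = Fun₀ L → Term M m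

  term : ∀ {n m} → (Fin n → Term M m) → Constants m → Term L n → Term M m
  term σ κ (# i)        = σ i
  term σ κ (con k)      = κ k
  term σ κ (app₁ f t)   = app₁ (fun₁ f) (term σ κ t)
  term σ κ (app₂ f t u) = app₂ (fun₂ f) (term σ κ t) (term σ κ u)

  form : ∀ {n m} → (Fin n → Term M m) → Constants m → Formula L n → Formula M m
  form σ κ (t ≐ u) = term σ κ t ≐ term σ κ u
  form σ κ (t ≺ u) = term σ κ t ≺ term σ κ u
  form σ κ ⊥′      = ⊥′
  form σ κ (φ ⇒ ψ) = form σ κ φ ⇒ form σ κ ψ
  -- A constant may be sent to an open term, so `κ` is weakened under the binder together with `σ`.
  form σ κ (∀′ φ)  = ∀′ (form (lift σ) (wkTerm ∘ κ) φ)

  term-cong : ∀ {n m} {σ τ : Fin n → Term M m} {κ ι : Constants m} →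
              σ ≗ τ → κ ≗ ι → term σ κ ≗ term τ ι
  term-cong e d (# i)        = e i
  term-cong e d (con k)      = d k
  term-cong e d (app₁ f t)   = ≡.cong (app₁ _) (term-cong e d t)
  term-cong e d (app₂ f t u) = ≡.cong₂ (app₂ _) (term-cong e d t) (term-cong e d u)

  form-cong : ∀ {n m} {σ τ : Fin n → Term M m} {κ ι : Constants m} →
              σ ≗ τ → κ ≗ ι → form σ κ ≗ form τ ι
  form-cong e d (t ≐ u) = ≡.cong₂ _≐_ (term-cong e d t) (term-cong e d u)
  form-cong e d (t ≺ u) = ≡.cong₂ _≺_ (term-cong e d t) (term-cong e d u)
  form-cong e d ⊥′      = refl
  form-cong e d (φ ⇒ ψ) = ≡.cong₂ _⇒_ (form-cong e d φ) (form-cong e d ψ)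
  form-cong e d (∀′ φ)  = ≡.cong ∀′ (form-cong (lift-cong e) (λ k → ≡.cong wkTerm (d k)) φ)

  substTerm-term : ∀ {n m l} (τ : Fin m → Term M l) (σ : Fin n → Term M m) (κ : Constants m) →
                   substTerm τ ∘ term σ κ ≗ term (substTerm τ ∘ σ) (substTerm τ ∘ κ)
  substTerm-term τ σ κ (# i)        = refl
  substTerm-term τ σ κ (con k)      = refl
  substTerm-term τ σ κ (app₁ f t)   = ≡.cong (app₁ _) (substTerm-term τ σ κ t)
  substTerm-term τ σ κ (app₂ f t u) = ≡.cong₂ (app₂ _) (substTerm-term τ σ κ t) (substTerm-term τ σ κ u)

  term-substTerm : ∀ {k n m} (σ : Fin n → Term M m) (κ : Constants m) (τ : Fin k → Term L n) →
                   term σ κ ∘ substTerm τ ≗ term (term σ κ ∘ τ) κ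
  term-substTerm σ κ τ (# i)        = refl
  term-substTerm σ κ τ (con k)      = refl
  term-substTerm σ κ τ (app₁ f t)   = ≡.cong (app₁ _) (term-substTerm σ κ τ t)
  term-substTerm σ κ τ (app₂ f t u) = ≡.cong₂ (app₂ _) (term-substTerm σ κ τ t) (term-substTerm σ κ τ u)

  subst-form : ∀ {n m l} (τ : Fin m → Term M l) (σ : Fin n → Term M m) (κ : Constants m) →
               subst τ ∘ form σ κ ≗ form (substTerm τ ∘ σ) (substTerm τ ∘ κ)
  subst-form τ σ κ (t ≐ u) = ≡.cong₂ _≐_ (substTerm-term τ σ κ t) (substTerm-term τ σ κ u)
  subst-form τ σ κ (t ≺ u) = ≡.cong₂ _≺_ (substTerm-term τ σ κ t) (substTerm-term τ σ κ u)
  subst-form τ σ κ ⊥′      = refl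
  subst-form τ σ κ (φ ⇒ ψ) = ≡.cong₂ _⇒_ (subst-form τ σ κ φ) (subst-form τ σ κ ψ)
  subst-form τ σ κ (∀′ φ)  = ≡.cong ∀′ (≡.trans
    (subst-form (lift τ) (lift σ) (wkTerm ∘ κ) φ)
    (form-cong (substTerm-lift τ σ) (λ k → substTerm-wkTerm τ (κ k)) φ))

  term-wkTerm : ∀ {n m} (σ : Fin n → Term M m) (κ : Constants m) (t : Term L n) →
                term (lift σ) (wkTerm ∘ κ) (wkTerm t) ≡ wkTerm (term σ κ t)
  term-wkTerm σ κ t = ≡.trans (term-substTerm (lift σ) (wkTerm ∘ κ) (λ i → # suc i) t)
                              (≡.sym (substTerm-term (λ i → # suc i) σ κ t))

  form-subst : ∀ {k n m} (σ : Fin n → Term M m) (κ : Constants m) (τ : Fin k → Term L n) →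
               form σ κ ∘ subst τ ≗ form (term σ κ ∘ τ) κ
  form-subst σ κ τ (t ≐ u) = ≡.cong₂ _≐_ (term-substTerm σ κ τ t) (term-substTerm σ κ τ u)
  form-subst σ κ τ (t ≺ u) = ≡.cong₂ _≺_ (term-substTerm σ κ τ t) (term-substTerm σ κ τ u)
  form-subst σ κ τ ⊥′      = refl
  form-subst σ κ τ (φ ⇒ ψ) = ≡.cong₂ _⇒_ (form-subst σ κ τ φ) (form-subst σ κ τ ψ)
  form-subst σ κ τ (∀′ φ)  = ≡.cong ∀′ (≡.trans
    (form-subst (lift σ) (wkTerm ∘ κ) (lift τ) φ)
    (form-cong (λ { zero → refl ; (suc i) → term-wkTerm σ κ (τ i) }) (λ _ → refl) φ))

  form-wk : ∀ {n m} (σ : Fin n → Term M m) (κ : Constants m) (φ : Formula L n) →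
            form (lift σ) (wkTerm ∘ κ) (wk φ) ≡ wk (form σ κ φ)
  form-wk σ κ φ = ≡.trans (form-subst (lift σ) (wkTerm ∘ κ) (λ i → # suc i) φ)
                          (≡.sym (subst-form (λ i → # suc i) σ κ φ))

  form-[] : ∀ {n m} (σ : Fin n → Term M m) (κ : Constants m) (φ : Formula L (suc n)) (t : Term L n) →
            form σ κ (φ [ t ]) ≡ form (lift σ) (wkTerm ∘ κ) φ [ term σ κ t ]
  form-[] σ κ φ t = ≡.trans (form-subst σ κ (single t) φ) (≡.trans
    (form-cong (λ { zero → refl ; (suc i) → ≡.sym (single-wkTerm (term σ κ t) (σ i)) })
               (λ k → ≡.sym (single-wkTerm (term σ κ t) (κ k))) φ)
    (≡.sym (subst-form (single (term σ κ t)) (lift σ) (wkTerm ∘ κ) φ)))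

  module Transport {T : Theory L} {S : Theory M}
    (Good : ∀ {m} → Constants m → Set)
    (good-wk : ∀ {m} {κ : Constants m} → Good κ → Good (wkTerm ∘ κ))
    (good-axiom : ∀ {m} {κ : Constants m} {Δ τ} → Good κ → T τ → S ∣ Δ ⊢ form (λ ()) κ τ)
    where

    -- The replacement of constants changes at every `∀-I`, so the images of the axioms have to be
    -- derivable for a whole class `Good` closed under weakening. The classes in use fix all
    -- constants, fix the constants of a smaller language, or read c_a as f_a(1).
    transport : ∀ {n Γ} {φ : Formula L n} → T ∣ Γ ⊢ φ →
                ∀ {m Δ} {σ : Fin n → Term M m} {κ : Constants m} → Good κ →
                (∀ {γ} → γ ∈ Γ → form σ κ γ ∈ Δ) → S ∣ Δ ⊢ form σ κ φ
    transport (axiom {σ = τ} a) {Δ = Δ} {σ} {κ} g h =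
      ≡.subst (S ∣ Δ ⊢_)
        (≡.sym (≡.trans (form-subst σ κ (λ ()) τ) (form-cong (λ ()) (λ _ → refl) τ))) (good-axiom g a)
    transport (hyp p) g h = hyp (h p)
    transport (⇒-I d) g h = ⇒-I (transport d g (λ { (here refl) → here refl ; (there p) → there (h p) }))
    transport (⇒-E d e) g h = ⇒-E (transport d g h) (transport e g h)
    transport (raa d) g h = raa (transport d g (λ { (here refl) → here refl ; (there p) → there (h p) }))
    transport {Γ = Γ} (∀-I d) {Δ = Δ} {σ} {κ} g h = ∀-I (transport d (good-wk g) h′)
      where
      h′ : ∀ {γ} → γ ∈ map wk Γ → form (lift σ) (wkTerm ∘ κ) γ ∈ map wk Δ
      h′ p with ∈-map⁻ wk p
      ... | γ , q , refl = ≡.subst (_∈ map wk Δ) (≡.sym (form-wk σ κ γ)) (∈-map⁺ wk (h q))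
    transport (∀-E {φ = φ} d t) {Δ = Δ} {σ} {κ} g h =
      ≡.subst (S ∣ Δ ⊢_) (≡.sym (form-[] σ κ φ t)) (∀-E (transport d g h) (term σ κ t))
    transport (≐-I t) g h = ≐-I _
    transport (≐-E {t = t} {u} φ d e) {Δ = Δ} {σ} {κ} g h =
      ≡.subst (S ∣ Δ ⊢_) (≡.sym (form-[] σ κ φ u))
        (≐-E (form (lift σ) (wkTerm ∘ κ) φ) (transport d g h)
          (≡.subst (S ∣ Δ ⊢_) (form-[] σ κ φ t) (transport e g h)))

module _ {L : Language} where
  open Replacement {L} {L} id id

  term-con : ∀ {n m} (σ : Fin n → Term L m) → term σ con ≗ substTerm σ
  term-con σ (# i)        = refl
  term-con σ (con k)      = refl
  term-con σ (app₁ f t)   = ≡.cong (app₁ f) (term-con σ t)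
  term-con σ (app₂ f t u) = ≡.cong₂ (app₂ f) (term-con σ t) (term-con σ u)

  form-con : ∀ {n m} (σ : Fin n → Term L m) → form σ con ≗ subst σ
  form-con σ (t ≐ u) = ≡.cong₂ _≐_ (term-con σ t) (term-con σ u)
  form-con σ (t ≺ u) = ≡.cong₂ _≺_ (term-con σ t) (term-con σ u)
  form-con σ ⊥′      = refl
  form-con σ (φ ⇒ ψ) = ≡.cong₂ _⇒_ (form-con σ φ) (form-con σ ψ)
  form-con σ (∀′ φ)  = ≡.cong ∀′ (form-con (lift σ) φ)

  subst-cong : ∀ {n m} {σ τ : Fin n → Term L m} → σ ≗ τ → subst σ ≗ subst τ
  subst-cong {σ = σ} {τ} e φ = ≡.trans (≡.sym (form-con σ φ))
    (≡.trans (form-cong e (λ _ → refl) φ) (form-con τ φ))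

  subst-∘ : ∀ {k n m} (τ : Fin n → Term L m) (σ : Fin k → Term L n) →
            subst τ ∘ subst σ ≗ subst (substTerm τ ∘ σ)
  subst-∘ τ σ φ = ≡.trans (≡.cong (subst τ) (≡.sym (form-con σ φ)))
    (≡.trans (subst-form τ σ con φ) (form-con (substTerm τ ∘ σ) φ))

  subst-id : ∀ {n} {σ : Fin n → Term L n} → σ ≗ #_ → (φ : Formula L n) → subst σ φ ≡ φ
  subst-id e (t ≐ u) = ≡.cong₂ _≐_ (≡.trans (substTerm-cong e t) (substTerm-id t))
                                   (≡.trans (substTerm-cong e u) (substTerm-id u))
  subst-id e (t ≺ u) = ≡.cong₂ _≺_ (≡.trans (substTerm-cong e t) (substTerm-id t))
                                   (≡.trans (substTerm-cong e u) (substTerm-id u))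
  subst-id e ⊥′      = refl
  subst-id e (φ ⇒ ψ) = ≡.cong₂ _⇒_ (subst-id e φ) (subst-id e ψ)
  subst-id e (∀′ φ)  = ≡.cong ∀′ (subst-id (λ { zero → refl ; (suc i) → ≡.cong wkTerm (e i) }) φ)

  FixesConstants : ∀ {m} → Constants m → Set
  FixesConstants κ = ∀ k → κ k ≡ con k

  wkTerm-fixes : ∀ {m} {κ : Constants m} → FixesConstants κ → FixesConstants (wkTerm ∘ κ)
  wkTerm-fixes e k = ≡.cong wkTerm (e k)

  axiom-fixes : ∀ {T : Theory L} {m} {κ : Constants m} {Δ τ} → FixesConstants κ → T τ → T ∣ Δ ⊢ form (λ ()) κ τ
  axiom-fixes {T} {Δ = Δ} {τ} e a = ≡.subst (T ∣ Δ ⊢_)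
    (≡.sym (≡.trans (form-cong (λ ()) e τ) (form-con (λ ()) τ))) (axiom a)

  module _ {T : Theory L} where
    open Transport {T} {T} FixesConstants wkTerm-fixes axiom-fixes

    ⊢-subst : ∀ {n m Γ Δ} {φ : Formula L n} (σ : Fin n → Term L m) → T ∣ Γ ⊢ φ →
              (∀ {γ} → γ ∈ Γ → subst σ γ ∈ Δ) → T ∣ Δ ⊢ subst σ φ
    ⊢-subst {Δ = Δ} {φ} σ d h = ≡.subst (T ∣ Δ ⊢_) (form-con σ φ)
      (transport d {σ = σ} {con} (λ _ → refl) (λ {γ} p → ≡.subst (_∈ Δ) (≡.sym (form-con σ γ)) (h p)))

    ⊢-weaken : ∀ {n} {Γ Δ : List (Formula L n)} {φ} → T ∣ Γ ⊢ φ → (∀ {γ} → γ ∈ Γ → γ ∈ Δ) → T ∣ Δ ⊢ φ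
    ⊢-weaken {Δ = Δ} {φ} d h = ≡.subst (T ∣ Δ ⊢_) (subst-id (λ _ → refl) φ)
      (⊢-subst #_ d (λ {γ} p → ≡.subst (_∈ Δ) (≡.sym (subst-id (λ _ → refl) γ)) (h p)))

module _ {L M N : Language} (h : Translation L M) {fun₁ : Fun₁ M → Fun₁ N} {fun₂ : Fun₂ M → Fun₂ N} where
  open Translation h renaming (fun₀ to h₀; fun₁ to h₁; fun₂ to h₂)
  private
    module A = Replacement {M} {N} fun₁ fun₂
    module B = Replacement {L} {N} (fun₁ ∘ h₁) (fun₂ ∘ h₂)

  term-translate : ∀ {n m} (σ : Fin n → Term N m) (κ : A.Constants m) t →
                   A.term σ κ (translateTerm h t) ≡ B.term σ (κ ∘ h₀) t
  term-translate σ κ (# i)        = refl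
  term-translate σ κ (con k)      = refl
  term-translate σ κ (app₁ f t)   = ≡.cong (app₁ _) (term-translate σ κ t)
  term-translate σ κ (app₂ f t u) = ≡.cong₂ (app₂ _) (term-translate σ κ t) (term-translate σ κ u)

  form-translate : ∀ {n m} (σ : Fin n → Term N m) (κ : A.Constants m) φ →
                   A.form σ κ (translate h φ) ≡ B.form σ (κ ∘ h₀) φ
  form-translate σ κ (t ≐ u) = ≡.cong₂ _≐_ (term-translate σ κ t) (term-translate σ κ u)
  form-translate σ κ (t ≺ u) = ≡.cong₂ _≺_ (term-translate σ κ t) (term-translate σ κ u)
  form-translate σ κ ⊥′      = refl
  form-translate σ κ (φ ⇒ ψ) = ≡.cong₂ _⇒_ (form-translate σ κ φ) (form-translate σ κ ψ)
  form-translate σ κ (∀′ φ)  = ≡.cong ∀′ (form-translate (lift σ) (wkTerm ∘ κ) φ)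

-- Kripke worlds, double negation and stable predicates

record Worlds : Set₁ where
  infix 4 _⊑_
  field
    World       : Set
    _⊑_         : World → World → Set
    ⊑-refl      : ∀ {w} → w ⊑ w
    ⊑-trans     : ∀ {u v w} → u ⊑ v → v ⊑ w → u ⊑ w
    Absurd      : World → Set
    absurd-mono : ∀ {w v} → w ⊑ v → Absurd w → Absurd v

  Mono : (World → Set) → Set
  Mono P = ∀ {w v} → w ⊑ v → P w → P v

  -- Kripke double negation.
  ◇ : (World → Set) → World → Set
  ◇ P w = ∀ {v} → w ⊑ v → (∀ {u} → v ⊑ u → P u → Absurd u) → Absurd v

  -- Stability is what makes `raa` sound. It passes from Q to P ⇒ Q and through ∀, so forcing is
  -- classical as soon as the atoms are regular.
  record Regular (P : World → Set) : Set where
    field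
      mono   : Mono P
      stable : ∀ {w} → ◇ P w → P w

  open Regular public

  ◇-bind : ∀ {P Q w} → ◇ P w → (∀ {v} → w ⊑ v → P v → ◇ Q v) → ◇ Q w
  ◇-bind p f w⊑v k = p w⊑v (λ v⊑u q → f (⊑-trans w⊑v v⊑u) q ⊑-refl (λ u⊑t → k (⊑-trans v⊑u u⊑t)))

  ◇-mono : ∀ {P} → Mono (◇ P)
  ◇-mono w⊑v p v⊑u = p (⊑-trans w⊑v v⊑u)

  ◇-map : ∀ {P Q w} → ◇ P w → (∀ {v} → w ⊑ v → P v → Q v) → ◇ Q w
  ◇-map p f w⊑v k = p w⊑v (λ v⊑u q → k v⊑u (f (⊑-trans w⊑v v⊑u) q))

  ◇-return : ∀ {P w} → Mono P → P w → ◇ P w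
  ◇-return m p w⊑v k = k ⊑-refl (m w⊑v p)

  -- The way in which trichotomy, inverses and roots are used: what exists only in larger worlds may
  -- be assumed when the goal is regular.
  run : ∀ {P Q w} → Regular Q → ◇ P w → (∀ {v} → w ⊑ v → P v → Q v) → Q w
  run r p f = stable r (◇-map p f)

  -- Ex falso is not automatic when absurdity may be inhabited; stability gives it, with a
  -- continuation that is never called.
  explode : ∀ {P w} → Regular P → Absurd w → P w
  explode r a = stable r (λ w⊑v k → absurd-mono w⊑v a)

  absurd-regular : Regular Absurd
  absurd-regular = record { mono = absurd-mono ; stable = λ p → p ⊑-refl (λ _ a → a) }

  ×-regular : ∀ {P Q} → Regular P → Regular Q → Regular (λ w → P w × Q w)
  ×-regular p q = record
    { mono   = λ { e (a , b) → mono p e a , mono q e b }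
    ; stable = λ d → stable p (◇-map d (λ _ → proj₁)) , stable q (◇-map d (λ _ → proj₂))
    }

  Implies : (World → Set) → (World → Set) → World → Set
  Implies P Q w = ∀ {v} → w ⊑ v → P v → Q v

  ⇒-regular : ∀ {P Q} → Mono P → Regular Q → Regular (Implies P Q)
  ⇒-regular p q = record
    { mono   = λ e f e′ → f (⊑-trans e e′)
    ; stable = λ d e a → run q (◇-mono e d) (λ e′ f → f ⊑-refl (p e′ a))
    }

  ∀-regular : ∀ {A : Set} {P : A → World → Set} → (∀ a → Regular (P a)) → Regular (λ w → ∀ a → P a w)
  ∀-regular r = record
    { mono   = λ e f a → mono (r a) e (f a)
    ; stable = λ d a → stable (r a) (◇-map d (λ _ f → f a))
    }

-- Kripke frames with a constant domain.  Absurdity need not be empty: in the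
-- generic model the worlds are finite sets of assumptions and absurdity is
-- their inconsistency.
record Frame : Set₁ where
  field
    worlds : Worlds

  open Worlds worlds public

  field
    Carrier      : Set
    Eq Less      : Carrier → Carrier → World → Set
    eq-regular   : ∀ {x y} → Regular (Eq x y)
    less-regular : ∀ {x y} → Regular (Less x y)
    eq-refl      : ∀ {x w} → Eq x x w
    eq-sym       : ∀ {x y w} → Eq x y w → Eq y x w
    eq-trans     : ∀ {x y z w} → Eq x y w → Eq y z w → Eq x z w
    less-resp    : ∀ {x x′ y y′ w} → Eq x x′ w → Eq y y′ w → Less x y w → Less x′ y′ w

-- Binary operations are given by their graphs, since quotients exist only
-- after passing to a larger world.
record Structure (K : Frame) (L : Language) : Set₁ where
  open Frame K
  field
    const  : Fun₀ L → Carrier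
    op₁    : Fun₁ L → Carrier → Carrier
    Graph₂ : Fun₂ L → Carrier → Carrier → Carrier → World → Set
    op₁-cong     : ∀ f {x y w} → Eq x y w → Eq (op₁ f x) (op₁ f y) w
    graph-mono   : ∀ f {x y z} → Mono (Graph₂ f x y z)
    graph-resp   : ∀ f {x y z z′ w} → Eq z z′ w → Graph₂ f x y z w → Graph₂ f x y z′ w
    graph-unique : ∀ f {x x′ y y′ z z′ w} → Eq x x′ w → Eq y y′ w →
                   Graph₂ f x y z w → Graph₂ f x′ y′ z′ w → Eq z z′ w
    graph-total  : ∀ f x y {w} → ◇ (λ v → ∃ λ z → Graph₂ f x y z v) w

-- Forcing and its soundness for classical deduction

module Forcing {K : Frame} {L : Language} (S : Structure K L) where
  open Frame K
  open Structure S

  Value : ∀ {n} → Vec Carrier n → Term L n → Carrier → World → Set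
  Value ρ (# i)        y w = Eq (lookup ρ i) y w
  Value ρ (con k)      y w = Eq (const k) y w
  Value ρ (app₁ f t)   y w = ∃ λ a → Value ρ t a w × Eq (op₁ f a) y w
  Value ρ (app₂ f t u) y w = ∃ λ a → ∃ λ b → Value ρ t a w × Value ρ u b w × Graph₂ f a b y w

  -- A term may acquire its value only in a larger world, so an atom speaks about all values in all
  -- larger worlds. This keeps it regular; as values are unique up to `Eq`, a single pair of values
  -- decides it (`same-value⁺`).
  SameValue : ∀ {n} → (Carrier → Carrier → World → Set) → Vec Carrier n → Term L n → Term L n → World → Set
  SameValue _∼_ ρ t u w = ∀ {v} → w ⊑ v → ∀ {y z} → Value ρ t y v → Value ρ u z v → (y ∼ z) v

  Force : ∀ {n} → Vec Carrier n → Formula L n → World → Set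
  Force ρ (t ≐ u) w = SameValue Eq ρ t u w
  Force ρ (t ≺ u) w = SameValue Less ρ t u w
  Force ρ ⊥′      w = Absurd w
  Force ρ (φ ⇒ ψ) w = Implies (Force ρ φ) (Force ρ ψ) w
  Force ρ (∀′ φ)  w = ∀ x → Force (x ∷ ρ) φ w

  value-mono : ∀ {n} {ρ : Vec Carrier n} t {y} → Mono (Value ρ t y)
  value-mono (# i)        e p = mono eq-regular e p
  value-mono (con k)      e p = mono eq-regular e p
  value-mono (app₁ f t)   e (a , p , q) = a , value-mono t e p , mono eq-regular e q
  value-mono (app₂ f t u) e (a , b , p , q , g) =
    a , b , value-mono t e p , value-mono u e q , graph-mono f e g

  value-resp : ∀ {n} {ρ : Vec Carrier n} t {y z w} → Eq y z w → Value ρ t y w → Value ρ t z w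
  value-resp (# i)        e p = eq-trans p e
  value-resp (con k)      e p = eq-trans p e
  value-resp (app₁ f t)   e (a , p , q) = a , p , eq-trans q e
  value-resp (app₂ f t u) e (a , b , p , q , g) = a , b , p , q , graph-resp f e g

  value-unique : ∀ {n} {ρ : Vec Carrier n} t {y z w} → Value ρ t y w → Value ρ t z w → Eq y z w
  value-unique (# i)        p q = eq-trans (eq-sym p) q
  value-unique (con k)      p q = eq-trans (eq-sym p) q
  value-unique (app₁ f t)   (a , p , q) (b , r , s) =
    eq-trans (eq-sym q) (eq-trans (op₁-cong f (value-unique t p r)) s)
  value-unique (app₂ f t u) (a , b , p , q , g) (a′ , b′ , p′ , q′ , g′) =
    graph-unique f (value-unique t p p′) (value-unique u q q′) g g′

  value-total : ∀ {n} {ρ : Vec Carrier n} t {w} → ◇ (λ v → ∃ λ y → Value ρ t y v) w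
  value-total (# i)        e k = k ⊑-refl (_ , eq-refl)
  value-total (con k)      e l = l ⊑-refl (_ , eq-refl)
  value-total (app₁ f t)   = ◇-map (value-total t) (λ { _ (a , p) → _ , a , p , eq-refl })
  value-total (app₂ f t u) =
    ◇-bind (value-total t) λ { e (a , p) →
    ◇-bind (value-total u) λ { e′ (b , q) →
    ◇-map (graph-total f a b) λ { e″ (z , g) →
      z , a , b , value-mono t (⊑-trans e′ e″) p , value-mono u e″ q , g }}}

  Same-regular : ∀ {n} {_∼_ : Carrier → Carrier → World → Set} → (∀ {x y} → Regular (x ∼ y)) →
                 ∀ {ρ : Vec Carrier n} t u → Regular (SameValue _∼_ ρ t u)
  Same-regular r t u = record
    { mono   = λ e f e′ → f (⊑-trans e e′)
    ; stable = λ d e p q → run r (◇-mono e d) (λ e′ f → f ⊑-refl (value-mono t e′ p) (value-mono u e′ q))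
    }

  same-value⁺ : ∀ {n} {ρ : Vec Carrier n} {_∼_} → (∀ {x y} → Regular (x ∼ y)) →
                (∀ {x x′ y y′ w} → Eq x x′ w → Eq y y′ w → (x ∼ y) w → (x′ ∼ y′) w) →
                ∀ t u {y z w} → Value ρ t y w → Value ρ u z w → (y ∼ z) w → SameValue _∼_ ρ t u w
  same-value⁺ r resp t u p q h e p′ q′ =
    resp (value-unique t (value-mono t e p) p′) (value-unique u (value-mono u e q) q′) (mono r e h)

  force-regular : ∀ {n} {ρ : Vec Carrier n} φ → Regular (Force ρ φ)
  force-regular (t ≐ u) = Same-regular eq-regular t u
  force-regular (t ≺ u) = Same-regular less-regular t u
  force-regular ⊥′      = absurd-regular
  force-regular (φ ⇒ ψ) = ⇒-regular (mono (force-regular φ)) (force-regular ψ)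
  force-regular (∀′ φ)  = ∀-regular (λ x → force-regular φ)

  -- A substitution cannot be evaluated to an environment, since its terms may still lack values.
  -- Instead the substitution lemmas hold relative to any environment `ρ′` that happens to consist
  -- of values of `σ`.
  Matches : ∀ {n m} → Vec Carrier m → (Fin n → Term L m) → Vec Carrier n → World → Set
  Matches ρ σ ρ′ w = ∀ i → Value ρ (σ i) (lookup ρ′ i) w

  matches-mono : ∀ {n m} {ρ : Vec Carrier m} (σ : Fin n → Term L m) {ρ′} → Mono (Matches ρ σ ρ′)
  matches-mono σ e h i = value-mono (σ i) e (h i)

  value-subst⁺ : ∀ {n m} {ρ : Vec Carrier m} {σ : Fin n → Term L m} {ρ′ w} → Matches ρ σ ρ′ w →
                 ∀ t {y} → Value ρ′ t y w → Value ρ (substTerm σ t) y w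
  value-subst⁺ {σ = σ} h (# i) p = value-resp (σ i) p (h i)
  value-subst⁺ h (con k)      p = p
  value-subst⁺ h (app₁ f t)   (a , p , q) = a , value-subst⁺ h t p , q
  value-subst⁺ h (app₂ f t u) (a , b , p , q , g) = a , b , value-subst⁺ h t p , value-subst⁺ h u q , g

  value-subst⁻ : ∀ {n m} {ρ : Vec Carrier m} {σ : Fin n → Term L m} {ρ′ w} → Matches ρ σ ρ′ w →
                 ∀ t {y} → Value ρ (substTerm σ t) y w → Value ρ′ t y w
  value-subst⁻ {σ = σ} h (# i) p = value-unique (σ i) (h i) p
  value-subst⁻ h (con k)      p = p
  value-subst⁻ h (app₁ f t)   (a , p , q) = a , value-subst⁻ h t p , q
  value-subst⁻ h (app₂ f t u) (a , b , p , q , g) = a , b , value-subst⁻ h t p , value-subst⁻ h u q , g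

  matches-wk : ∀ {n} {ρ : Vec Carrier n} {x w} → Matches (x ∷ ρ) (λ i → # suc i) ρ w
  matches-wk i = eq-refl

  matches-lift : ∀ {n m} {ρ : Vec Carrier m} {σ : Fin n → Term L m} {ρ′ w x} → Matches ρ σ ρ′ w →
                 Matches (x ∷ ρ) (lift σ) (x ∷ ρ′) w
  matches-lift h zero = eq-refl
  matches-lift {ρ = ρ} {σ} {x = x} h (suc i) =
    value-subst⁺ {ρ = x ∷ ρ} {ρ′ = ρ} (matches-wk {ρ = ρ} {x = x}) (σ i) (h i)

  matches-single : ∀ {n} {ρ : Vec Carrier n} {t y w} → Value ρ t y w → Matches ρ (single t) (y ∷ ρ) w
  matches-single p zero    = p
  matches-single p (suc i) = eq-refl

  mutual
    force-subst⁺ : ∀ {n m} {ρ : Vec Carrier m} {σ : Fin n → Term L m} {ρ′ w} → Matches ρ σ ρ′ w →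
                   ∀ φ → Force ρ′ φ w → Force ρ (subst σ φ) w
    force-subst⁺ {ρ = ρ} {σ} {ρ′} h (t ≐ u) f e p q =
      f e (value-subst⁻ (matches-mono {ρ = ρ} σ {ρ′} e h) t p) (value-subst⁻ (matches-mono {ρ = ρ} σ {ρ′} e h) u q)
    force-subst⁺ {ρ = ρ} {σ} {ρ′} h (t ≺ u) f e p q =
      f e (value-subst⁻ (matches-mono {ρ = ρ} σ {ρ′} e h) t p) (value-subst⁻ (matches-mono {ρ = ρ} σ {ρ′} e h) u q)
    force-subst⁺ h ⊥′ f = f
    force-subst⁺ {ρ = ρ} {σ} {ρ′} h (φ ⇒ ψ) f e p =
      force-subst⁺ h′ ψ (f e (force-subst⁻ h′ φ p))
      where h′ = matches-mono {ρ = ρ} σ {ρ′} e h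
    force-subst⁺ {ρ = ρ} {σ} {ρ′} h (∀′ φ) f x =
      force-subst⁺ (matches-lift {ρ = ρ} {σ} {ρ′} h) φ (f x)

    force-subst⁻ : ∀ {n m} {ρ : Vec Carrier m} {σ : Fin n → Term L m} {ρ′ w} → Matches ρ σ ρ′ w →
                   ∀ φ → Force ρ (subst σ φ) w → Force ρ′ φ w
    force-subst⁻ {ρ = ρ} {σ} {ρ′} h (t ≐ u) f e p q =
      f e (value-subst⁺ (matches-mono {ρ = ρ} σ {ρ′} e h) t p) (value-subst⁺ (matches-mono {ρ = ρ} σ {ρ′} e h) u q)
    force-subst⁻ {ρ = ρ} {σ} {ρ′} h (t ≺ u) f e p q =
      f e (value-subst⁺ (matches-mono {ρ = ρ} σ {ρ′} e h) t p) (value-subst⁺ (matches-mono {ρ = ρ} σ {ρ′} e h) u q)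
    force-subst⁻ h ⊥′ f = f
    force-subst⁻ {ρ = ρ} {σ} {ρ′} h (φ ⇒ ψ) f e p =
      force-subst⁻ h′ ψ (f e (force-subst⁺ h′ φ p))
      where h′ = matches-mono {ρ = ρ} σ {ρ′} e h
    force-subst⁻ {ρ = ρ} {σ} {ρ′} h (∀′ φ) f x =
      force-subst⁻ (matches-lift {ρ = ρ} {σ} {ρ′} h) φ (f x)

  -- The terms in `∀-E` and `≐-E` receive values only in larger worlds; regularity of the conclusion
  -- brings it back to the present one.
  sound : ∀ {T : Theory L} → (∀ {τ} → T τ → ∀ {w} → Force [] τ w) →
          ∀ {n Γ} {φ : Formula L n} → T ∣ Γ ⊢ φ →
          ∀ {ρ w} → (∀ {γ} → γ ∈ Γ → Force ρ γ w) → Force ρ φ w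
  sound ax (axiom {σ = τ} a) h = force-subst⁺ (λ ()) τ (ax a)
  sound ax (hyp p) h = h p
  sound ax (⇒-I d) h e p =
    sound ax d λ { (here refl) → p ; {γ} (there q) → mono (force-regular γ) e (h q) }
  sound ax (⇒-E d d′) h = sound ax d h ⊑-refl (sound ax d′ h)
  -- The continuation `k` supplied by `◇` is literally the forcing of `¬′ φ`.
  sound ax (raa {φ = φ} d) h = stable (force-regular φ) λ e k →
    sound ax d λ { (here refl) → k ; {γ} (there q) → mono (force-regular γ) e (h q) }
  sound ax (∀-I {Γ = Γ} {φ} d) {ρ} {w} h x = sound ax d h′
    where
    h′ : ∀ {γ} → γ ∈ map wk Γ → Force (x ∷ ρ) γ w
    h′ p with ∈-map⁻ wk p
    ... | γ , q , refl = force-subst⁺ {ρ′ = ρ} (matches-wk {ρ = ρ} {x}) γ (h q)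
  sound ax (∀-E {φ = φ} d t) {ρ} h =
    run (force-regular (φ [ t ])) (value-total t) λ { {v} e (y , p) →
      force-subst⁺ {ρ′ = y ∷ ρ} (matches-single {ρ = ρ} {t} p) φ (mono (force-regular φ) e (sound ax d h y)) }
  sound ax (≐-I t) h e p q = value-unique t p q
  sound ax (≐-E {t = t} {u} φ d d′) {ρ} h =
    run (force-regular (φ [ u ])) (value-total t) λ { {v} e (y , p) →
    run (force-regular (φ [ u ])) (value-total u) λ { {v′} e′ (z , q) →
      let p′ = value-mono t e′ p in
      force-subst⁺ {ρ′ = y ∷ ρ} (matches-single {ρ = ρ} {u} (value-resp u (eq-sym (sound ax d h (⊑-trans e e′) p′ q)) q)) φ
        (force-subst⁻ {ρ′ = y ∷ ρ} (matches-single {ρ = ρ} {t} p′) φ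
          (mono (force-regular (φ [ t ])) (⊑-trans e e′) (sound ax d′ h))) }}

-- Reducts along a translation of languages

module _ {K : Frame} {L M : Language} (h : Translation L M) (S : Structure K M) where
  open Frame K
  open Structure S
  open Translation h

  reduct : Structure K L
  reduct = record
    { const        = const ∘ fun₀
    ; op₁          = op₁ ∘ fun₁
    ; Graph₂       = Graph₂ ∘ fun₂
    ; op₁-cong     = op₁-cong ∘ fun₁
    ; graph-mono   = graph-mono ∘ fun₂
    ; graph-resp   = graph-resp ∘ fun₂
    ; graph-unique = graph-unique ∘ fun₂
    ; graph-total  = graph-total ∘ fun₂
    }

  private
    module A = Forcing reduct
    module B = Forcing S

  value-translate⁺ : ∀ {n} {ρ : Vec Carrier n} t {y w} → A.Value ρ t y w → B.Value ρ (translateTerm h t) y w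
  value-translate⁺ (# i)        p = p
  value-translate⁺ (con k)      p = p
  value-translate⁺ (app₁ f t)   (a , p , q) = a , value-translate⁺ t p , q
  value-translate⁺ (app₂ f t u) (a , b , p , q , g) = a , b , value-translate⁺ t p , value-translate⁺ u q , g

  value-translate⁻ : ∀ {n} {ρ : Vec Carrier n} t {y w} → B.Value ρ (translateTerm h t) y w → A.Value ρ t y w
  value-translate⁻ (# i)        p = p
  value-translate⁻ (con k)      p = p
  value-translate⁻ (app₁ f t)   (a , p , q) = a , value-translate⁻ t p , q
  value-translate⁻ (app₂ f t u) (a , b , p , q , g) = a , b , value-translate⁻ t p , value-translate⁻ u q , g

  mutual
    force-translate⁺ : ∀ {n} {ρ : Vec Carrier n} φ {w} → A.Force ρ φ w → B.Force ρ (translate h φ) w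
    force-translate⁺ (t ≐ u) f e p q = f e (value-translate⁻ t p) (value-translate⁻ u q)
    force-translate⁺ (t ≺ u) f e p q = f e (value-translate⁻ t p) (value-translate⁻ u q)
    force-translate⁺ ⊥′      f = f
    force-translate⁺ (φ ⇒ ψ) f e p = force-translate⁺ ψ (f e (force-translate⁻ φ p))
    force-translate⁺ (∀′ φ)  f x = force-translate⁺ φ (f x)

    force-translate⁻ : ∀ {n} {ρ : Vec Carrier n} φ {w} → B.Force ρ (translate h φ) w → A.Force ρ φ w
    force-translate⁻ (t ≐ u) f e p q = f e (value-translate⁺ t p) (value-translate⁺ u q)
    force-translate⁻ (t ≺ u) f e p q = f e (value-translate⁺ t p) (value-translate⁺ u q)
    force-translate⁻ ⊥′      f = f
    force-translate⁻ (φ ⇒ ψ) f e p = force-translate⁻ ψ (f e (force-translate⁺ φ p))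
    force-translate⁻ (∀′ φ)  f x = force-translate⁻ φ (f x)

-- Quantifier elimination by test points

record Scalars : Set₁ where
  infixl 6 _+ₖ_
  infixl 7 _*ₖ_
  infix 4 _≃_
  field
    K C        : Set
    0ₖ 1ₖ      : K
    _+ₖ_ _*ₖ_  : K → K → K
    _≃_        : K → K → Set
    Positive   : K → Set
    1-positive : Positive 1ₖ
    +-positive : ∀ {k l} → Positive k → Positive l → Positive (k +ₖ l)
    *-positive : ∀ {k l} → Positive k → Positive l → Positive (k *ₖ l)
    -- The only subtraction that natural exponents allow: of two unequal scalars one exceeds the
    -- other by a positive scalar.
    difference : ∀ k l → (∃ λ d → Positive d × k +ₖ d ≃ l) ⊎ k ≃ l ⊎ (∃ λ d → Positive d × l +ₖ d ≃ k)
    up         : C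

-- Quantifier elimination by test points (Ferrante and Rackoff).  A test point
-- is a formal fraction (P − Q) / d: the zeros of the atoms, the midpoints of
-- two zeros, and points beyond all zeros.  Subtraction and division are
-- cleared when the point is substituted, so that the same procedure serves
-- for multiplication, where the scalars are natural exponents.
module Elimination (S : Scalars) where
  open Scalars S

  infixl 6 _⊞_
  infixl 7 _⊠_
  infix 4 _≋_ _≪_
  infixr 3 _&_
  infixr 2 _⊃_

  data Linear (n : ℕ) : Set where
    var  : Fin n → Linear n
    cst  : C → Linear n
    null : Linear n
    _⊞_  : Linear n → Linear n → Linear n
    _⊠_  : K → Linear n → Linear n

  data QF (n : ℕ) : Set where
    _≋_ _≪_ : Linear n → Linear n → QF n
    falsum  : QF n
    _⊃_ _&_ : QF n → QF n → QF n

  verum : ∀ {n} → QF n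
  verum = falsum ⊃ falsum

  coef : ∀ {n} → Linear (suc n) → K
  coef (var zero)    = 1ₖ
  coef (var (suc i)) = 0ₖ
  coef (cst a)       = 0ₖ
  coef null          = 0ₖ
  coef (f ⊞ g)       = coef f +ₖ coef g
  coef (k ⊠ f)       = k *ₖ coef f

  rest : ∀ {n} → Linear (suc n) → Linear n
  rest (var zero)    = null
  rest (var (suc i)) = var i
  rest (cst a)       = cst a
  rest null          = null
  rest (f ⊞ g)       = rest f ⊞ rest g
  rest (k ⊠ f)       = k ⊠ rest f

  record Point (n : ℕ) : Set where
    constructor point
    field
      minuend subtrahend : Linear n
      denominator        : K
      positive           : Positive denominator

  open Point

  -- At x = (P - Q) / d the value of f, multiplied by d, is coef f · (P - Q) + d · rest f. In a
  -- comparison with g, adding (coef f + coef g) · Q to both sides removes the minus sign; `l` is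
  -- the coefficient of the other side.
  evaluate : ∀ {n} → Point n → Linear (suc n) → K → Linear n
  evaluate (point P Q d _) f l = (coef f ⊠ P ⊞ l ⊠ Q) ⊞ d ⊠ rest f

  at : ∀ {n} → Point n → QF (suc n) → QF n
  at p (f ≋ g) = evaluate p f (coef g) ≋ evaluate p g (coef f)
  at p (f ≪ g) = evaluate p f (coef g) ≪ evaluate p g (coef f)
  at p falsum  = falsum
  at p (ψ ⊃ χ) = at p ψ ⊃ at p χ
  at p (ψ & χ) = at p ψ & at p χ

  -- If coef f + d = coef g, then f = g amounts to rest f = d · x + rest g, which has the single
  -- solution (rest f - rest g) / d. With equal coefficients the outcome does not depend on x, and
  -- there is nothing to test.
  atomZeros : ∀ {n} → Linear (suc n) → Linear (suc n) → List (Point n)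
  atomZeros f g with difference (coef f) (coef g)
  ... | inj₁ (d , d>0 , _)        = point (rest f) (rest g) d d>0 ∷ []
  ... | inj₂ (inj₁ _)             = []
  ... | inj₂ (inj₂ (d , d>0 , _)) = point (rest g) (rest f) d d>0 ∷ []

  zeros : ∀ {n} → QF (suc n) → List (Point n)
  zeros (f ≋ g) = atomZeros f g
  zeros (f ≪ g) = atomZeros f g
  zeros falsum  = []
  zeros (ψ ⊃ χ) = zeros ψ ++ zeros χ
  zeros (ψ & χ) = zeros ψ ++ zeros χ

  origin : ∀ {n} → Point n
  origin = point null null 1ₖ 1-positive

  -- `up` is a constant beyond the neutral element: 1 for addition, 2 for multiplication. So these
  -- points are a unit, or a factor 2, away; likewise `midpoint` is the arithmetic or the geometric
  -- mean.
  above below : ∀ {n} → Point n → Point n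
  above (point P Q d d>0) = point (P ⊞ d ⊠ cst up) Q d d>0
  below (point P Q d d>0) = point P (Q ⊞ d ⊠ cst up) d d>0

  midpoint : ∀ {n} → Point n → Point n → Point n
  midpoint (point P Q d d>0) (point P′ Q′ d′ d′>0) = point
    (d′ ⊠ P ⊞ d ⊠ P′) (d′ ⊠ Q ⊞ d ⊠ Q′) ((1ₖ +ₖ 1ₖ) *ₖ (d *ₖ d′))
    (*-positive (+-positive 1-positive 1-positive) (*-positive d>0 d′>0))

  -- The zeros themselves are included: zero number i is `middle i i`. `centre` serves the formulas
  -- without zeros.
  data Test (m : ℕ) : Set where
    centre     : Test m
    over under : Fin m → Test m
    middle     : Fin m → Fin m → Test m

  testPoint : ∀ {n m} → (Fin m → Point n) → Test m → Point n
  testPoint p centre       = origin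
  testPoint p (over i)     = above (p i)
  testPoint p (under i)    = below (p i)
  testPoint p (middle i j) = midpoint (p i) (p j)

  conjunction : ∀ {n} m → (Fin m → QF n) → QF n
  conjunction zero    f = verum
  conjunction (suc m) f = f zero & conjunction m (f ∘ suc)

  eliminate : ∀ {n} → QF (suc n) → QF n
  eliminate ψ = at origin ψ
    & conjunction m (λ i → at (above (z i)) ψ)
    & conjunction m (λ i → at (below (z i)) ψ)
    & conjunction m (λ i → conjunction m (λ j → at (midpoint (z i) (z j)) ψ))
    where
    m = length (zeros ψ)
    z = List.lookup (zeros ψ)

  module Decision (Lower Equal : Linear 0 → Linear 0 → Set)
                  (order : ∀ f g → Lower f g ⊎ Equal f g ⊎ Lower g f) where

    holds : QF 0 → Bool
    holds (f ≋ g) with order f g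
    ... | inj₂ (inj₁ _) = true
    ... | _             = false
    holds (f ≪ g) with order f g
    ... | inj₁ _ = true
    ... | inj₂ _ = false
    holds falsum  = false
    holds (ψ ⊃ χ) = not (holds ψ) ∨ holds χ
    holds (ψ & χ) = holds ψ ∧ holds χ

-- Correctness of the elimination in divisible ordered modules

record OrderedModule (F : Frame) (S : Scalars) : Set₁ where
  open Frame F
  open Scalars S
  infixl 6 _∙_
  infixl 7 _·_
  field
    -- The ordered group inside the carrier: everything for addition, the positive elements for
    -- multiplication. The equations are required on the whole carrier, monotonicity and
    -- divisibility only on `Dom`.
    Dom      : Carrier → World → Set
    dom-mono : ∀ {x} → Mono (Dom x)
    _∙_      : Carrier → Carrier → Carrier
    ε        : Carrier
    _·_      : K → Carrier → Carrier
    ⟦_⟧      : C → Carrier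

    ∙-cong     : ∀ {x x′ y y′ w} → Eq x x′ w → Eq y y′ w → Eq (x ∙ y) (x′ ∙ y′) w
    ∙-assoc    : ∀ {w} x y z → Eq ((x ∙ y) ∙ z) (x ∙ (y ∙ z)) w
    ∙-comm     : ∀ {w} x y → Eq (x ∙ y) (y ∙ x) w
    ∙-identity : ∀ {w} x → Eq (x ∙ ε) x w
    ·-congʳ    : ∀ k {x y w} → Eq x y w → Eq (k · x) (k · y) w
    ·-congˡ    : ∀ {k l x w} → k ≃ l → Eq (k · x) (l · x) w
    1·         : ∀ {w} x → Eq (1ₖ · x) x w
    0·         : ∀ {w} x → Eq (0ₖ · x) ε w
    +·         : ∀ {w} k l x → Eq ((k +ₖ l) · x) (k · x ∙ l · x) w
    *·         : ∀ {w} k l x → Eq ((k *ₖ l) · x) (k · (l · x)) w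
    ·-comm     : ∀ {w} k l x → Eq (k · (l · x)) (l · (k · x)) w
    ·ε         : ∀ {w} k → Eq (k · ε) ε w
    ·∙         : ∀ {w} k x y → Eq (k · (x ∙ y)) (k · x ∙ k · y) w

    dom-ε : ∀ {w} → Dom ε w
    dom-∙ : ∀ {x y w} → Dom x w → Dom y w → Dom (x ∙ y) w
    dom-· : ∀ k {x w} → Dom x w → Dom (k · x) w
    dom-⟦⟧ : ∀ a {w} → Dom ⟦ a ⟧ w

    less-irrefl : ∀ {x w} → Less x x w → Absurd w
    less-trans  : ∀ {x y z w} → Less x y w → Less y z w → Less x z w
    compare     : ∀ x y {w} → ◇ (λ v → Less x y v ⊎ Eq x y v ⊎ Less y x v) w
    ∙-less      : ∀ {x y z w} → Dom x w → Dom y w → Dom z w → Less x y w → Less (x ∙ z) (y ∙ z) w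
    ·-less      : ∀ {k x y w} → Positive k → Dom x w → Dom y w → Less x y w → Less (k · x) (k · y) w
    divide      : ∀ {k p q w} → Positive k → Dom p w → Dom q w → ◇ (λ v → ∃ λ y → Dom y v × Eq (k · y ∙ q) p v) w
    ε<up        : ∀ {w} → Less ε ⟦ up ⟧ w

module Correctness {F : Frame} {S : Scalars} (M : OrderedModule F S) where
  open Frame F
  open Scalars S
  open Elimination S
  open OrderedModule M

  commutativeMonoid : World → CommutativeMonoid 0ℓ 0ℓ
  commutativeMonoid w = record
    { Carrier = Carrier ; _≈_ = λ x y → Eq x y w ; _∙_ = _∙_ ; ε = ε
    ; isCommutativeMonoid = record
      { isMonoid = record
        { isSemigroup = record
          { isMagma = record
            { isEquivalence = record { refl = eq-refl ; sym = eq-sym ; trans = eq-trans }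
            ; ∙-cong = ∙-cong }
          ; assoc = ∙-assoc }
        ; identity = (λ x → eq-trans (∙-comm ε x) (∙-identity x)) , ∙-identity }
      ; comm = ∙-comm } }

  module Reasoning {w : World} where
    open CommutativeMonoid (commutativeMonoid w) public using (setoid; identityˡ)
    open Relation.Binary.Reasoning.Setoid setoid public
    open Algebra.Solver.CommutativeMonoid (commutativeMonoid w) public using (solve; _⊜_) renaming (_⊕_ to infixr 5 _⊙_)

  Transfers : Carrier → Carrier → Carrier → Carrier → World → Set
  Transfers a b a′ b′ w =
    Implies (Less a b) (Less a′ b′) w × Implies (Eq a b) (Eq a′ b′) w × Implies (Less b a) (Less b′ a′) w

  -- By trichotomy one direction suffices: either of the two wrong outcomes for a and b would be
  -- carried over to a′ and b′ and contradict the given one. Cancellation laws thus come from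
  -- monotonicity.
  transfers-sym : ∀ {a b a′ b′ w} → Transfers a b a′ b′ w → Transfers a′ b′ a b w
  transfers-sym {a} {b} (l , q , g) =
    (λ e p → run less-regular (compare a b) λ where
      e′ (inj₁ r)        → r
      e′ (inj₂ (inj₁ r)) → explode less-regular
        (less-irrefl (less-resp (q (⊑-trans e e′) r) eq-refl (mono less-regular e′ p)))
      e′ (inj₂ (inj₂ r)) → explode less-regular
        (less-irrefl (less-trans (g (⊑-trans e e′) r) (mono less-regular e′ p)))) ,
    (λ e p → run eq-regular (compare a b) λ where
      e′ (inj₁ r)        → explode eq-regular
        (less-irrefl (less-resp (mono eq-regular e′ p) eq-refl (l (⊑-trans e e′) r)))
      e′ (inj₂ (inj₁ r)) → r
      e′ (inj₂ (inj₂ r)) → explode eq-regular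
        (less-irrefl (less-resp eq-refl (mono eq-regular e′ p) (g (⊑-trans e e′) r)))) ,
    (λ e p → run less-regular (compare a b) λ where
      e′ (inj₁ r)        → explode less-regular
        (less-irrefl (less-trans (l (⊑-trans e e′) r) (mono less-regular e′ p)))
      e′ (inj₂ (inj₁ r)) → explode less-regular
        (less-irrefl (less-resp eq-refl (q (⊑-trans e e′) r) (mono less-regular e′ p)))
      e′ (inj₂ (inj₂ r)) → r)

  transfers-trans : ∀ {a b a′ b′ a″ b″ w} → Transfers a b a′ b′ w → Transfers a′ b′ a″ b″ w → Transfers a b a″ b″ w
  transfers-trans (l , q , g) (l′ , q′ , g′) =
    (λ e p → l′ e (l e p)) , (λ e p → q′ e (q e p)) , (λ e p → g′ e (g e p))

  transfers-flip : ∀ {a b a′ b′ w} → Transfers a b a′ b′ w → Transfers b a b′ a′ w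
  transfers-flip (l , q , g) = g , (λ e p → eq-sym (q e (eq-sym p))) , l

  transfers-mono : ∀ {a b a′ b′} → Mono (Transfers a b a′ b′)
  transfers-mono e (l , q , g) =
    (λ e′ → l (⊑-trans e e′)) , (λ e′ → q (⊑-trans e e′)) , (λ e′ → g (⊑-trans e e′))

  transfers-eq : ∀ {a b a′ b′ w} → Eq a a′ w → Eq b b′ w → Transfers a b a′ b′ w
  transfers-eq p q =
    (λ e → less-resp (mono eq-regular e p) (mono eq-regular e q)) ,
    (λ e r → eq-trans (eq-sym (mono eq-regular e p)) (eq-trans r (mono eq-regular e q))) ,
    (λ e → less-resp (mono eq-regular e q) (mono eq-regular e p))

  transfers-less : ∀ {a b a′ b′ w} → Less a b w → Less a′ b′ w → Transfers a b a′ b′ w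
  transfers-less p q =
    (λ e _ → mono less-regular e q) ,
    (λ e r → explode eq-regular (less-irrefl (less-resp r eq-refl (mono less-regular e p)))) ,
    (λ e r → explode less-regular (less-irrefl (less-trans r (mono less-regular e p))))

  transfers-∙ : ∀ {a b c w} → Dom a w → Dom b w → Dom c w → Transfers a b (a ∙ c) (b ∙ c) w
  transfers-∙ a b c =
    (λ e → ∙-less (dom-mono e a) (dom-mono e b) (dom-mono e c)) ,
    (λ e p → ∙-cong p eq-refl) ,
    (λ e → ∙-less (dom-mono e b) (dom-mono e a) (dom-mono e c))

  transfers-· : ∀ {a b k w} → Positive k → Dom a w → Dom b w → Transfers a b (k · a) (k · b) w
  transfers-· {k = k} k>0 a b =
    (λ e → ·-less k>0 (dom-mono e a) (dom-mono e b)) ,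
    (λ e p → ·-congʳ k p) ,
    (λ e → ·-less k>0 (dom-mono e b) (dom-mono e a))

  value : ∀ {n} → Vec Carrier n → Linear n → Carrier
  value ρ (var i) = lookup ρ i
  value ρ (cst a) = ⟦ a ⟧
  value ρ null    = ε
  value ρ (f ⊞ g) = value ρ f ∙ value ρ g
  value ρ (k ⊠ f) = k · value ρ f

  Domain : ∀ {n} → Vec Carrier n → World → Set
  Domain ρ w = ∀ i → Dom (lookup ρ i) w

  domain-mono : ∀ {n} {ρ : Vec Carrier n} → Mono (Domain ρ)
  domain-mono e p i = dom-mono e (p i)

  domain-∷ : ∀ {n x} {ρ : Vec Carrier n} {w} → Dom x w → Domain ρ w → Domain (x ∷ ρ) w
  domain-∷ p q zero    = p
  domain-∷ p q (suc i) = q i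

  dom-value : ∀ {n} {ρ : Vec Carrier n} {w} → Domain ρ w → ∀ f → Dom (value ρ f) w
  dom-value p (var i) = p i
  dom-value p (cst a) = dom-⟦⟧ a
  dom-value p null    = dom-ε
  dom-value p (f ⊞ g) = dom-∙ (dom-value p f) (dom-value p g)
  dom-value p (k ⊠ f) = dom-· k (dom-value p f)

  ForceQ : ∀ {n} → Vec Carrier n → QF n → World → Set
  ForceQ ρ (f ≋ g) w = Eq (value ρ f) (value ρ g) w
  ForceQ ρ (f ≪ g) w = Less (value ρ f) (value ρ g) w
  ForceQ ρ falsum  w = Absurd w
  ForceQ ρ (ψ ⊃ χ) w = Implies (ForceQ ρ ψ) (ForceQ ρ χ) w
  ForceQ ρ (ψ & χ) w = ForceQ ρ ψ w × ForceQ ρ χ w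

  forceQ-regular : ∀ {n} {ρ : Vec Carrier n} ψ → Regular (ForceQ ρ ψ)
  forceQ-regular (f ≋ g) = eq-regular
  forceQ-regular (f ≪ g) = less-regular
  forceQ-regular falsum  = absurd-regular
  forceQ-regular (ψ ⊃ χ) = ⇒-regular (mono (forceQ-regular ψ)) (forceQ-regular χ)
  forceQ-regular (ψ & χ) = ×-regular (forceQ-regular ψ) (forceQ-regular χ)

  value-split : ∀ {n} x (ρ : Vec Carrier n) {w} f → Eq (value (x ∷ ρ) f) (coef f · x ∙ value ρ (rest f)) w
  value-split x ρ (var zero)    = eq-sym (eq-trans (∙-identity _) (1· x))
  value-split x ρ (var (suc i)) = eq-sym (eq-trans (∙-cong (0· x) eq-refl) (Reasoning.identityˡ _))
  value-split x ρ (cst a)       = eq-sym (eq-trans (∙-cong (0· x) eq-refl) (Reasoning.identityˡ _))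
  value-split x ρ null          = eq-sym (eq-trans (∙-cong (0· x) eq-refl) (Reasoning.identityˡ _))
  value-split x ρ (f ⊞ g) = begin
    value (x ∷ ρ) f ∙ value (x ∷ ρ) g
      ≈⟨ ∙-cong (value-split x ρ f) (value-split x ρ g) ⟩
    (coef f · x ∙ value ρ (rest f)) ∙ (coef g · x ∙ value ρ (rest g))
      ≈⟨ solve 4 (λ a b c d → (a ⊙ b) ⊙ (c ⊙ d) ⊜ (a ⊙ c) ⊙ (b ⊙ d)) eq-refl _ _ _ _ ⟩
    (coef f · x ∙ coef g · x) ∙ (value ρ (rest f) ∙ value ρ (rest g))
      ≈⟨ ∙-cong (+· _ _ x) eq-refl ⟨
    (coef f +ₖ coef g) · x ∙ (value ρ (rest f) ∙ value ρ (rest g)) ∎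
    where open Reasoning
  value-split x ρ (k ⊠ f) = begin
    k · value (x ∷ ρ) f                          ≈⟨ ·-congʳ k (value-split x ρ f) ⟩
    k · (coef f · x ∙ value ρ (rest f))          ≈⟨ ·∙ k _ _ ⟩
    k · (coef f · x) ∙ k · value ρ (rest f)      ≈⟨ ∙-cong (*· k _ x) eq-refl ⟨
    (k *ₖ coef f) · x ∙ k · value ρ (rest f)     ∎
    where open Reasoning

  record Located {n} (ρ : Vec Carrier n) (p : Point n) (y : Carrier) (w : World) : Set where
    constructor located
    open Point p
    field
      dom   : Dom y w
      solves : Eq (denominator · y ∙ value ρ subtrahend) (value ρ minuend) w

  located-mono : ∀ {n} {ρ : Vec Carrier n} {p y} → Mono (Located ρ p y)
  located-mono e (located a b) = located (dom-mono e a) (mono eq-regular e b)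

  evaluate-correct : ∀ {n} {ρ : Vec Carrier n} {p y w} → Located ρ p y w → ∀ f l →
    Eq (value ρ (evaluate p f l))
       (Point.denominator p · value (y ∷ ρ) f ∙ (coef f · value ρ (Point.subtrahend p) ∙ l · value ρ (Point.subtrahend p))) w
  evaluate-correct {ρ = ρ} {point P Q d _} {y} (located _ q) f l = begin
    (k · p ∙ l · r) ∙ d · s
      ≈⟨ ∙-cong (∙-cong (·-congʳ k (eq-sym q)) eq-refl) eq-refl ⟩
    (k · (d · y ∙ r) ∙ l · r) ∙ d · s
      ≈⟨ ∙-cong (∙-cong (eq-trans (·∙ k _ _) (∙-cong (·-comm k d y) eq-refl)) eq-refl) eq-refl ⟩
    (((d · (k · y)) ∙ k · r) ∙ l · r) ∙ d · s
      ≈⟨ solve 4 (λ a b c e → ((a ⊙ b) ⊙ c) ⊙ e ⊜ (a ⊙ e) ⊙ (b ⊙ c)) eq-refl _ _ _ _ ⟩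
    (d · (k · y) ∙ d · s) ∙ (k · r ∙ l · r)
      ≈⟨ ∙-cong (eq-trans (·-congʳ d (value-split y ρ f)) (·∙ d _ _)) eq-refl ⟨
    d · value (y ∷ ρ) f ∙ (k · r ∙ l · r) ∎
    where
    open Reasoning
    k = coef f
    p = value ρ P
    r = value ρ Q
    s = value ρ (rest f)

  -- Both sides are multiplied by the denominator and increased by (coef f + coef g) · Q; for g the
  -- two summands of the increment come in the opposite order, hence the commutation.
  evaluate-transfers : ∀ {n} {ρ : Vec Carrier n} {p y w} → Domain ρ w → Located ρ p y w → ∀ f g →
    Transfers (value (y ∷ ρ) f) (value (y ∷ ρ) g) (value ρ (evaluate p f (coef g))) (value ρ (evaluate p g (coef f))) w
  evaluate-transfers {ρ = ρ} {p} {y} D loc f g =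
    transfers-trans (transfers-· (Point.positive p) F′ G′)
    (transfers-trans (transfers-∙ (dom-· _ F′) (dom-· _ G′) (dom-∙ (dom-· _ Q′) (dom-· _ Q′)))
    (transfers-eq (eq-sym (evaluate-correct loc f (coef g)))
      (eq-sym (eq-trans (evaluate-correct loc g (coef f)) (∙-cong eq-refl (∙-comm _ _))))))
    where
    D′ = domain-∷ {x = y} {ρ} (Located.dom loc) D
    F′ = dom-value D′ f
    G′ = dom-value D′ g
    Q′ = dom-value D (Point.subtrahend p)

  mutual
    at⁺ : ∀ {n} {ρ : Vec Carrier n} {p y w} → Domain ρ w → Located ρ p y w → ∀ ψ →
          ForceQ (y ∷ ρ) ψ w → ForceQ ρ (at p ψ) w
    at⁺ D loc (f ≋ g) h = proj₁ (proj₂ (evaluate-transfers D loc f g)) ⊑-refl h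
    at⁺ D loc (f ≪ g) h = proj₁ (evaluate-transfers D loc f g) ⊑-refl h
    at⁺ D loc falsum  h = h
    at⁺ {ρ = ρ} D loc (ψ ⊃ χ) h e p =
      at⁺ (domain-mono {ρ = ρ} e D) (located-mono e loc) χ (h e (at⁻ (domain-mono {ρ = ρ} e D) (located-mono e loc) ψ p))
    at⁺ D loc (ψ & χ) (h , h′) = at⁺ D loc ψ h , at⁺ D loc χ h′

    at⁻ : ∀ {n} {ρ : Vec Carrier n} {p y w} → Domain ρ w → Located ρ p y w → ∀ ψ →
          ForceQ ρ (at p ψ) w → ForceQ (y ∷ ρ) ψ w
    at⁻ D loc (f ≋ g) h = proj₁ (proj₂ (transfers-sym (evaluate-transfers D loc f g))) ⊑-refl h
    at⁻ D loc (f ≪ g) h = proj₁ (transfers-sym (evaluate-transfers D loc f g)) ⊑-refl h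
    at⁻ D loc falsum  h = h
    at⁻ {ρ = ρ} D loc (ψ ⊃ χ) h e p =
      at⁻ (domain-mono {ρ = ρ} e D) (located-mono e loc) χ (h e (at⁺ (domain-mono {ρ = ρ} e D) (located-mono e loc) ψ p))
    at⁻ D loc (ψ & χ) (h , h′) = at⁻ D loc ψ h , at⁻ D loc χ h′

  -- Zeros of an atom are the only places where its truth value can change.
  Alike : ∀ {n} → Vec Carrier n → Carrier → Carrier → World → Point n → Set
  Alike ρ x y w p = ∃ λ v → Located ρ p v w × Transfers x v y v w

  alike-mono : ∀ {n} {ρ : Vec Carrier n} {x y p w v} → w ⊑ v → Alike ρ x y w p → Alike ρ x y v p
  alike-mono e (v , loc , t) = v , located-mono e loc , transfers-mono e t

  alikes-mono : ∀ {n} {ρ : Vec Carrier n} {x y ps w v} → w ⊑ v → All (Alike ρ x y w) ps → All (Alike ρ x y v) ps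
  alikes-mono e []       = []
  alikes-mono e (a ∷ as) = alike-mono e a ∷ alikes-mono e as

  alikes-sym : ∀ {n} {ρ : Vec Carrier n} {x y ps w} → All (Alike ρ x y w) ps → All (Alike ρ y x w) ps
  alikes-sym []                  = []
  alikes-sym ((v , loc , t) ∷ as) = (v , loc , transfers-sym t) ∷ alikes-sym as

  -- Multiply v and x by d, add rest g, so that the left side becomes rest f, and then add coef f ·
  -- x: the comparison of v with x has become that of f with g at x.
  zero-transfers : ∀ {n} {ρ : Vec Carrier n} {x v d w} (f g : Linear (suc n)) (d>0 : Positive d) →
    coef f +ₖ d ≃ coef g → Domain ρ w → Dom x w → Located ρ (point (rest f) (rest g) d d>0) v w →
    Transfers v x (value (x ∷ ρ) f) (value (x ∷ ρ) g) w
  zero-transfers {ρ = ρ} {x} {v} {d} f g d>0 p D X (located V q) =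
    transfers-trans (transfers-· d>0 V X)
    (transfers-trans (transfers-∙ (dom-· d V) (dom-· d X) G′)
    (transfers-trans (transfers-eq q eq-refl)
    (transfers-trans (transfers-∙ F′ (dom-∙ (dom-· d X) G′) (dom-· (coef f) X))
    (transfers-eq
      (begin
        value ρ (rest f) ∙ coef f · x  ≈⟨ ∙-comm _ _ ⟩
        coef f · x ∙ value ρ (rest f)  ≈⟨ value-split x ρ f ⟨
        value (x ∷ ρ) f ∎)
      (begin
        (d · x ∙ value ρ (rest g)) ∙ coef f · x
          ≈⟨ solve 3 (λ a b c → (a ⊙ b) ⊙ c ⊜ (c ⊙ a) ⊙ b) eq-refl _ _ _ ⟩
        (coef f · x ∙ d · x) ∙ value ρ (rest g)
          ≈⟨ ∙-cong (eq-trans (eq-sym (+· _ _ x)) (·-congˡ p)) eq-refl ⟩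
        coef g · x ∙ value ρ (rest g)  ≈⟨ value-split x ρ g ⟨
        value (x ∷ ρ) g ∎)))))
    where
    open Reasoning
    F′ = dom-value D (rest f)
    G′ = dom-value D (rest g)

  atom-transfers : ∀ {n} {ρ : Vec Carrier n} {x y w} → Domain ρ w → Dom x w → Dom y w → ∀ f g →
    All (Alike ρ x y w) (atomZeros f g) →
    Transfers (value (x ∷ ρ) f) (value (x ∷ ρ) g) (value (y ∷ ρ) f) (value (y ∷ ρ) g) w
  atom-transfers {ρ = ρ} {x} {y} {w} D X Y f g as with difference (coef f) (coef g)
  atom-transfers D X Y f g ((v , loc , t) ∷ []) | inj₁ (d , d>0 , p) =
    transfers-trans (transfers-sym (zero-transfers f g d>0 p D X loc))
    (transfers-trans (transfers-flip t) (zero-transfers f g d>0 p D Y loc))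
  atom-transfers {ρ = ρ} {x} {y} {w} D X Y f g [] | inj₂ (inj₁ p) =
    transfers-trans (transfers-sym (parallel x X)) (parallel y Y)
    where
    -- With equal coefficients both sides differ from their rests by the same summand, so every z
    -- gives the outcome of comparing the rests.
    parallel : ∀ z → Dom z w → Transfers (value ρ (rest f)) (value ρ (rest g)) (value (z ∷ ρ) f) (value (z ∷ ρ) g) w
    parallel z Z = transfers-trans
      (transfers-∙ (dom-value D (rest f)) (dom-value D (rest g)) (dom-· (coef f) Z))
      (transfers-eq (eq-trans (∙-comm _ _) (eq-sym (value-split z ρ f)))
        (eq-trans (∙-comm _ _) (eq-trans (∙-cong (·-congˡ p) eq-refl) (eq-sym (value-split z ρ g)))))
  atom-transfers D X Y f g ((v , loc , t) ∷ []) | inj₂ (inj₂ (d , d>0 , p)) = transfers-flip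
    (transfers-trans (transfers-sym (zero-transfers g f d>0 p D X loc))
    (transfers-trans (transfers-flip t) (zero-transfers g f d>0 p D Y loc)))

  alike-force : ∀ {n} {ρ : Vec Carrier n} {x y w} → Domain ρ w → Dom x w → Dom y w → ∀ ψ →
                All (Alike ρ x y w) (zeros ψ) → ForceQ (x ∷ ρ) ψ w → ForceQ (y ∷ ρ) ψ w
  alike-force D X Y (f ≋ g) as h = proj₁ (proj₂ (atom-transfers D X Y f g as)) ⊑-refl h
  alike-force D X Y (f ≪ g) as h = proj₁ (atom-transfers D X Y f g as) ⊑-refl h
  alike-force D X Y falsum  as h = h
  alike-force {ρ = ρ} D X Y (ψ ⊃ χ) as h e p =
    alike-force (domain-mono {ρ = ρ} e D) (dom-mono e X) (dom-mono e Y) χ (alikes-mono e (All.++⁻ʳ (zeros ψ) as))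
      (h e (alike-force (domain-mono {ρ = ρ} e D) (dom-mono e Y) (dom-mono e X) ψ
        (alikes-sym (alikes-mono e (All.++⁻ˡ (zeros ψ) as))) p))
  alike-force D X Y (ψ & χ) as (h , h′) =
    alike-force D X Y ψ (All.++⁻ˡ (zeros ψ) as) h , alike-force D X Y χ (All.++⁻ʳ (zeros ψ) as) h′

  -- Choice for finitely many `◇`-statements. Each further choice may enlarge the world, so the
  -- earlier results must be monotone.
  family : ∀ {m} {P : Fin m → World → Set} {w} → (∀ i → Mono (P i)) → (∀ i → ◇ (P i) w) → ◇ (λ v → ∀ i → P i v) w
  family {zero}  m f e k = k ⊑-refl (λ ())
  family {suc n} m f =
    ◇-bind (f zero) λ e p →
    ◇-map (family (m ∘ suc) (λ i → ◇-mono e (f (suc i)))) λ e′ q → λ where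
      zero    → m zero e′ p
      (suc i) → q i

  some-or-all : ∀ {m} {P Q : Fin m → Set} → (∀ i → P i ⊎ Q i) → ∃ P ⊎ (∀ i → Q i)
  some-or-all {zero}  f = inj₂ (λ ())
  some-or-all {suc m} f with f zero | some-or-all (f ∘ suc)
  ... | inj₁ p | _            = inj₁ (zero , p)
  ... | inj₂ q | inj₁ (i , p) = inj₁ (suc i , p)
  ... | inj₂ q | inj₂ r       = inj₂ λ { zero → q ; (suc i) → r i }

  -- Serves twice, for the last zero below x and, with the order reversed, for the first zero above
  -- x.
  greatest : ∀ {m} {P Q : Fin m → Set} {_≼_ : Fin m → Fin m → Set} →
             (∀ i j → i ≼ j ⊎ j ≼ i) → (∀ {i j k} → i ≼ j → j ≼ k → i ≼ k) → (∀ i → P i ⊎ Q i) →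
             (∀ i → Q i) ⊎ (∃ λ i → P i × (∀ j → Q j ⊎ j ≼ i))
  greatest {zero}  total trans f = inj₁ (λ ())
  greatest {suc m} total trans f with f zero | greatest (λ i j → total (suc i) (suc j)) trans (f ∘ suc)
  -- Reflexivity comes from totality at equal arguments.
  ... | inj₁ p | inj₁ r           =
    inj₂ (zero , p , λ { zero → inj₂ (reduce (total zero zero)) ; (suc i) → inj₁ (r i) })
  ... | inj₂ q | inj₁ r           = inj₁ λ { zero → q ; (suc i) → r i }
  ... | inj₂ q | inj₂ (i , p , h) = inj₂ (suc i , p , λ { zero → inj₁ q ; (suc j) → h j })
  ... | inj₁ p | inj₂ (i , p′ , h) with total zero (suc i)
  ...   | inj₁ z≼i = inj₂ (suc i , p′ , λ { zero → inj₂ z≼i ; (suc j) → h j })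
  ...   | inj₂ i≼z = inj₂ (zero , p , λ
    { zero    → inj₂ (reduce (total zero zero))
    ; (suc j) → map₂ (λ j≼i → trans j≼i i≼z) (h j) })

  conjunction⁺ : ∀ {n} {ρ : Vec Carrier n} {w} m {f} → (∀ i → ForceQ ρ (f i) w) → ForceQ ρ (conjunction m f) w
  conjunction⁺ zero    h = λ _ a → a
  conjunction⁺ (suc m) h = h zero , conjunction⁺ m (h ∘ suc)

  conjunction⁻ : ∀ {n} {ρ : Vec Carrier n} {w} m {f} → ForceQ ρ (conjunction m f) w → ∀ i → ForceQ ρ (f i) w
  conjunction⁻ (suc m) (h , h′) zero    = h
  conjunction⁻ (suc m) (h , h′) (suc i) = conjunction⁻ m h′ i

  module _ {n} {ρ : Vec Carrier n} where
    open Reasoning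

    locate : ∀ {w} → Domain ρ w → ∀ p → ◇ (λ v → ∃ λ y → Located ρ p y v) w
    locate D (point P Q d d>0) = ◇-map (divide d>0 (dom-value D P) (dom-value D Q)) (λ { _ (y , a , b) → y , located a b })

    located-origin : ∀ {w} → Located ρ origin ε w
    located-origin = located dom-ε (eq-trans (∙-identity _) (·ε _))

    located-above : ∀ {p v w} → Located ρ p v w → Located ρ (above p) (v ∙ ⟦ up ⟧) w
    located-above {point P Q d _} {v} (located a b) = located (dom-∙ a (dom-⟦⟧ up)) (begin
      d · (v ∙ ⟦ up ⟧) ∙ value ρ Q      ≈⟨ ∙-cong (·∙ d _ _) eq-refl ⟩
      (d · v ∙ d · ⟦ up ⟧) ∙ value ρ Q  ≈⟨ solve 3 (λ a b c → (a ⊙ b) ⊙ c ⊜ (a ⊙ c) ⊙ b) eq-refl _ _ _ ⟩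
      (d · v ∙ value ρ Q) ∙ d · ⟦ up ⟧  ≈⟨ ∙-cong b eq-refl ⟩
      value ρ P ∙ d · ⟦ up ⟧ ∎)

    located-below : ∀ {p v y w} → Located ρ p v w → Dom y w → Eq (y ∙ ⟦ up ⟧) v w → Located ρ (below p) y w
    located-below {point P Q d _} {v} {y} (located a b) Y q = located Y (begin
      d · y ∙ (value ρ Q ∙ d · ⟦ up ⟧)  ≈⟨ solve 3 (λ a b c → a ⊙ (c ⊙ b) ⊜ (a ⊙ b) ⊙ c) eq-refl _ _ _ ⟩
      (d · y ∙ d · ⟦ up ⟧) ∙ value ρ Q  ≈⟨ ∙-cong (eq-trans (·-congʳ d (eq-sym q)) (·∙ d _ _)) eq-refl ⟨
      d · v ∙ value ρ Q                 ≈⟨ b ⟩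
      value ρ P ∎)

    2ₖ : K
    2ₖ = 1ₖ +ₖ 1ₖ

    double : ∀ {w} x → Eq (2ₖ · x) (x ∙ x) w
    double x = eq-trans (+· _ _ x) (∙-cong (1· x) (1· x))

    located-midpoint : ∀ {p p′ v v′ y w} → Located ρ p v w → Located ρ p′ v′ w → Dom y w →
                       Eq (2ₖ · y) (v ∙ v′) w → Located ρ (midpoint p p′) y w
    located-midpoint {point P Q d _} {point P′ Q′ d′ _} {v} {v′} {y} (located a b) (located a′ b′) Y q = located Y (begin
      (2ₖ *ₖ (d *ₖ d′)) · y ∙ (d′ · r ∙ d · r′)
        ≈⟨ ∙-cong (eq-trans (*· _ _ y) (eq-trans (·-congʳ 2ₖ (*· d d′ y)) (eq-trans (·-comm 2ₖ d _)
             (·-congʳ d (·-comm 2ₖ d′ y))))) eq-refl ⟩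
      d · (d′ · (2ₖ · y)) ∙ (d′ · r ∙ d · r′)
        ≈⟨ ∙-cong (eq-trans (·-congʳ d (eq-trans (·-congʳ d′ q) (·∙ d′ v v′))) (·∙ d _ _)) eq-refl ⟩
      (d · (d′ · v) ∙ d · (d′ · v′)) ∙ (d′ · r ∙ d · r′)
        ≈⟨ ∙-cong (∙-cong (·-comm d d′ v) eq-refl) eq-refl ⟩
      (d′ · (d · v) ∙ d · (d′ · v′)) ∙ (d′ · r ∙ d · r′)
        ≈⟨ solve 4 (λ a b c e → (a ⊙ b) ⊙ (c ⊙ e) ⊜ (a ⊙ c) ⊙ (b ⊙ e)) eq-refl _ _ _ _ ⟩
      (d′ · (d · v) ∙ d′ · r) ∙ (d · (d′ · v′) ∙ d · r′)
        ≈⟨ ∙-cong (·∙ d′ _ _) (·∙ d _ _) ⟨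
      d′ · (d · v ∙ r) ∙ d · (d′ · v′ ∙ r′)
        ≈⟨ ∙-cong (·-congʳ d′ b) (·-congʳ d b′) ⟩
      d′ · value ρ P ∙ d · value ρ P′ ∎)
      where
      r  = value ρ Q
      r′ = value ρ Q′

    2-positive : Positive 2ₖ
    2-positive = +-positive 1-positive 1-positive

    less-up : ∀ {x w} → Dom x w → Less x (x ∙ ⟦ up ⟧) w
    less-up X = less-resp (eq-trans (∙-comm _ _) (∙-identity _)) (∙-comm _ _) (∙-less dom-ε (dom-⟦⟧ up) X ε<up)

    between : ∀ {v v′ y w} → Dom v w → Dom v′ w → Dom y w → Eq (2ₖ · y) (v ∙ v′) w → Less v v′ w →
              Less v y w × Less y v′ w
    between {v} {v′} {y} V V′ Y q l =
      proj₁ (transfers-sym (transfers-· 2-positive V Y)) ⊑-refl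
        (less-resp (eq-sym (double v)) (eq-trans (∙-comm _ _) (eq-sym q)) (∙-less V V′ V l)) ,
      proj₁ (transfers-sym (transfers-· 2-positive Y V′)) ⊑-refl
        (less-resp (eq-sym q) (eq-sym (double v′)) (∙-less V V′ V′ l))

    _≤[_]_ : Carrier → World → Carrier → Set
    x ≤[ w ] y = Less x y w ⊎ Eq x y w

    <-≤-trans : ∀ {x y z w} → Less x y w → y ≤[ w ] z → Less x z w
    <-≤-trans l (inj₁ m) = less-trans l m
    <-≤-trans l (inj₂ q) = less-resp eq-refl q l

    ≤-<-trans : ∀ {x y z w} → x ≤[ w ] y → Less y z w → Less x z w
    ≤-<-trans (inj₁ l) m = less-trans l m
    ≤-<-trans (inj₂ q) m = less-resp (eq-sym q) eq-refl m

    ≤-trans : ∀ {x y z w} → x ≤[ w ] y → y ≤[ w ] z → x ≤[ w ] z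
    ≤-trans (inj₁ l) m        = inj₁ (<-≤-trans l m)
    ≤-trans (inj₂ q) (inj₁ m) = inj₁ (less-resp (eq-sym q) eq-refl m)
    ≤-trans (inj₂ q) (inj₂ r) = inj₂ (eq-trans q r)

    -- Trichotomy holds only under `◇`. Once a world has settled all comparisons of x with the zeros
    -- and of the zeros with each other, the test point for x can be found by plain case
    -- distinction.
    record Decided {m} (p : Fin m → Point n) (x : Carrier) (w : World) : Set where
      field
        zeroAt  : Fin m → Carrier
        isZero  : ∀ i → Located ρ (p i) (zeroAt i) w
        against : ∀ i → Less x (zeroAt i) w ⊎ Eq x (zeroAt i) w ⊎ Less (zeroAt i) x w
        each-other : ∀ i j → Less (zeroAt i) (zeroAt j) w ⊎ Eq (zeroAt i) (zeroAt j) w ⊎ Less (zeroAt j) (zeroAt i) w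

    compared-mono : ∀ {x y} → Mono (λ w → Less x y w ⊎ Eq x y w ⊎ Less y x w)
    compared-mono e (inj₁ p)        = inj₁ (mono less-regular e p)
    compared-mono e (inj₂ (inj₁ p)) = inj₂ (inj₁ (mono eq-regular e p))
    compared-mono e (inj₂ (inj₂ p)) = inj₂ (inj₂ (mono less-regular e p))

    decide-order : ∀ {m w} (p : Fin m → Point n) x → Domain ρ w → ◇ (Decided p x) w
    decide-order p x D =
      ◇-bind (family (λ i e (y , l) → y , located-mono e l) (λ i → locate D (p i))) λ e f →
      ◇-bind (family (λ i → compared-mono) (λ i → compare x (proj₁ (f i)))) λ e′ g →
      ◇-map (family (λ i e h j → compared-mono e (h j)) (λ i → family (λ j → compared-mono)
              (λ j → compare (proj₁ (f i)) (proj₁ (f j))))) λ e″ h → record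
        { zeroAt       = proj₁ ∘ f
        ; isZero       = λ i → located-mono (⊑-trans e′ e″) (proj₂ (f i))
        ; against      = λ i → compared-mono e″ (g i)
        ; each-other = h
        }

    module _ {w x m} {p : Fin m → Point n} (decided : Decided p x w) where
      open Decided decided

      module _ {v} (e : w ⊑ v) where

        alike-off-zeros : ∀ {y} → (∀ i → Less x (zeroAt i) w ⊎ Less (zeroAt i) x w) →
          (∀ i → Less x (zeroAt i) w → Less y (zeroAt i) v) → (∀ i → Less (zeroAt i) x w → Less (zeroAt i) y v) →
          ∀ i → Alike ρ x y v (p i)
        alike-off-zeros strict lower upper i with strict i
        ... | inj₁ l = zeroAt i , located-mono e (isZero i) , transfers-less (mono less-regular e l) (lower i l)
        ... | inj₂ l = zeroAt i , located-mono e (isZero i) ,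
                       transfers-flip (transfers-less (mono less-regular e l) (upper i l))

        ≤-mono : ∀ {y z} → y ≤[ w ] z → y ≤[ v ] z
        ≤-mono (inj₁ l) = inj₁ (mono less-regular e l)
        ≤-mono (inj₂ q) = inj₂ (mono eq-regular e q)

        contradictory : ∀ {y z s t} → Less y z w → Less z y w → Less s t v
        contradictory l l′ = explode less-regular (absurd-mono e (less-irrefl (less-trans l l′)))

      Predecessor Successor : Fin m → Set
      Predecessor i = Less (zeroAt i) x w × (∀ j → Less x (zeroAt j) w ⊎ zeroAt j ≤[ w ] zeroAt i)
      Successor   i = Less x (zeroAt i) w × (∀ j → Less (zeroAt j) x w ⊎ zeroAt i ≤[ w ] zeroAt j)

      past : ∀ {y i v} → w ⊑ v → Predecessor i → Less (zeroAt i) y v → ∀ j → Less (zeroAt j) x w → Less (zeroAt j) y v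
      past e (_ , h) l j l′ with h j
      ... | inj₁ l″ = contradictory e l′ l″
      ... | inj₂ le = ≤-<-trans (≤-mono e le) l

      before : ∀ {y i v} → w ⊑ v → Successor i → Less y (zeroAt i) v → ∀ j → Less x (zeroAt j) w → Less y (zeroAt j) v
      before e (_ , h) l j l′ with h j
      ... | inj₁ l″ = contradictory e l′ l″
      ... | inj₂ le = <-≤-trans l (≤-mono e le)

      module _ (strict : ∀ i → Less x (zeroAt i) w ⊎ Less (zeroAt i) x w) where

        opposite : ∀ i → Less (zeroAt i) x w ⊎ Less x (zeroAt i) w
        opposite i with strict i
        ... | inj₁ l = inj₂ l
        ... | inj₂ l = inj₁ l

        ≤-total : ∀ i j → zeroAt i ≤[ w ] zeroAt j ⊎ zeroAt j ≤[ w ] zeroAt i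
        ≤-total i j with each-other i j
        ... | inj₁ l        = inj₁ (inj₁ l)
        ... | inj₂ (inj₁ q) = inj₁ (inj₂ q)
        ... | inj₂ (inj₂ l) = inj₂ (inj₁ l)

        predecessor : (∀ i → Less x (zeroAt i) w) ⊎ ∃ Predecessor
        predecessor = greatest ≤-total ≤-trans opposite

        successor : (∀ i → Less (zeroAt i) x w) ⊎ ∃ Successor
        successor = greatest (λ i j → ≤-total j i) (λ a b → ≤-trans b a) strict

    Represents : ∀ {m} → (Fin m → Point n) → Carrier → Test m → World → Set
    Represents p x t v = ∃ λ y → Located ρ (testPoint p t) y v × (∀ i → Alike ρ x y v (p i))

    represents-mono : ∀ {m} {p : Fin m → Point n} {x} → Mono (λ v → ∃ λ t → Represents p x t v)
    represents-mono e (t , y , l , h) = t , y , located-mono e l , λ i → alike-mono e (h i)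

    middle-first : ∀ {A B C : Set} → A ⊎ B ⊎ C → B ⊎ (A ⊎ C)
    middle-first (inj₁ a)        = inj₂ (inj₁ a)
    middle-first (inj₂ (inj₁ b)) = inj₁ b
    middle-first (inj₂ (inj₂ c)) = inj₂ (inj₂ c)

    -- Either x is a zero, or it lies in an open interval bounded by neighbouring zeros, possibly
    -- unbounded on one side or both. No atom changes its truth value inside such an interval, and
    -- each interval contains a test point.
    represented : ∀ {w x m} {p : Fin m → Point n} → Decided p x w → ◇ (λ v → ∃ λ t → Represents p x t v) w
    represented {w} {x} {m} {p} D with some-or-all (middle-first ∘ Decided.against D)
    ... | inj₁ (i , q) = ◇-return represents-mono
      (middle i i , zeroAt i ,
       located-midpoint (isZero i) (isZero i) (Located.dom (isZero i)) (double (zeroAt i)) ,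
       λ j → zeroAt j , isZero j , transfers-eq q eq-refl)
      where open Decided D
    ... | inj₂ strict with predecessor D strict | successor D strict
    -- Every zero is both above and below x: there are none, or the world is absurd. In both cases
    -- the origin will do.
    ...   | inj₁ lo | inj₁ hi = ◇-return represents-mono
      (centre , ε , located-origin , alike-off-zeros D ⊑-refl strict
        (λ i _ → contradictory D ⊑-refl (lo i) (hi i)) (λ i _ → contradictory D ⊑-refl (lo i) (hi i)))
    ...   | inj₁ lo | inj₂ (u , U) =
      ◇-map (divide 1-positive (Located.dom (isZero u)) (dom-⟦⟧ up)) λ { e (y , Y , q) →
        let q′ = eq-trans (∙-cong (eq-sym (1· y)) eq-refl) q in
        under u , y , located-below (located-mono e (isZero u)) Y q′ , alike-off-zeros D e strict
          (before D e U (less-resp eq-refl q′ (less-up Y)))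
          (λ i l → contradictory D e l (lo i)) }
      where open Decided D
    ...   | inj₂ (l , L) | inj₁ hi = ◇-return represents-mono
      (over l , zeroAt l ∙ ⟦ up ⟧ , located-above (isZero l) , alike-off-zeros D ⊑-refl strict
        (λ i l′ → contradictory D ⊑-refl l′ (hi i))
        (past D ⊑-refl L (less-up (Located.dom (isZero l)))))
      where open Decided D
    ...   | inj₂ (l , L) | inj₂ (u , U) =
      ◇-map (divide 2-positive (dom-∙ (Located.dom (isZero l)) (Located.dom (isZero u))) dom-ε) λ { e (y , Y , q) →
        let q′ = eq-trans (eq-sym (∙-identity _)) q
            l′ = located-mono e (isZero l)
            u′ = located-mono e (isZero u)
            l<y , y<u = between (Located.dom l′) (Located.dom u′) Y q′
                          (mono less-regular e (less-trans (proj₁ L) (proj₁ U)))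
        in
        middle l u , y , located-midpoint l′ u′ Y q′ ,
        alike-off-zeros D e strict (before D e U y<u) (past D e L l<y) }
      where open Decided D

    force-test : ∀ {w ψ} → ForceQ ρ (eliminate ψ) w → ∀ t → ForceQ ρ (at (testPoint (List.lookup (zeros ψ)) t) ψ) w
    force-test {ψ = ψ} (h , _) centre               = h
    force-test {ψ = ψ} (_ , h , _) (over i)         = conjunction⁻ (length (zeros ψ)) h i
    force-test {ψ = ψ} (_ , _ , h , _) (under i)    = conjunction⁻ (length (zeros ψ)) h i
    force-test {ψ = ψ} (_ , _ , _ , h) (middle i j) =
      conjunction⁻ (length (zeros ψ)) (conjunction⁻ (length (zeros ψ)) h i) j

    -- The test point representing x lies on the same side of every zero as x, so ψ can be moved
    -- from there to x.
    eliminate⁻ : ∀ {x w} ψ → Domain ρ w → Dom x w → ForceQ ρ (eliminate ψ) w → ForceQ (x ∷ ρ) ψ w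
    eliminate⁻ {x} ψ D X h =
      run (forceQ-regular ψ) (decide-order (List.lookup (zeros ψ)) x D) λ e d →
      run (forceQ-regular ψ) (represented d) λ { e′ (t , y , l , a) →
        let e″ = ⊑-trans e e′
            D′ = domain-mono {ρ = ρ} e″ D in
        alike-force D′ (Located.dom l) (dom-mono e″ X) ψ (alikes-sym (all-lookup (zeros ψ) a))
          (at⁻ D′ l ψ (mono (forceQ-regular (at (testPoint (List.lookup (zeros ψ)) t) ψ)) e″ (force-test {ψ = ψ} h t))) }
      where
      all-lookup : ∀ {P : Point n → Set} ps → (∀ i → P (List.lookup ps i)) → All P ps
      all-lookup []       h = []
      all-lookup (p ∷ ps) h = h zero ∷ all-lookup ps (h ∘ suc)

    eliminate⁺ : ∀ {w} ψ → Domain ρ w → (∀ x → Implies (Dom x) (ForceQ (x ∷ ρ) ψ) w) → ForceQ ρ (eliminate ψ) w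
    eliminate⁺ {w} ψ D h =
      test origin ,
      conjunction⁺ m (λ i → test (above (z i))) ,
      conjunction⁺ m (λ i → test (below (z i))) ,
      conjunction⁺ m (λ i → conjunction⁺ m (λ j → test (midpoint (z i) (z j))))
      where
      m = length (zeros ψ)
      z = List.lookup (zeros ψ)
      test : ∀ p → ForceQ ρ (at p ψ) w
      test p = run (forceQ-regular (at p ψ)) (locate D p) λ { e (y , l) →
        at⁺ (domain-mono {ρ = ρ} e D) l ψ (h y e (Located.dom l)) }

  module DecisionCorrectness (Lower Equal : Linear 0 → Linear 0 → Set)
    (order : ∀ f g → Lower f g ⊎ Equal f g ⊎ Lower g f)
    (lower-less : ∀ f g → Lower f g → ∀ {w} → Less (value [] f) (value [] g) w)
    (equal-eq : ∀ f g → Equal f g → ∀ {w} → Eq (value [] f) (value [] g) w) where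
    open Decision Lower Equal order

    -- Closed terms are ordered outside the frame, so a verdict concerns all worlds at once. An
    -- implication with refuted premise needs this, because the premise may be forced in a larger
    -- world.
    Verdict : Bool → QF 0 → Set
    Verdict true  ψ = ∀ {w} → ForceQ [] ψ w
    Verdict false ψ = ∀ {w} → ForceQ [] ψ w → Absurd w

    verdict : ∀ ψ → Verdict (holds ψ) ψ
    verdict (f ≋ g) with order f g
    ... | inj₁ l        = λ p → less-irrefl (less-resp p eq-refl (lower-less _ _ l))
    ... | inj₂ (inj₁ q) = equal-eq f g q
    ... | inj₂ (inj₂ l) = λ p → less-irrefl (less-resp eq-refl p (lower-less _ _ l))
    verdict (f ≪ g) with order f g
    ... | inj₁ l        = lower-less f g l
    ... | inj₂ (inj₁ q) = λ p → less-irrefl (less-resp (equal-eq f g q) eq-refl p)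
    ... | inj₂ (inj₂ l) = λ p → less-irrefl (less-trans p (lower-less _ _ l))
    verdict falsum = id
    verdict (ψ ⊃ χ) with holds ψ | holds χ | verdict ψ | verdict χ
    ... | false | _     | p | _ = λ _ a → explode (forceQ-regular χ) (p a)
    ... | true  | true  | _ | q = λ _ _ → q
    ... | true  | false | p | q = λ h → q (h ⊑-refl p)
    verdict (ψ & χ) with holds ψ | holds χ | verdict ψ | verdict χ
    ... | false | _     | p | _ = λ h → p (proj₁ h)
    ... | true  | true  | p | q = p , q
    ... | true  | false | _ | q = λ h → q (proj₂ h)

-- Elementary arithmetic of ordered fields

module OrderedField (R : CompleteOrderedField) where
  private module R = CompleteOrderedField R
  open R hiding (refl; +-assoc; +-comm)
  open IsStrictTotalOrder isStrictTotalOrder using (irrefl; <-resp-≈) renaming (trans to lt-trans)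
  open Algebra.Properties.Ring ring
  open Relation.Binary.Reasoning.Setoid setoid

  <-resp : ∀ {x x′ y y′} → x ≈ x′ → y ≈ y′ → x < y → x′ < y′
  <-resp p q l = proj₂ <-resp-≈ p (proj₁ <-resp-≈ q l)

  <-asym : ∀ {x y} → x < y → ¬ (y < x)
  <-asym p q = irrefl R.refl (lt-trans p q)

  +-pos : ∀ {x y} → 0# < x → 0# < y → 0# < x + y
  +-pos {x} {y} p q = lt-trans q (<-resp (+-identityˡ y) R.refl (+-mono-< 0# x y p))

  difference-pos : ∀ {x y} → x < y → 0# < y - x
  difference-pos {x} {y} p = <-resp (-‿inverseʳ x) R.refl (+-mono-< x y (- x) p)

  add-difference : ∀ x y → x + (y - x) ≈ y
  add-difference x y = begin
    x + (y - x)  ≈⟨ R.+-comm x _ ⟩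
    y - x + x    ≈⟨ R.+-assoc y _ x ⟩
    y + (- x + x) ≈⟨ +-congˡ (-‿inverseˡ x) ⟩
    y + 0#       ≈⟨ +-identityʳ y ⟩
    y ∎

  neg-pos : ∀ {x} → x < 0# → 0# < - x
  neg-pos p = <-resp R.refl (+-identityˡ _) (difference-pos p)

  *-mono-< : ∀ {x y z} → 0# < z → x < y → x * z < y * z
  *-mono-< {x} {y} {z} p q = <-resp (+-identityˡ _) (begin
    (y - x) * z + x * z          ≈⟨ distribʳ z (y - x) x ⟨
    (y - x + x) * z              ≈⟨ *-congʳ (trans (R.+-comm _ x) (add-difference x y)) ⟩
    y * z ∎)
    (+-mono-< 0# ((y - x) * z) (x * z) (*-pos _ _ (difference-pos q) p))

  <⇒≉0 : ∀ {x} → 0# < x → ¬ (x ≈ 0#)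
  <⇒≉0 p q = irrefl (sym q) p

  pos-inverse : ∀ {x y} → 0# < x → x * y ≈ 1# → 0# < y
  pos-inverse {x} {y} p q with compare 0# y
  ... | tri< l _ _ = l
  ... | tri≈ _ e _ = ⊥-elim (<⇒≉0 0<1 (trans (sym q) (trans (*-congˡ (sym e)) (zeroʳ x))))
  ... | tri> _ _ g = ⊥-elim (<-asym 0<1 (<-resp q (zeroˡ x) (<-resp (*-comm y x) R.refl (*-mono-< p g))))

-- Consequences of the axioms of T[F]*

power : ∀ {A : Set} → (A → A → A) → A → A → ℕ → A
power _⊛_ 𝟙 x zero    = 𝟙
power _⊛_ 𝟙 x (suc k) = x ⊛ power _⊛_ 𝟙 x k

-- The axioms of T[F]* in a frame; κ a interprets c_a.
record StarModel {R : CompleteOrderedField} (F : Subfield R) (K : Frame) : Set₁ where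
  open CompleteOrderedField R using (_≈_; _<_; _+_; _*_; 0#)
  open Subfield F
  open Frame K
  infixl 6 _⊹_
  infixl 7 _⊛_
  field
    𝟘 𝟙     : Carrier
    κ       : Element → Carrier
    _⊹_ _⊛_ : Carrier → Carrier → Carrier

    ⊹-cong     : ∀ {x x′ y y′ w} → Eq x x′ w → Eq y y′ w → Eq (x ⊹ y) (x′ ⊹ y′) w
    ⊛-cong     : ∀ {x x′ y y′ w} → Eq x x′ w → Eq y y′ w → Eq (x ⊛ y) (x′ ⊛ y′) w
    ⊹-assoc    : ∀ {w} x y z → Eq ((x ⊹ y) ⊹ z) (x ⊹ (y ⊹ z)) w
    ⊹-comm     : ∀ {w} x y → Eq (x ⊹ y) (y ⊹ x) w
    ⊹-identity : ∀ {w} x → Eq (x ⊹ 𝟘) x w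
    ⊹-inverse  : ∀ {w} x → ◇ (λ v → ∃ λ y → Eq (x ⊹ y) 𝟘 v) w
    less-irrefl : ∀ {x w} → Less x x w → Absurd w
    less-trans : ∀ {x y z w} → Less x y w → Less y z w → Less x z w
    compare    : ∀ x y {w} → ◇ (λ v → Less x y v ⊎ Eq x y v ⊎ Less y x v) w
    ⊹-less     : ∀ {x y w} z → Less x y w → Less (x ⊹ z) (y ⊹ z) w

    ⊛-pos       : ∀ {x y w} → Less 𝟘 x w → Less 𝟘 y w → Less 𝟘 (x ⊛ y) w
    ⊛-assoc⁺    : ∀ {x y z w} → Less 𝟘 x w → Less 𝟘 y w → Less 𝟘 z w → Eq ((x ⊛ y) ⊛ z) (x ⊛ (y ⊛ z)) w
    ⊛-comm⁺     : ∀ {x y w} → Less 𝟘 x w → Less 𝟘 y w → Eq (x ⊛ y) (y ⊛ x) w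
    𝟙-pos       : ∀ {w} → Less 𝟘 𝟙 w
    ⊛-identity⁺ : ∀ {x w} → Less 𝟘 x w → Eq (x ⊛ 𝟙) x w
    ⊛-inverse⁺  : ∀ {x w} → Less 𝟘 x w → ◇ (λ v → ∃ λ y → Less 𝟘 y v × Eq (x ⊛ y) 𝟙 v) w
    ⊛-less⁺     : ∀ {x y z w} → Less 𝟘 x w → Less 𝟘 y w → Less 𝟘 z w → Less x y w → Less (x ⊛ z) (y ⊛ z) w
    root        : ∀ k {x w} → Less 𝟘 x w → ◇ (λ v → ∃ λ y → Less 𝟘 y v × Eq (power _⊛_ 𝟙 y (suc k)) x v) w

    ⊛-signˡ : ∀ {x y w} z → Eq (x ⊹ y) 𝟘 w → Eq (x ⊛ z ⊹ y ⊛ z) 𝟘 w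
    ⊛-signʳ : ∀ {x y w} z → Eq (x ⊹ y) 𝟘 w → Eq (z ⊛ x ⊹ z ⊛ y) 𝟘 w

    κ-+        : ∀ a b d {w} → ⌊ d ⌋ ≈ ⌊ a ⌋ + ⌊ b ⌋ → Eq (κ d) (κ a ⊹ κ b) w
    κ-*        : ∀ a b d {w} → ⌊ d ⌋ ≈ ⌊ a ⌋ * ⌊ b ⌋ → Eq (κ d) (κ a ⊛ κ b) w
    κ-pos      : ∀ a {w} → 0# < ⌊ a ⌋ → Less 𝟘 (κ a) w
    κ-distribʳ : ∀ a b d {w} → ⌊ d ⌋ ≈ ⌊ a ⌋ + ⌊ b ⌋ → ∀ x → Eq (κ d ⊛ x) (κ a ⊛ x ⊹ κ b ⊛ x) w
    κ-distribˡ : ∀ a {w} x y → Eq (κ a ⊛ (x ⊹ y)) (κ a ⊛ x ⊹ κ a ⊛ y) w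

module Elements {R : CompleteOrderedField} (F : Subfield R) where
  open CompleteOrderedField R using (_+_; _*_; -_; _-_; 0#; 1#)
  open Subfield F

  0ᶠ 1ᶠ -1ᶠ : Element
  0ᶠ  = 0# , 0-closed
  1ᶠ  = 1# , 1-closed
  -1ᶠ = - 1# , neg-closed 1-closed

  infixl 6 _+ᶠ_ _-ᶠ_
  infixl 7 _*ᶠ_

  _+ᶠ_ _-ᶠ_ _*ᶠ_ : Element → Element → Element
  (a , p) +ᶠ (b , q) = a + b , +-closed p q
  (a , p) -ᶠ (b , q) = a - b , +-closed p (neg-closed q)
  (a , p) *ᶠ (b , q) = a * b , *-closed p q

  -ᶠ_ : Element → Element
  -ᶠ (a , p) = - a , neg-closed p

module Derived {R : CompleteOrderedField} {F : Subfield R} {K : Frame} (M : StarModel F K) where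
  open CompleteOrderedField R using (_≈_; _<_; 0#; 1#; 0<1)
  private module R = CompleteOrderedField R
  open Subfield F
  open Elements F
  open OrderedField R using (difference-pos; add-difference)
  open Frame K
  open StarModel M

  ⊹-cancelˡ : ∀ {x y z w} → Eq (x ⊹ y) (x ⊹ z) w → Eq y z w
  ⊹-cancelˡ {x} {y} {z} p = run eq-regular (⊹-inverse x) λ { e (x′ , q) →
    eq-trans (eq-sym (shift q y)) (eq-trans (⊹-cong eq-refl (mono eq-regular e p)) (shift q z)) }
    where
    shift : ∀ {x′ v} → Eq (x ⊹ x′) 𝟘 v → ∀ u → Eq (x′ ⊹ (x ⊹ u)) u v
    shift {x′} q u = eq-trans (eq-sym (⊹-assoc x′ x u)) (eq-trans (⊹-cong (eq-trans (⊹-comm x′ x) q) eq-refl)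
      (eq-trans (⊹-comm 𝟘 u) (⊹-identity u)))

  ⊹-idempotent⇒𝟘 : ∀ {x w} → Eq x (x ⊹ x) w → Eq x 𝟘 w
  ⊹-idempotent⇒𝟘 {x} p = ⊹-cancelˡ (eq-trans (eq-sym p) (eq-sym (⊹-identity x)))

  -- No axiom links c_0 with 0 directly, but 0 + 0 = 0 makes c_0 additively idempotent, and so it is
  -- 0.
  κ-0 : ∀ {w} → Eq (κ 0ᶠ) 𝟘 w
  κ-0 = ⊹-idempotent⇒𝟘 (κ-+ 0ᶠ 0ᶠ 0ᶠ (R.sym (R.+-identityʳ 0#)))

  κ-cong : ∀ {a b w} → ⌊ a ⌋ ≈ ⌊ b ⌋ → Eq (κ a) (κ b) w
  κ-cong {a} {b} p = eq-sym (eq-trans (κ-+ a 0ᶠ b (R.trans (R.sym p) (R.sym (R.+-identityʳ _))))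
    (eq-trans (⊹-cong eq-refl κ-0) (⊹-identity _)))

  κ0-⊛ : ∀ {w} x → Eq (κ 0ᶠ ⊛ x) 𝟘 w
  κ0-⊛ x = ⊹-idempotent⇒𝟘 (κ-distribʳ 0ᶠ 0ᶠ 0ᶠ (R.sym (R.+-identityʳ 0#)) x)

  𝟘-⊛ : ∀ {w} x → Eq (𝟘 ⊛ x) 𝟘 w
  𝟘-⊛ x = eq-trans (⊛-cong (eq-sym κ-0) eq-refl) (κ0-⊛ x)

  κ-⊛𝟘 : ∀ {w} a → Eq (κ a ⊛ 𝟘) 𝟘 w
  κ-⊛𝟘 a = ⊹-idempotent⇒𝟘 (eq-trans (⊛-cong eq-refl (eq-sym (⊹-identity 𝟘))) (κ-distribˡ a 𝟘 𝟘))

  -- Likewise c_1 is multiplicatively idempotent; being positive, it can be cancelled.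
  κ-1 : ∀ {w} → Eq (κ 1ᶠ) 𝟙 w
  κ-1 = run eq-regular (⊛-inverse⁺ (κ-pos 1ᶠ 0<1)) λ { e (y , y>0 , p) →
    let 1>0 = κ-pos 1ᶠ 0<1 in
    eq-trans (eq-sym (⊛-identity⁺ 1>0)) (eq-trans (⊛-cong eq-refl (eq-sym p))
      (eq-trans (eq-sym (⊛-assoc⁺ 1>0 1>0 y>0))
        (eq-trans (⊛-cong (eq-sym (κ-* 1ᶠ 1ᶠ 1ᶠ (R.sym (R.*-identityʳ 1#)))) eq-refl) p))) }

  less-neg⁺ : ∀ {x y w} → Eq (x ⊹ y) 𝟘 w → Less x 𝟘 w → Less 𝟘 y w
  less-neg⁺ {x} {y} p l = less-resp p (eq-trans (⊹-comm 𝟘 y) (⊹-identity y)) (⊹-less y l)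

  𝟙-⊛ : ∀ {w} x → Eq (𝟙 ⊛ x) x w
  𝟙-⊛ x = run eq-regular (compare 𝟘 x) λ where
      e (inj₁ l)        → positive l
      e (inj₂ (inj₁ p)) → eq-trans (⊛-cong (eq-sym κ-1) (eq-sym p)) (eq-trans (κ-⊛𝟘 1ᶠ) p)
      e (inj₂ (inj₂ g)) → run eq-regular (⊹-inverse x) λ { e′ (y , p) →
        ⊹-cancelˡ (eq-trans (⊹-comm y _) (eq-trans
          (⊹-cong eq-refl (eq-sym (positive (less-neg⁺ p (mono less-regular e′ g)))))
          (eq-trans (⊛-signʳ 𝟙 p) (eq-sym (eq-trans (⊹-comm y x) p))))) }
    where
    positive : ∀ {y v} → Less 𝟘 y v → Eq (𝟙 ⊛ y) y v
    positive l = eq-trans (⊛-comm⁺ 𝟙-pos l) (⊛-identity⁺ l)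

  κ1-⊛ : ∀ {w} x → Eq (κ 1ᶠ ⊛ x) x w
  κ1-⊛ x = eq-trans (⊛-cong κ-1 eq-refl) (𝟙-⊛ x)

  neg : Carrier → Carrier
  neg x = κ -1ᶠ ⊛ x

  neg-inverseʳ : ∀ {w} x → Eq (x ⊹ neg x) 𝟘 w
  neg-inverseʳ x = eq-trans (⊹-cong (eq-sym (κ1-⊛ x)) eq-refl)
    (eq-trans (eq-sym (κ-distribʳ 1ᶠ -1ᶠ 0ᶠ (R.sym (R.-‿inverseʳ 1#)) x)) (κ0-⊛ x))

  additive : World → AbelianGroup 0ℓ 0ℓ
  additive w = record
    { Carrier = Carrier ; _≈_ = λ x y → Eq x y w ; _∙_ = _⊹_ ; ε = 𝟘 ; _⁻¹ = neg
    ; isAbelianGroup = record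
      { isGroup = record
        { isMonoid = record
          { isSemigroup = record
            { isMagma = record
              { isEquivalence = record { refl = eq-refl ; sym = eq-sym ; trans = eq-trans }
              ; ∙-cong = ⊹-cong }
            ; assoc = ⊹-assoc }
          ; identity = (λ x → eq-trans (⊹-comm 𝟘 x) (⊹-identity x)) , ⊹-identity }
        ; inverse = (λ x → eq-trans (⊹-comm (neg x) x) (neg-inverseʳ x)) , neg-inverseʳ
        ; ⁻¹-cong = ⊛-cong eq-refl }
      ; comm = ⊹-comm } }

  module ⊹ {w : World} where
    open AbelianGroup (additive w) public using (setoid; identityˡ)
    open Algebra.Properties.AbelianGroup (additive w) public
    open Relation.Binary.Reasoning.Setoid setoid public

  neg-cong : ∀ {x y w} → Eq x y w → Eq (neg x) (neg y) w
  neg-cong = ⊛-cong eq-refl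

  neg-⊛ˡ : ∀ {w} x y → Eq (neg x ⊛ y) (neg (x ⊛ y)) w
  neg-⊛ˡ x y = ⊹.inverseʳ-unique _ _ (⊛-signˡ y (neg-inverseʳ x))

  neg-⊛ʳ : ∀ {w} x y → Eq (x ⊛ neg y) (neg (x ⊛ y)) w
  neg-⊛ʳ x y = ⊹.inverseʳ-unique _ _ (⊛-signʳ x (neg-inverseʳ y))

  neg-less : ∀ {x y w} → Less x y w → Less (neg y) (neg x) w
  neg-less {x} {y} l = less-resp
    (eq-trans (eq-sym (⊹-assoc _ _ _)) (eq-trans (⊹-cong (neg-inverseʳ x) eq-refl) (⊹.identityˡ _)))
    (eq-trans (⊹-cong eq-refl (⊹-comm _ _)) (eq-trans (eq-sym (⊹-assoc _ _ _))
      (eq-trans (⊹-cong (neg-inverseʳ y) eq-refl) (⊹.identityˡ _))))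
    (⊹-less (neg x ⊹ neg y) l)

  neg-𝟘 : ∀ {w} → Eq (neg 𝟘) 𝟘 w
  neg-𝟘 = ⊹.ε⁻¹≈ε

  neg-involutive : ∀ {w} x → Eq (neg (neg x)) x w
  neg-involutive = ⊹.⁻¹-involutive

  less-neg : ∀ {x w} → Less 𝟘 x w → Less (neg x) 𝟘 w
  less-neg l = less-resp eq-refl neg-𝟘 (neg-less l)

  -- Since 0 = -0, the product x · 0 is its own negative, and an ordered group has no element of
  -- order two.
  ⊛-𝟘 : ∀ {w} x → Eq (x ⊛ 𝟘) 𝟘 w
  ⊛-𝟘 x = run eq-regular (compare 𝟘 (x ⊛ 𝟘)) λ where
      e (inj₁ l)        → explode eq-regular (less-irrefl (less-trans l (less-resp (eq-sym self-neg) eq-refl (less-neg l))))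
      e (inj₂ (inj₁ p)) → eq-sym p
      e (inj₂ (inj₂ g)) → explode eq-regular
        (less-irrefl (less-trans (less-neg⁺ (⊹.x≈y⇒x∙y⁻¹≈ε eq-refl) g) (less-resp self-neg eq-refl g)))
    where
    self-neg : ∀ {v} → Eq (x ⊛ 𝟘) (neg (x ⊛ 𝟘)) v
    self-neg = eq-trans (⊛-cong eq-refl (eq-sym neg-𝟘)) (neg-⊛ʳ x 𝟘)

  data Signed (x : Carrier) (w : World) : Set where
    is-pos  : Less 𝟘 x w → Signed x w
    is-zero : Eq x 𝟘 w → Signed x w
    is-neg  : ∀ y → Less 𝟘 y w → Eq x (neg y) w → Signed x w

  signed : ∀ {w} x → ◇ (Signed x) w
  signed x = ◇-map (compare 𝟘 x) λ where
      _ (inj₁ l)        → is-pos l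
      _ (inj₂ (inj₁ p)) → is-zero (eq-sym p)
      _ (inj₂ (inj₂ g)) → is-neg (neg x) (less-neg⁺ (neg-inverseʳ x) g) (eq-sym (neg-involutive x))

  -- Extends the axioms for positive factors to all elements: every element is positive, zero or the
  -- negative of a positive one, and the rules of signs carry an identity across `neg`.
  by-sign : (P : Carrier → World → Set) → (∀ x → Regular (P x)) → (∀ {x y v} → Eq x y v → P y v → P x v) →
            ∀ {w} → (∀ {x v} → w ⊑ v → Less 𝟘 x v → P x v) → P 𝟘 w → (∀ {x v} → P x v → P (neg x) v) → ∀ x → P x w
  by-sign P regular resp pos at-𝟘 at-neg x = run (regular x) (signed x) λ where
      e (is-pos l)     → pos e l
      e (is-zero p)    → resp p (mono (regular 𝟘) e at-𝟘)
      e (is-neg y l p) → resp p (at-neg (pos e l))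

  ⊛-comm : ∀ {w} x y → Eq (x ⊛ y) (y ⊛ x) w
  ⊛-comm {w} x y = by-sign (λ x w → Eq (x ⊛ y) (y ⊛ x) w) (λ _ → eq-regular)
    (λ p q → eq-trans (⊛-cong p eq-refl) (eq-trans q (⊛-cong eq-refl (eq-sym p))))
    (λ _ l → positive l y)
    (eq-trans (𝟘-⊛ y) (eq-sym (⊛-𝟘 y)))
    (λ q → eq-trans (neg-⊛ˡ _ _) (eq-trans (neg-cong q) (eq-sym (neg-⊛ʳ _ _)))) x
    where
    positive : ∀ {x v} → Less 𝟘 x v → ∀ y → Eq (x ⊛ y) (y ⊛ x) v
    positive {x} l = by-sign (λ y w → Eq (x ⊛ y) (y ⊛ x) w) (λ _ → eq-regular)
      (λ p q → eq-trans (⊛-cong eq-refl p) (eq-trans q (⊛-cong (eq-sym p) eq-refl)))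
      (λ e → ⊛-comm⁺ (mono less-regular e l))
      (eq-trans (⊛-𝟘 x) (eq-sym (𝟘-⊛ x)))
      (λ q → eq-trans (neg-⊛ʳ _ _) (eq-trans (neg-cong q) (eq-sym (neg-⊛ˡ _ _))))

  ⊛-assoc : ∀ {w} x y z → Eq ((x ⊛ y) ⊛ z) (x ⊛ (y ⊛ z)) w
  ⊛-assoc x y z = by-sign (λ x w → Eq ((x ⊛ y) ⊛ z) (x ⊛ (y ⊛ z)) w) (λ _ → eq-regular)
    (λ p q → eq-trans (⊛-cong (⊛-cong p eq-refl) eq-refl) (eq-trans q (⊛-cong (eq-sym p) eq-refl)))
    (λ _ l → positive₁ l y z)
    (eq-trans (⊛-cong (𝟘-⊛ y) eq-refl) (eq-trans (𝟘-⊛ z) (eq-sym (𝟘-⊛ _))))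
    (λ q → eq-trans (⊛-cong (neg-⊛ˡ _ _) eq-refl) (eq-trans (neg-⊛ˡ _ _) (eq-trans (neg-cong q) (eq-sym (neg-⊛ˡ _ _)))))
    x
    where
    positive₂ : ∀ {x y v} → Less 𝟘 x v → Less 𝟘 y v → ∀ z → Eq ((x ⊛ y) ⊛ z) (x ⊛ (y ⊛ z)) v
    positive₂ {x} {y} l m = by-sign (λ z w → Eq ((x ⊛ y) ⊛ z) (x ⊛ (y ⊛ z)) w) (λ _ → eq-regular)
      (λ p q → eq-trans (⊛-cong eq-refl p) (eq-trans q (⊛-cong eq-refl (⊛-cong eq-refl (eq-sym p)))))
      (λ e → ⊛-assoc⁺ (mono less-regular e l) (mono less-regular e m))
      (eq-trans (⊛-𝟘 _) (eq-sym (eq-trans (⊛-cong eq-refl (⊛-𝟘 y)) (⊛-𝟘 x))))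
      (λ q → eq-trans (neg-⊛ʳ _ _) (eq-trans (neg-cong q) (eq-sym
        (eq-trans (⊛-cong eq-refl (neg-⊛ʳ _ _)) (neg-⊛ʳ _ _)))))
    positive₁ : ∀ {x v} → Less 𝟘 x v → ∀ y z → Eq ((x ⊛ y) ⊛ z) (x ⊛ (y ⊛ z)) v
    positive₁ {x} l y z = by-sign (λ y w → Eq ((x ⊛ y) ⊛ z) (x ⊛ (y ⊛ z)) w) (λ _ → eq-regular)
      (λ p q → eq-trans (⊛-cong (⊛-cong eq-refl p) eq-refl)
        (eq-trans q (⊛-cong eq-refl (⊛-cong (eq-sym p) eq-refl))))
      (λ e m → positive₂ (mono less-regular e l) m z)
      (eq-trans (⊛-cong (⊛-𝟘 x) eq-refl) (eq-trans (𝟘-⊛ z) (eq-sym (eq-trans (⊛-cong eq-refl (𝟘-⊛ z)) (⊛-𝟘 x)))))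
      (λ q → eq-trans (⊛-cong (neg-⊛ʳ _ _) eq-refl) (eq-trans (neg-⊛ˡ _ _) (eq-trans (neg-cong q)
        (eq-sym (eq-trans (⊛-cong eq-refl (neg-⊛ˡ _ _)) (neg-⊛ʳ _ _))))))
      y

  ⊛-less : ∀ {x y z w} → Less 𝟘 z w → Less x y w → Less (x ⊛ z) (y ⊛ z) w
  ⊛-less {x} {y} {z} z>0 l =
    run less-regular (signed x) λ e s →
    run less-regular (signed y) λ e′ t →
    cases (mono less-regular (⊑-trans e e′) z>0) (mono less-regular (⊑-trans e e′) l) (signed-mono e′ s) t
    where
    signed-mono : ∀ {x} → Mono (Signed x)
    signed-mono e (is-pos l)     = is-pos (mono less-regular e l)
    signed-mono e (is-zero p)    = is-zero (mono eq-regular e p)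
    signed-mono e (is-neg y l p) = is-neg y (mono less-regular e l) (mono eq-regular e p)

    absurd : ∀ {v} → Less x y v → Less y 𝟘 v ⊎ Eq y 𝟘 v → Less 𝟘 x v ⊎ Eq x 𝟘 v → Absurd v
    absurd l (inj₁ m) (inj₁ n) = less-irrefl (less-trans l (less-trans m n))
    absurd l (inj₁ m) (inj₂ q) = less-irrefl (less-trans (less-resp q eq-refl l) m)
    absurd l (inj₂ q) (inj₁ n) = less-irrefl (less-trans (less-resp eq-refl q l) n)
    absurd l (inj₂ q) (inj₂ r) = less-irrefl (less-resp r q l)

    neg-⊛ : ∀ {u v x} → Eq x (neg u) v → Eq (x ⊛ z) (neg (u ⊛ z)) v
    neg-⊛ p = eq-trans (⊛-cong p eq-refl) (neg-⊛ˡ _ _)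

    is-neg-less : ∀ {u v x} → Less 𝟘 u v → Eq x (neg u) v → Less x 𝟘 v
    is-neg-less l p = less-resp (eq-sym p) eq-refl (less-neg l)

    zero-⊛ : ∀ {v x} → Eq x 𝟘 v → Eq (x ⊛ z) 𝟘 v
    zero-⊛ p = eq-trans (⊛-cong p eq-refl) (𝟘-⊛ z)

    cases : ∀ {v} → Less 𝟘 z v → Less x y v → Signed x v → Signed y v → Less (x ⊛ z) (y ⊛ z) v
    cases n l (is-pos p)  (is-pos q)     = ⊛-less⁺ p q n l
    cases n l (is-pos p)  (is-zero q)    = explode less-regular (absurd l (inj₂ q) (inj₁ p))
    cases n l (is-pos p)  (is-neg _ m q) = explode less-regular (absurd l (inj₁ (is-neg-less m q)) (inj₁ p))
    cases n l (is-zero p) (is-pos q)     = less-resp (eq-sym (zero-⊛ p)) eq-refl (⊛-pos q n)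
    cases n l (is-zero p) (is-zero q)    = explode less-regular (absurd l (inj₂ q) (inj₂ p))
    cases n l (is-zero p) (is-neg _ m q) = explode less-regular (absurd l (inj₁ (is-neg-less m q)) (inj₂ p))
    cases n l (is-neg _ m p) (is-pos q)  =
      less-trans (less-resp (eq-sym (neg-⊛ p)) eq-refl (less-neg (⊛-pos m n))) (⊛-pos q n)
    cases n l (is-neg _ m p) (is-zero q) =
      less-resp (eq-sym (neg-⊛ p)) (eq-sym (zero-⊛ q)) (less-neg (⊛-pos m n))
    cases n l (is-neg u m p) (is-neg u′ m′ q) =
      less-resp (eq-sym (neg-⊛ p)) (eq-sym (neg-⊛ q)) (neg-less (⊛-less⁺ m′ m n
        (less-resp (neg-involutive u′) (neg-involutive u) (neg-less (less-resp p q l)))))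

  multiplicative : World → CommutativeMonoid 0ℓ 0ℓ
  multiplicative w = record
    { Carrier = Carrier ; _≈_ = λ x y → Eq x y w ; _∙_ = _⊛_ ; ε = 𝟙
    ; isCommutativeMonoid = record
      { isMonoid = record
        { isSemigroup = record
          { isMagma = record
            { isEquivalence = record { refl = eq-refl ; sym = eq-sym ; trans = eq-trans }
            ; ∙-cong = ⊛-cong }
          ; assoc = ⊛-assoc }
        ; identity = 𝟙-⊛ , λ x → eq-trans (⊛-comm x 𝟙) (𝟙-⊛ x) }
      ; comm = ⊛-comm } }

  κ-less : ∀ {a b w} → ⌊ a ⌋ < ⌊ b ⌋ → Less (κ a) (κ b) w
  κ-less {a} {b} l = less-resp (⊹.identityˡ _)
    (eq-trans (⊹-comm _ _) (eq-sym (κ-+ a (b -ᶠ a) b (R.sym (add-difference ⌊ a ⌋ ⌊ b ⌋)))))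
    (⊹-less (κ a) (κ-pos (b -ᶠ a) (difference-pos l)))

  κ-neg : ∀ {w} a → Eq (κ a) (neg (κ (-ᶠ a))) w
  κ-neg a = ⊹.inverseʳ-unique _ _ (eq-trans (eq-sym (κ-+ (-ᶠ a) a 0ᶠ (R.sym (R.-‿inverseˡ ⌊ a ⌋)))) κ-0)

-- Interpretation of both languages of T[F] in a model of T[F]*

module Structures {R : CompleteOrderedField} {F : Subfield R} {K : Frame} (M : StarModel F K) where
  open Frame K
  open StarModel M
  open Derived M

  Apart : Carrier → World → Set
  Apart x w = Less 𝟘 x w ⊎ Less x 𝟘 w

  apart-mono : ∀ {x} → Mono (Apart x)
  apart-mono e (inj₁ l) = inj₁ (mono less-regular e l)
  apart-mono e (inj₂ l) = inj₂ (mono less-regular e l)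

  apart-nonzero : ∀ {x w} → Apart x w → Eq x 𝟘 w → Absurd w
  apart-nonzero (inj₁ l) p = less-irrefl (less-resp eq-refl p l)
  apart-nonzero (inj₂ l) p = less-irrefl (less-resp p eq-refl l)

  -- x ÷ 0 = 0.
  Quotient : Carrier → Carrier → Carrier → World → Set
  Quotient x y z w = (Eq y 𝟘 w × Eq z 𝟘 w) ⊎ (Apart y w × Eq (z ⊛ y) x w)

  ⊛-cancelʳ : ∀ {x y z w} → Apart z w → Eq (x ⊛ z) (y ⊛ z) w → Eq x y w
  ⊛-cancelʳ {x} {y} {z} a p = run eq-regular (compare x y) λ where
      e (inj₁ l)        → explode eq-regular (scaled l (mono eq-regular e p) (apart-mono e a))
      e (inj₂ (inj₁ q)) → q
      e (inj₂ (inj₂ l)) → explode eq-regular (scaled l (eq-sym (mono eq-regular e p)) (apart-mono e a))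
    where
    scaled : ∀ {x y v} → Less x y v → Eq (x ⊛ z) (y ⊛ z) v → Apart z v → Absurd v
    scaled l p (inj₁ z>0) = less-irrefl (less-resp p eq-refl (⊛-less z>0 l))
    scaled {x} {y} l p (inj₂ z<0) = less-irrefl (less-resp
      (eq-trans (neg-⊛ʳ x z) (eq-trans (neg-cong p) (eq-sym (neg-⊛ʳ y z)))) eq-refl
      (⊛-less (less-neg⁺ (neg-inverseʳ z) z<0) l))

  quotient-unique : ∀ {x x′ y y′ z z′ w} → Eq x x′ w → Eq y y′ w → Quotient x y z w → Quotient x′ y′ z′ w → Eq z z′ w
  quotient-unique p q (inj₁ (_ , r)) (inj₁ (_ , r′)) = eq-trans r (eq-sym r′)
  quotient-unique p q (inj₁ (y0 , _)) (inj₂ (a , _)) = explode eq-regular (apart-nonzero a (eq-trans (eq-sym q) y0))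
  quotient-unique p q (inj₂ (a , _)) (inj₁ (y0 , _)) = explode eq-regular (apart-nonzero a (eq-trans q y0))
  quotient-unique p q (inj₂ (a , r)) (inj₂ (_ , r′)) =
    ⊛-cancelʳ a (eq-trans r (eq-trans p (eq-trans (eq-sym r′) (⊛-cong eq-refl (eq-sym q)))))

  quotient-total : ∀ x y {w} → ◇ (λ v → ∃ λ z → Quotient x y z v) w
  quotient-total x y = ◇-bind (signed y) λ where
      e (is-zero p)    → λ e′ k → k ⊑-refl (𝟘 , inj₁ (mono eq-regular e′ p , eq-refl))
      e (is-pos l)     → ◇-map (⊛-inverse⁺ l) λ { e′ (u , _ , q) →
        x ⊛ u , inj₂ (inj₁ (mono less-regular e′ l) , solution q) }
      e (is-neg u l p) → ◇-map (⊛-inverse⁺ l) λ { e′ (t , _ , q) →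
        x ⊛ neg t , inj₂ (inj₂ (less-resp (eq-sym (mono eq-regular e′ p)) eq-refl (less-neg (mono less-regular e′ l))) ,
          solution (eq-trans (⊛-cong (mono eq-regular e′ p) eq-refl)
            (eq-trans (neg-⊛ʳ _ _) (eq-trans (neg-cong (neg-⊛ˡ u t)) (eq-trans (neg-involutive _) q))))) }
    where
    solution : ∀ {u v} → Eq (y ⊛ u) 𝟙 v → Eq ((x ⊛ u) ⊛ y) x v
    solution q = eq-trans (⊛-assoc _ _ _) (eq-trans (⊛-cong eq-refl (eq-trans (⊛-comm _ _) q))
      (eq-trans (⊛-comm _ _) (𝟙-⊛ x)))

  quotient-mono : ∀ {x y z} → Mono (Quotient x y z)
  quotient-mono e (inj₁ (p , q)) = inj₁ (mono eq-regular e p , mono eq-regular e q)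
  quotient-mono e (inj₂ (a , q)) = inj₂ (apart-mono e a , mono eq-regular e q)

  quotient-resp : ∀ {x y z z′ w} → Eq z z′ w → Quotient x y z w → Quotient x y z′ w
  quotient-resp p (inj₁ (y0 , q)) = inj₁ (y0 , eq-trans (eq-sym p) q)
  quotient-resp p (inj₂ (a , q))  = inj₂ (a , eq-trans (⊛-cong (eq-sym p) eq-refl) q)

  Graph : AddOp ⊎ MultOp → Carrier → Carrier → Carrier → World → Set
  Graph (inj₁ `+) x y z = Eq (x ⊹ y) z
  Graph (inj₁ `-) x y z = Eq (x ⊹ neg y) z
  Graph (inj₂ `×) x y z = Eq (x ⊛ y) z
  Graph (inj₂ `÷) x y z = Quotient x y z

  total-operation : ∀ x {w} → ◇ (λ v → ∃ λ z → Eq x z v) w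
  total-operation x e k = k ⊑-refl (x , eq-refl)

  combined : Structure K (combinedLanguage F)
  combined = record
    { const        = λ { `0 → 𝟘 ; `1 → 𝟙 }
    ; op₁          = λ a x → κ a ⊛ x
    ; Graph₂       = Graph
    ; op₁-cong     = λ _ → ⊛-cong eq-refl
    ; graph-mono   = λ { (inj₁ `+) → mono eq-regular ; (inj₁ `-) → mono eq-regular
                       ; (inj₂ `×) → mono eq-regular ; (inj₂ `÷) → quotient-mono }
    ; graph-resp   = λ { (inj₁ `+) p q → eq-trans q p ; (inj₁ `-) p q → eq-trans q p
                       ; (inj₂ `×) p q → eq-trans q p ; (inj₂ `÷) → quotient-resp }
    ; graph-unique = λ { (inj₁ `+) p q r s → eq-trans (eq-sym r) (eq-trans (⊹-cong p q) s)
                       ; (inj₁ `-) p q r s → eq-trans (eq-sym r) (eq-trans (⊹-cong p (neg-cong q)) s)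
                       ; (inj₂ `×) p q r s → eq-trans (eq-sym r) (eq-trans (⊛-cong p q) s)
                       ; (inj₂ `÷) → quotient-unique }
    ; graph-total  = λ { (inj₁ `+) x y → total-operation _ ; (inj₁ `-) x y → total-operation _
                       ; (inj₂ `×) x y → total-operation _ ; (inj₂ `÷) → quotient-total }
    }

  additiveStructure : Structure K (addLanguage F)
  additiveStructure = reduct (add⊆combined F) combined

  multiplicativeStructure : Structure K (multLanguage F)
  multiplicativeStructure = reduct (mult⊆combined F) combined

-- Completeness of the additive theory

module AddQE {R : CompleteOrderedField} (F : Subfield R) where
  open CompleteOrderedField R using (_≈_; _<_; compare; inverse; 0#; 0<1; *-pos)
  private module R = CompleteOrderedField R
  open Subfield F
  open Elements F
  open OrderedField R

  -- The only constant is 1, whence `C = ⊤`; every other closed term is a scalar from F times 1.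
  scalars : Scalars
  scalars = record
    { K = Element ; C = ⊤ ; 0ₖ = 0ᶠ ; 1ₖ = 1ᶠ ; _+ₖ_ = _+ᶠ_ ; _*ₖ_ = _*ᶠ_
    ; _≃_ = λ a b → ⌊ a ⌋ ≈ ⌊ b ⌋ ; Positive = λ a → 0# < ⌊ a ⌋
    ; 1-positive = 0<1 ; +-positive = +-pos ; *-positive = *-pos _ _
    ; difference = difference ; up = tt }
    where
    difference : ∀ k l → (∃ λ d → 0# < ⌊ d ⌋ × ⌊ k +ᶠ d ⌋ ≈ ⌊ l ⌋) ⊎ ⌊ k ⌋ ≈ ⌊ l ⌋ ⊎ (∃ λ d → 0# < ⌊ d ⌋ × ⌊ l +ᶠ d ⌋ ≈ ⌊ k ⌋)
    difference k l with compare ⌊ k ⌋ ⌊ l ⌋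
    ... | tri< p _ _ = inj₁ (l -ᶠ k , difference-pos p , add-difference _ _)
    ... | tri≈ _ p _ = inj₂ (inj₁ p)
    ... | tri> _ _ p = inj₂ (inj₂ (k -ᶠ l , difference-pos p , add-difference _ _))

  open Elimination scalars

  linear : ∀ {n} → Term (addLanguage F) n → Linear n
  linear (# i)         = var i
  linear (con `0)      = null
  linear (con `1)      = cst tt
  linear (app₁ a t)    = a ⊠ linear t
  linear (app₂ `+ t u) = linear t ⊞ linear u
  linear (app₂ `- t u) = linear t ⊞ -1ᶠ ⊠ linear u

  qf : ∀ {n} → Formula (addLanguage F) n → QF n
  qf (t ≐ u) = linear t ≋ linear u
  qf (t ≺ u) = linear t ≪ linear u
  qf ⊥′      = falsum
  qf (φ ⇒ ψ) = qf φ ⊃ qf ψ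
  qf (∀′ φ)  = eliminate (qf φ)

  scalar : Linear 0 → Element
  scalar (cst _) = 1ᶠ
  scalar null    = 0ᶠ
  scalar (f ⊞ g) = scalar f +ᶠ scalar g
  scalar (a ⊠ f) = a *ᶠ scalar f

  Lower Equal : Linear 0 → Linear 0 → Set
  Lower f g = ⌊ scalar f ⌋ < ⌊ scalar g ⌋
  Equal f g = ⌊ scalar f ⌋ ≈ ⌊ scalar g ⌋

  order : ∀ f g → Lower f g ⊎ Equal f g ⊎ Lower g f
  order f g with compare ⌊ scalar f ⌋ ⌊ scalar g ⌋
  ... | tri< p _ _ = inj₁ p
  ... | tri≈ _ p _ = inj₂ (inj₁ p)
  ... | tri> _ _ p = inj₂ (inj₂ p)

  open Decision Lower Equal order public

  module _ {W : Frame} (M : StarModel F W) where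
    open Frame W
    open StarModel M hiding (compare)
    open Derived M
    open Structures M
    open Forcing additiveStructure hiding (Value)
    private module A = Forcing additiveStructure

    orderedModule : OrderedModule W scalars
    orderedModule = record
      { Dom = λ _ _ → ⊤ ; dom-mono = λ _ _ → tt
      ; _∙_ = _⊹_ ; ε = 𝟘 ; _·_ = λ a x → κ a ⊛ x ; ⟦_⟧ = λ _ → 𝟙
      ; ∙-cong = ⊹-cong ; ∙-assoc = ⊹-assoc ; ∙-comm = ⊹-comm ; ∙-identity = ⊹-identity
      ; ·-congʳ = λ _ → ⊛-cong eq-refl
      ; ·-congˡ = λ p → ⊛-cong (κ-cong p) eq-refl
      ; 1· = κ1-⊛ ; 0· = κ0-⊛
      ; +· = λ a b → κ-distribʳ a b (a +ᶠ b) R.refl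
      ; *· = *·
      ; ·-comm = λ a b x → eq-trans (eq-sym (⊛-assoc _ _ _)) (eq-trans (⊛-cong (⊛-comm _ _) eq-refl) (⊛-assoc _ _ _))
      ; ·ε = κ-⊛𝟘 ; ·∙ = λ a → κ-distribˡ a
      ; dom-ε = tt ; dom-∙ = λ _ _ → tt ; dom-· = λ _ _ → tt ; dom-⟦⟧ = λ _ → tt
      ; less-irrefl = less-irrefl ; less-trans = less-trans ; compare = StarModel.compare M
      ; ∙-less = λ _ _ _ → ⊹-less _
      ; ·-less = λ {a} p _ _ l → less-resp (⊛-comm _ _) (⊛-comm _ _) (⊛-less (κ-pos a p) l)
      ; divide = divide
      ; ε<up = 𝟙-pos }
      where
      *· : ∀ {w} a b x → Eq (κ (a *ᶠ b) ⊛ x) (κ a ⊛ (κ b ⊛ x)) w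
      *· a b x = eq-trans (⊛-cong (κ-* a b (a *ᶠ b) R.refl) eq-refl) (⊛-assoc _ _ _)

      divide : ∀ {a p q w} → 0# < ⌊ a ⌋ → ⊤ → ⊤ → ◇ (λ v → ∃ λ y → ⊤ × Eq (κ a ⊛ y ⊹ q) p v) w
      divide {a} {p} {q} a>0 _ _ e k with inverse ⌊ a ⌋ (<⇒≉0 a>0)
      -- The inverse of the scalar lies in F, so the solution is a⁻¹ · (p - q) and no larger world
      -- is needed.
      ... | b , ab≈1 = k ⊑-refl (κ b′ ⊛ (p ⊹ neg q) , tt ,
          eq-trans (⊹-cong (eq-trans (eq-sym (*· a b′ _)) (eq-trans (⊛-cong (κ-cong ab≈1) eq-refl) (κ1-⊛ _))) eq-refl)
            (eq-trans (⊹-assoc _ _ _) (eq-trans (⊹-cong eq-refl (eq-trans (⊹-comm _ _) (neg-inverseʳ q))) (⊹-identity p))))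
        where b′ = b , inv-closed (proj₂ a) ab≈1

    open Correctness orderedModule

    value-linear : ∀ {n} (ρ : Vec Carrier n) t {w} → A.Value ρ t (value ρ (linear t)) w
    value-linear ρ (# i)         = eq-refl
    value-linear ρ (con `0)      = eq-refl
    value-linear ρ (con `1)      = eq-refl
    value-linear ρ (app₁ a t)    = _ , value-linear ρ t , eq-refl
    value-linear ρ (app₂ `+ t u) = _ , _ , value-linear ρ t , value-linear ρ u , eq-refl
    value-linear ρ (app₂ `- t u) = _ , _ , value-linear ρ t , value-linear ρ u , eq-refl

    mutual
      qf⁺ : ∀ {n} {ρ : Vec Carrier n} φ {w} → Force ρ φ w → ForceQ ρ (qf φ) w
      qf⁺ (t ≐ u) h = h ⊑-refl (value-linear _ t) (value-linear _ u)
      qf⁺ (t ≺ u) h = h ⊑-refl (value-linear _ t) (value-linear _ u)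
      qf⁺ ⊥′      h = h
      qf⁺ (φ ⇒ ψ) h e p = qf⁺ ψ (h e (qf⁻ φ p))
      qf⁺ (∀′ φ)  h = eliminate⁺ (qf φ) (λ _ → tt) (λ x e _ → qf⁺ φ (mono (force-regular φ) e (h x)))

      qf⁻ : ∀ {n} {ρ : Vec Carrier n} φ {w} → ForceQ ρ (qf φ) w → Force ρ φ w
      qf⁻ (t ≐ u) h = same-value⁺ eq-regular (λ p q r → eq-trans (eq-sym p) (eq-trans r q)) t u
        (value-linear _ t) (value-linear _ u) h
      qf⁻ (t ≺ u) h = same-value⁺ less-regular less-resp t u (value-linear _ t) (value-linear _ u) h
      qf⁻ ⊥′      h = h
      qf⁻ (φ ⇒ ψ) h e p = qf⁻ ψ (h e (qf⁺ φ p))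
      qf⁻ (∀′ φ)  h x = qf⁻ φ (eliminate⁻ (qf φ) (λ _ → tt) tt h)

    value-scalar : ∀ f {w} → Eq (value [] f) (κ (scalar f)) w
    value-scalar (cst _) = eq-sym κ-1
    value-scalar null    = eq-sym κ-0
    value-scalar (f ⊞ g) = eq-trans (⊹-cong (value-scalar f) (value-scalar g)) (eq-sym (κ-+ _ _ _ R.refl))
    value-scalar (a ⊠ f) = eq-trans (⊛-cong eq-refl (value-scalar f)) (eq-sym (κ-* _ _ _ R.refl))

    lower-less : ∀ f g → Lower f g → ∀ {w} → Less (value [] f) (value [] g) w
    lower-less f g l = less-resp (eq-sym (value-scalar f)) (eq-sym (value-scalar g)) (κ-less l)

    equal-eq : ∀ f g → Equal f g → ∀ {w} → Eq (value [] f) (value [] g) w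
    equal-eq f g p = eq-trans (value-scalar f) (eq-trans (κ-cong p) (eq-sym (value-scalar g)))

    open DecisionCorrectness Lower Equal order lower-less equal-eq

    holds⇒force : ∀ σ → holds (qf σ) ≡ true → ∀ {w} → Force [] σ w
    holds⇒force σ e = qf⁻ σ (≡.subst (λ b → Verdict b (qf σ)) e (verdict (qf σ)))

    fails⇒absurd : ∀ σ → holds (qf σ) ≡ false → ∀ {w} → Force [] σ w → Absurd w
    fails⇒absurd σ e h = ≡.subst (λ b → Verdict b (qf σ)) e (verdict (qf σ)) (qf⁺ σ h)

-- Completeness of the multiplicative theory

-- Prescribing the signs of the variables turns a term into a signed monomial
-- fraction in positive variables; there × is an ordered abelian group law,
-- with natural numbers as scalars.
module MultQE {R : CompleteOrderedField} (F : Subfield R) where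
  open CompleteOrderedField R using (_≈_; _<_; compare; 0#; 1#; 0<1)
  private module R = CompleteOrderedField R
  open Subfield F
  open Elements F
  open OrderedField R

  PositiveElement : Set
  PositiveElement = ∃ λ (a : Element) → 0# < ⌊ a ⌋

  IsSuc : ℕ → Set
  IsSuc k = ∃ λ j → k ≡ suc j

  scalars : Scalars
  scalars = record
    { K = ℕ ; C = PositiveElement ; 0ₖ = 0 ; 1ₖ = 1 ; _+ₖ_ = ℕ._+_ ; _*ₖ_ = ℕ._*_
    ; _≃_ = _≡_ ; Positive = IsSuc
    ; 1-positive = 0 , refl
    ; +-positive = λ { (j , refl) q → _ , refl }
    ; *-positive = λ { (j , refl) (i , refl) → _ , refl }
    ; difference = difference
    ; up = 1ᶠ +ᶠ 1ᶠ , +-pos 0<1 0<1 }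
    where
    difference : ∀ k l → (∃ λ d → IsSuc d × k ℕ.+ d ≡ l) ⊎ k ≡ l ⊎ (∃ λ d → IsSuc d × l ℕ.+ d ≡ k)
    difference k l with ℕ.compare k l
    ... | ℕ.less _ d    = inj₁ (suc d , (d , refl) , ℕ.+-suc k d)
    ... | ℕ.equal _     = inj₂ (inj₁ refl)
    ... | ℕ.greater _ d = inj₂ (inj₂ (suc d , (d , refl) , ℕ.+-suc l d))

  open Elimination scalars

  data Sign : Set where
    minus none plus : Sign

  flip : Sign → Sign
  flip minus = plus
  flip none  = none
  flip plus  = minus

  infixl 7 _*ₛ_
  _*ₛ_ : Sign → Sign → Sign
  s *ₛ minus = flip s
  s *ₛ none  = none
  s *ₛ plus  = s

  infix 4 _⨾_/_

  -- A linear term over the multiplicative module is a monomial in positive variables with positive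
  -- constants from F. Exponents being natural numbers, quotients require a separate denominator.
  record Fraction (n : ℕ) : Set where
    constructor _⨾_/_
    field
      sign    : Sign
      num den : Linear n

  scale : ∀ {n} → Element → Fraction n → Fraction n
  scale a (s ⨾ p / q) with compare 0# ⌊ a ⌋
  ... | tri< a>0 _ _ = s ⨾ cst (a , a>0) ⊞ p / q
  ... | tri≈ _ _ _   = none ⨾ null / null
  ... | tri> _ _ a<0 = flip s ⨾ cst (-ᶠ a , neg-pos a<0) ⊞ p / q

  -- A nonzero sign is its own inverse, so signs multiply in quotients as well; and `s *ₛ none`
  -- being `none` reproduces x ÷ 0 = 0.
  multiply quotient : ∀ {n} → Fraction n → Fraction n → Fraction n
  multiply (s ⨾ p / q) (s′ ⨾ p′ / q′) = s *ₛ s′ ⨾ p ⊞ p′ / (q ⊞ q′)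
  quotient (s ⨾ p / q) (s′ ⨾ p′ / q′) = s *ₛ s′ ⨾ p ⊞ q′ / (q ⊞ p′)

  fraction : ∀ {n} → Vec Sign n → Term (multLanguage F) n → Fraction n
  fraction σ (# i)         = lookup σ i ⨾ var i / null
  fraction σ (con `0)      = none ⨾ null / null
  fraction σ (con `1)      = plus ⨾ null / null
  fraction σ (app₁ a t)    = scale a (fraction σ t)
  fraction σ (app₂ `× t u) = multiply (fraction σ t) (fraction σ u)
  fraction σ (app₂ `÷ t u) = quotient (fraction σ t) (fraction σ u)

  equal less : ∀ {n} → Sign → Sign → Linear n → Linear n → QF n
  equal minus minus f g = f ≋ g
  equal none  none  f g = verum
  equal plus  plus  f g = f ≋ g
  equal _     _     f g = falsum
  less minus minus f g = g ≪ f
  less minus none  f g = verum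
  less minus plus  f g = verum
  less none  plus  f g = verum
  less plus  plus  f g = f ≪ g
  less _     _     f g = falsum

  atom : ∀ {n} → (Sign → Sign → Linear n → Linear n → QF n) → Fraction n → Fraction n → QF n
  atom rel (s ⨾ p / q) (s′ ⨾ p′ / q′) = rel s s′ (p ⊞ q′) (p′ ⊞ q)

  qf : ∀ {n} → Vec Sign n → Formula (multLanguage F) n → QF n
  qf σ (t ≐ u) = atom equal (fraction σ t) (fraction σ u)
  qf σ (t ≺ u) = atom less (fraction σ t) (fraction σ u)
  qf σ ⊥′      = falsum
  qf σ (φ ⇒ ψ) = qf σ φ ⊃ qf σ ψ
  -- A quantifier over all elements becomes three over positive ones. In the second the variable is
  -- a dummy, since `none • y` is zero for every y.
  qf σ (∀′ φ)  = eliminate (qf (minus ∷ σ) φ) & eliminate (qf (none ∷ σ) φ) & eliminate (qf (plus ∷ σ) φ)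

  scalar : Linear 0 → Element
  scalar (cst a) = proj₁ a
  scalar null    = 1ᶠ
  scalar (f ⊞ g) = scalar f *ᶠ scalar g
  scalar (k ⊠ f) = power _*ᶠ_ 1ᶠ (scalar f) k

  Lower Equal : Linear 0 → Linear 0 → Set
  Lower f g = ⌊ scalar f ⌋ < ⌊ scalar g ⌋
  Equal f g = ⌊ scalar f ⌋ ≈ ⌊ scalar g ⌋

  order : ∀ f g → Lower f g ⊎ Equal f g ⊎ Lower g f
  order f g with compare ⌊ scalar f ⌋ ⌊ scalar g ⌋
  ... | tri< p _ _ = inj₁ p
  ... | tri≈ _ p _ = inj₂ (inj₁ p)
  ... | tri> _ _ p = inj₂ (inj₂ p)

  open Decision Lower Equal order public

  module _ {W : Frame} (M : StarModel F W) where
    open Frame W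
    open StarModel M hiding (compare)
    open Derived M
    open Structures M
    open Forcing multiplicativeStructure hiding (Value)
    private module A = Forcing multiplicativeStructure

    infixr 8 _^_
    _^_ : Carrier → ℕ → Carrier
    x ^ k = power _⊛_ 𝟙 x k

    private
      module ⊛ {w : World} where
        open CommutativeMonoid (multiplicative w) public using (setoid; identityˡ; identityʳ)
        open Algebra.Properties.CommutativeMonoid.Mult (multiplicative w) public renaming (_×_ to _⋆_)
        open Relation.Binary.Reasoning.Setoid setoid public
        open Algebra.Solver.CommutativeMonoid (multiplicative w) public
          using (solve; _⊜_) renaming (_⊕_ to infixr 5 _⊙_)

    open ⊛ using (solve; _⊜_; _⊙_)

    ^≡⋆ : ∀ {w} x k → x ^ k ≡ ⊛._⋆_ {w} k x
    ^≡⋆ x zero    = refl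
    ^≡⋆ x (suc k) = ≡.cong (x ⊛_) (^≡⋆ x k)

    ^-cong : ∀ k {x y w} → Eq x y w → Eq (x ^ k) (y ^ k) w
    ^-cong zero    p = eq-refl
    ^-cong (suc k) p = ⊛-cong p (^-cong k p)

    ^-+ : ∀ {w} k l x → Eq (x ^ (k ℕ.+ l)) (x ^ k ⊛ x ^ l) w
    ^-+ {w} k l x rewrite ^≡⋆ {w} x (k ℕ.+ l) | ^≡⋆ {w} x k | ^≡⋆ {w} x l = ⊛.×-homo-+ x k l

    ^-* : ∀ {w} k l x → Eq (x ^ (k ℕ.* l)) ((x ^ l) ^ k) w
    ^-* {w} k l x rewrite ^≡⋆ {w} (x ^ l) k | ^≡⋆ {w} x l | ^≡⋆ {w} x (k ℕ.* l) = eq-sym (⊛.×-assocˡ x k l)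

    ^-comm : ∀ {w} k l x → Eq ((x ^ l) ^ k) ((x ^ k) ^ l) w
    ^-comm {w} k l x = eq-trans (eq-sym (^-* k l x)) (≡.subst (λ m → Eq (x ^ m) ((x ^ k) ^ l) w) (ℕ.*-comm l k) (^-* l k x))

    ^-⊛ : ∀ {w} k x y → Eq ((x ⊛ y) ^ k) (x ^ k ⊛ y ^ k) w
    ^-⊛ {w} k x y rewrite ^≡⋆ {w} (x ⊛ y) k | ^≡⋆ {w} x k | ^≡⋆ {w} y k = ⊛.×-distrib-+ x y k

    𝟙^ : ∀ {w} k → Eq (𝟙 ^ k) 𝟙 w
    𝟙^ zero    = eq-refl
    𝟙^ (suc k) = eq-trans (𝟙-⊛ _) (𝟙^ k)

    ^-pos : ∀ k {x w} → Less 𝟘 x w → Less 𝟘 (x ^ k) w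
    ^-pos zero    l = 𝟙-pos
    ^-pos (suc k) l = ⊛-pos l (^-pos k l)

    ^-less : ∀ k {x y w} → Less 𝟘 x w → Less 𝟘 y w → Less x y w → Less (x ^ suc k) (y ^ suc k) w
    ^-less zero    p q l = less-resp (eq-sym (⊛.identityʳ _)) (eq-sym (⊛.identityʳ _)) l
    ^-less (suc k) p q l = less-trans (⊛-less (^-pos (suc k) p) l)
      (less-resp (⊛-comm _ _) (⊛-comm _ _) (⊛-less q (^-less k p q l)))

    orderedModule : OrderedModule W scalars
    orderedModule = record
      { Dom = λ x → Less 𝟘 x ; dom-mono = mono less-regular
      ; _∙_ = _⊛_ ; ε = 𝟙 ; _·_ = λ k x → x ^ k ; ⟦_⟧ = λ a → κ (proj₁ a)
      ; ∙-cong = ⊛-cong ; ∙-assoc = ⊛-assoc ; ∙-comm = ⊛-comm ; ∙-identity = ⊛.identityʳ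
      ; ·-congʳ = ^-cong
      ; ·-congˡ = λ { refl → eq-refl }
      ; 1· = ⊛.identityʳ ; 0· = λ x → eq-refl
      ; +· = ^-+ ; *· = ^-* ; ·-comm = ^-comm ; ·ε = 𝟙^ ; ·∙ = ^-⊛
      ; dom-ε = 𝟙-pos ; dom-∙ = ⊛-pos ; dom-· = ^-pos ; dom-⟦⟧ = λ a → κ-pos (proj₁ a) (proj₂ a)
      ; less-irrefl = less-irrefl ; less-trans = less-trans ; compare = StarModel.compare M
      ; ∙-less = λ _ _ z>0 → ⊛-less z>0
      ; ·-less = λ { (j , refl) → ^-less j }
      ; divide = divide
      ; ε<up = less-resp κ-1 eq-refl (κ-less (<-resp (R.+-identityˡ 1#) R.refl (R.+-mono-< 0# 1# 1# 0<1))) }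
      where
      divide : ∀ {k p q w} → IsSuc k → Less 𝟘 p w → Less 𝟘 q w → ◇ (λ v → ∃ λ y → Less 𝟘 y v × Eq (y ^ k ⊛ q) p v) w
      divide {p = p} {q} (j , refl) p>0 q>0 =
        ◇-bind (⊛-inverse⁺ q>0) λ { e (r , r>0 , i) →
        ◇-map (root j (⊛-pos (mono less-regular e p>0) r>0)) λ { e′ (y , y>0 , h) →
          y , y>0 , eq-trans (⊛-cong h eq-refl) (eq-trans (⊛-assoc _ _ _) (eq-trans
            (⊛-cong eq-refl (eq-trans (⊛-comm _ _) (mono eq-regular e′ i))) (⊛.identityʳ p))) }}

    open Correctness orderedModule

    infixr 8 _•_
    _•_ : Sign → Carrier → Carrier
    minus • x = neg x
    none  • x = 𝟘
    plus  • x = x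

    •-cong : ∀ s {x y w} → Eq x y w → Eq (s • x) (s • y) w
    •-cong minus p = neg-cong p
    •-cong none  p = eq-refl
    •-cong plus  p = p

    neg-• : ∀ {w} s x → Eq (neg (s • x)) (flip s • x) w
    neg-• minus x = neg-involutive x
    neg-• none  x = neg-𝟘
    neg-• plus  x = eq-refl

    •-⊛ˡ : ∀ {w} s x y → Eq ((s • x) ⊛ y) (s • (x ⊛ y)) w
    •-⊛ˡ minus x y = neg-⊛ˡ x y
    •-⊛ˡ none  x y = 𝟘-⊛ y
    •-⊛ˡ plus  x y = eq-refl

    •-⊛ : ∀ {w} s t x y → Eq ((s • x) ⊛ (t • y)) ((s *ₛ t) • (x ⊛ y)) w
    •-⊛ s minus x y = eq-trans (neg-⊛ʳ _ _) (eq-trans (neg-cong (•-⊛ˡ s x y)) (neg-• s _))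
    •-⊛ s none  x y = ⊛-𝟘 _
    •-⊛ s plus  x y = •-⊛ˡ s x y

    Denotes : ∀ {n} → Vec Carrier n → Fraction n → Carrier → World → Set
    Denotes ys (s ⨾ p / q) v w = Eq (v ⊛ value ys q) (s • value ys p) w

    HasSigns : ∀ {n} → Vec Carrier n → Vec Sign n → Vec Carrier n → World → Set
    HasSigns ρ σ ys w = ∀ i → Eq (lookup ρ i) (lookup σ i • lookup ys i) w

    denotes-scale : ∀ {n} (ys : Vec Carrier n) a r {v w} → Denotes ys r v w → Denotes ys (scale a r) (κ a ⊛ v) w
    denotes-scale ys a (s ⨾ p / q) {v} d with compare 0# ⌊ a ⌋
    ... | tri< _ _ _   = scaled d
      where
      scaled : ∀ {w} → Eq (v ⊛ value ys q) (s • value ys p) w → Eq ((κ a ⊛ v) ⊛ value ys q) (s • (κ a ⊛ value ys p)) w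
      scaled d = eq-trans (⊛-assoc _ _ _) (eq-trans (⊛-cong eq-refl d) (eq-trans (⊛-comm _ _)
        (eq-trans (•-⊛ˡ s _ _) (•-cong s (⊛-comm _ _)))))
    ... | tri≈ _ 0≈a _ = eq-trans (⊛-cong (⊛-cong (eq-trans (κ-cong (R.sym 0≈a)) κ-0) eq-refl) eq-refl)
      (eq-trans (⊛-cong (𝟘-⊛ v) eq-refl) (𝟘-⊛ _))
    ... | tri> _ _ a<0 = eq-trans (⊛-assoc _ _ _) (eq-trans (⊛-cong (κ-neg a) d) (eq-trans (neg-⊛ˡ _ _)
      (eq-trans (neg-cong (eq-trans (⊛-comm _ _) (eq-trans (•-⊛ˡ s _ _) (•-cong s (⊛-comm _ _))))) (neg-• s _))))

    denotes-multiply : ∀ {n} (ys : Vec Carrier n) r r′ {v v′ w} → Denotes ys r v w → Denotes ys r′ v′ w →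
                    Denotes ys (multiply r r′) (v ⊛ v′) w
    denotes-multiply ys (s ⨾ p / q) (s′ ⨾ p′ / q′) d d′ = eq-trans
      (solve 4 (λ a b c e → (a ⊙ b) ⊙ (c ⊙ e) ⊜ (a ⊙ c) ⊙ (b ⊙ e)) eq-refl _ _ _ _)
      (eq-trans (⊛-cong d d′) (•-⊛ s s′ _ _))

    sign-of : ∀ {n} {ys : Vec Carrier n} s p {w} → Domain ys w → s ≡ none ⊎ Apart (s • value ys p) w
    sign-of minus p D = inj₂ (inj₂ (less-neg (dom-value D p)))
    sign-of none  p D = inj₁ refl
    sign-of plus  p D = inj₂ (inj₁ (dom-value D p))

    -- If v′ is nonzero, then z · v′ = v and v · q = s • p give z · q · (v′ · q′) = s • (p · q′),
    -- which is `cleared`. Here v′ · q′ equals s′ • p′, and the sign s′ moves to the right-hand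
    -- side.
    denotes-quotient : ∀ {n} (ys : Vec Carrier n) r r′ {v v′ z w} → Domain ys w → Denotes ys r v w → Denotes ys r′ v′ w →
                   Quotient v v′ z w → Denotes ys (quotient r r′) z w
    denotes-quotient ys (s ⨾ p / q) (s′ ⨾ p′ / q′) {v} {v′} {z} D d d′ (inj₁ (v′0 , z0)) with sign-of {ys = ys} s′ p′ D
    ... | inj₁ refl = eq-trans (⊛-cong z0 eq-refl) (𝟘-⊛ _)
    ... | inj₂ a    = explode eq-regular (apart-nonzero a
      (eq-trans (eq-sym d′) (eq-trans (⊛-cong v′0 eq-refl) (𝟘-⊛ _))))
    denotes-quotient ys (s ⨾ p / q) (s′ ⨾ p′ / q′) {v} {v′} {z} {w} D d d′ (inj₂ (v′≠0 , h)) = cases s′ d′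
      where
      cleared : Eq (z ⊛ (value ys q ⊛ (v′ ⊛ value ys q′))) (s • (value ys p ⊛ value ys q′)) w
      cleared = eq-trans
        (solve 4 (λ a b c e → a ⊙ (b ⊙ (c ⊙ e)) ⊜ ((a ⊙ c) ⊙ b) ⊙ e) eq-refl _ _ _ _)
        (eq-trans (⊛-cong (eq-trans (⊛-cong h eq-refl) d) eq-refl) (•-⊛ˡ s _ _))
      cases : ∀ s′ → Denotes ys (s′ ⨾ p′ / q′) v′ w → Denotes ys (quotient (s ⨾ p / q) (s′ ⨾ p′ / q′)) z w
      cases none  d′ = explode eq-regular (apart-nonzero v′≠0
        (⊛-cancelʳ (inj₁ (dom-value D q′)) (eq-trans d′ (eq-sym (𝟘-⊛ _)))))
      cases plus  d′ = eq-trans (⊛-cong eq-refl (⊛-cong eq-refl (eq-sym d′))) cleared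
      cases minus d′ = eq-trans
        (⊛-cong eq-refl (⊛-cong eq-refl (eq-trans (eq-sym (neg-involutive _)) (neg-cong (eq-sym d′)))))
        (eq-trans (⊛-cong eq-refl (neg-⊛ʳ _ _)) (eq-trans (neg-⊛ʳ _ _) (eq-trans (neg-cong cleared) (neg-• s _))))

    denotes-fraction : ∀ {n} {ρ : Vec Carrier n} {σ ys} t {v w} → Domain ys w → HasSigns ρ σ ys w →
                       A.Value ρ t v w → Denotes ys (fraction σ t) v w
    denotes-fraction {σ = σ} (# i) D h p = eq-trans (⊛.identityʳ _) (eq-trans (eq-sym p) (h i))
    denotes-fraction (con `0) D h p = eq-trans (⊛.identityʳ _) (eq-sym p)
    denotes-fraction (con `1) D h p = eq-trans (⊛.identityʳ _) (eq-sym p)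
    denotes-fraction {σ = σ} {ys} (app₁ a t) D h (x , p , q) =
      denotes-resp (scale a (fraction σ t)) q (denotes-scale ys a (fraction σ t) (denotes-fraction t D h p))
      where
      denotes-resp : ∀ r {x y w} → Eq x y w → Denotes ys r x w → Denotes ys r y w
      denotes-resp r p d = eq-trans (⊛-cong (eq-sym p) eq-refl) d
    denotes-fraction {σ = σ} {ys} (app₂ `× t u) D h (x , y , p , q , g) =
      eq-trans (⊛-cong (eq-sym g) eq-refl)
        (denotes-multiply ys (fraction σ t) (fraction σ u) (denotes-fraction t D h p) (denotes-fraction u D h q))
    denotes-fraction {σ = σ} {ys} (app₂ `÷ t u) D h (x , y , p , q , g) =
      denotes-quotient ys (fraction σ t) (fraction σ u) D (denotes-fraction t D h p) (denotes-fraction u D h q) g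

    minus<plus : ∀ {x y w} → Less 𝟘 x w → Less 𝟘 y w → Less (neg x) y w
    minus<plus p q = less-trans (less-neg p) q

    module _ {n} {ys : Vec Carrier n} (f g : Linear n) where
      private
        a = value ys f
        b = value ys g

      module _ {w} (a>0 : Less 𝟘 a w) (b>0 : Less 𝟘 b w) where
        private
          clash : ∀ {x y} → Less x y w → Eq x y w → Absurd w
          clash l p = less-irrefl (less-resp p eq-refl l)
          cycle : ∀ {x y} → Less x y w → Less y x w → Absurd w
          cycle l m = less-irrefl (less-trans l m)

        equal⁺ : ∀ s s′ → Eq (s • a) (s′ • b) w → ForceQ ys (equal s s′ f g) w
        equal⁺ minus minus p = eq-trans (eq-sym (neg-involutive a)) (eq-trans (neg-cong p) (neg-involutive b))
        equal⁺ minus none  p = clash (less-neg a>0) p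
        equal⁺ minus plus  p = clash (minus<plus a>0 b>0) p
        equal⁺ none  minus p = clash (less-neg b>0) (eq-sym p)
        equal⁺ none  none  p = λ _ x → x
        equal⁺ none  plus  p = clash b>0 p
        equal⁺ plus  minus p = clash (minus<plus b>0 a>0) (eq-sym p)
        equal⁺ plus  none  p = clash a>0 (eq-sym p)
        equal⁺ plus  plus  p = p

        less⁺ : ∀ s s′ → Less (s • a) (s′ • b) w → ForceQ ys (less s s′ f g) w
        less⁺ minus minus l = less-resp (neg-involutive b) (neg-involutive a) (neg-less l)
        less⁺ minus none  l = λ _ x → x
        less⁺ minus plus  l = λ _ x → x
        less⁺ none  minus l = cycle (less-neg b>0) l
        less⁺ none  none  l = less-irrefl l
        less⁺ none  plus  l = λ _ x → x
        less⁺ plus  minus l = cycle (minus<plus b>0 a>0) l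
        less⁺ plus  none  l = cycle a>0 l
        less⁺ plus  plus  l = l

        equal⁻ : ∀ s s′ → ForceQ ys (equal s s′ f g) w → Eq (s • a) (s′ • b) w
        equal⁻ minus minus p = neg-cong p
        equal⁻ minus none  p = explode eq-regular p
        equal⁻ minus plus  p = explode eq-regular p
        equal⁻ none  minus p = explode eq-regular p
        equal⁻ none  none  p = eq-refl
        equal⁻ none  plus  p = explode eq-regular p
        equal⁻ plus  minus p = explode eq-regular p
        equal⁻ plus  none  p = explode eq-regular p
        equal⁻ plus  plus  p = p

        less⁻ : ∀ s s′ → ForceQ ys (less s s′ f g) w → Less (s • a) (s′ • b) w
        less⁻ minus minus l = neg-less l
        less⁻ minus none  l = less-neg a>0
        less⁻ minus plus  l = minus<plus a>0 b>0
        less⁻ none  minus p = explode less-regular p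
        less⁻ none  none  p = explode less-regular p
        less⁻ none  plus  l = b>0
        less⁻ plus  minus p = explode less-regular p
        less⁻ plus  none  p = explode less-regular p
        less⁻ plus  plus  l = l

    -- Cross multiplication by the positive denominators.
    cross : ∀ {n} (ys : Vec Carrier n) {w} → Domain ys w → ∀ r r′ {v v′} → Denotes ys r v w → Denotes ys r′ v′ w →
      let open Fraction in
      Transfers v v′ (sign r • value ys (num r ⊞ den r′)) (sign r′ • value ys (num r′ ⊞ den r)) w
    cross ys {w} D (s ⨾ p / q) (s′ ⨾ p′ / q′) {v} {v′} d d′ = transfers-trans
      ( (λ e → ⊛-less (mono less-regular e q>0))
      , (λ e h → ⊛-cong h eq-refl)
      , (λ e → ⊛-less (mono less-regular e q>0)))
      (transfers-eq
        (eq-trans (eq-sym (⊛-assoc _ _ _)) (eq-trans (⊛-cong d eq-refl) (•-⊛ˡ s _ _)))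
        (eq-trans (solve 3 (λ a b c → a ⊙ (b ⊙ c) ⊜ (a ⊙ c) ⊙ b) eq-refl _ _ _)
          (eq-trans (⊛-cong d′ eq-refl) (•-⊛ˡ s′ _ _))))
      where
      q>0 : Less 𝟘 (value ys q ⊛ value ys q′) w
      q>0 = ⊛-pos (dom-value D q) (dom-value D q′)

    hasSigns-mono : ∀ {n} {ρ : Vec Carrier n} {σ ys} → Mono (HasSigns ρ σ ys)
    hasSigns-mono e h i = mono eq-regular e (h i)

    hasSigns-∷ : ∀ {n} {ρ : Vec Carrier n} {σ ys w x s y} → Eq x (s • y) w → HasSigns ρ σ ys w →
                 HasSigns (x ∷ ρ) (s ∷ σ) (y ∷ ys) w
    hasSigns-∷ p h zero    = p
    hasSigns-∷ p h (suc i) = h i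

    module _ {n} {ρ : Vec Carrier n} {σ ys w} (D : Domain ys w) (h : HasSigns ρ σ ys w)
             (t u : Term (multLanguage F) n) where
      private
        r  = fraction σ t
        r′ = fraction σ u
        f  = Fraction.num r ⊞ Fraction.den r′
        g  = Fraction.num r′ ⊞ Fraction.den r
        D′ : ∀ {v} → w ⊑ v → Domain ys v
        D′ e = domain-mono {ρ = ys} e D

        transfers : ∀ {v x y} → w ⊑ v → A.Value ρ t x v → A.Value ρ u y v →
                    Transfers x y (Fraction.sign r • value ys f) (Fraction.sign r′ • value ys g) v
        transfers e p q = cross ys (D′ e) r r′
          (denotes-fraction t (D′ e) (hasSigns-mono {ρ = ρ} {σ} {ys} e h) p)
          (denotes-fraction u (D′ e) (hasSigns-mono {ρ = ρ} {σ} {ys} e h) q)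

      equal-atom⁺ : Force ρ (t ≐ u) w → ForceQ ys (atom equal r r′) w
      equal-atom⁺ k =
        run (forceQ-regular (atom equal r r′)) (A.value-total t) λ { e (x , p) →
        run (forceQ-regular (atom equal r r′)) (A.value-total u) λ { e′ (y , q) →
          let e″ = ⊑-trans e e′
              p′ = A.value-mono t e′ p in
          equal⁺ {ys = ys} f g (dom-value {ρ = ys} (D′ e″) f) (dom-value {ρ = ys} (D′ e″) g) (Fraction.sign r) (Fraction.sign r′)
            (proj₁ (proj₂ (transfers e″ p′ q)) ⊑-refl (k e″ p′ q)) }}

      less-atom⁺ : Force ρ (t ≺ u) w → ForceQ ys (atom less r r′) w
      less-atom⁺ k =
        run (forceQ-regular (atom less r r′)) (A.value-total t) λ { e (x , p) →
        run (forceQ-regular (atom less r r′)) (A.value-total u) λ { e′ (y , q) →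
          let e″ = ⊑-trans e e′
              p′ = A.value-mono t e′ p in
          less⁺ {ys = ys} f g (dom-value {ρ = ys} (D′ e″) f) (dom-value {ρ = ys} (D′ e″) g) (Fraction.sign r) (Fraction.sign r′)
            (proj₁ (transfers e″ p′ q) ⊑-refl (k e″ p′ q)) }}

      equal-atom⁻ : ForceQ ys (atom equal r r′) w → Force ρ (t ≐ u) w
      equal-atom⁻ k e p q = proj₁ (proj₂ (transfers-sym (transfers e p q))) ⊑-refl
        (equal⁻ {ys = ys} f g (dom-value {ρ = ys} (D′ e) f) (dom-value {ρ = ys} (D′ e) g) (Fraction.sign r) (Fraction.sign r′) (mono (forceQ-regular (atom equal r r′)) e k))

      less-atom⁻ : ForceQ ys (atom less r r′) w → Force ρ (t ≺ u) w
      less-atom⁻ k e p q = proj₁ (transfers-sym (transfers e p q)) ⊑-refl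
        (less⁻ {ys = ys} f g (dom-value {ρ = ys} (D′ e) f) (dom-value {ρ = ys} (D′ e) g) (Fraction.sign r) (Fraction.sign r′) (mono (forceQ-regular (atom less r r′)) e k))

    mutual
      qf⁺ : ∀ {n} {ρ : Vec Carrier n} {σ ys w} → Domain ys w → HasSigns ρ σ ys w → ∀ φ →
            Force ρ φ w → ForceQ ys (qf σ φ) w
      qf⁺ D h (t ≐ u) k = equal-atom⁺ D h t u k
      qf⁺ D h (t ≺ u) k = less-atom⁺ D h t u k
      qf⁺ D h ⊥′      k = k
      qf⁺ {ρ = ρ} {σ} {ys} D h (φ ⇒ ψ) k e p = qf⁺ D′ h′ ψ (k e (qf⁻ D′ h′ φ p))
        where
        D′ = domain-mono {ρ = ys} e D
        h′ = hasSigns-mono {ρ = ρ} {σ} {ys} e h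
      qf⁺ {ρ = ρ} {σ} {ys} {w} D h (∀′ φ) k = each minus , each none , each plus
        where
        each : ∀ s → ForceQ ys (eliminate (qf (s ∷ σ) φ)) w
        each s = eliminate⁺ (qf (s ∷ σ) φ) D λ y e y>0 →
          qf⁺ (domain-∷ {ρ = ys} y>0 (domain-mono {ρ = ys} e D))
            (hasSigns-∷ {ρ = ρ} {σ} {ys} eq-refl (hasSigns-mono {ρ = ρ} {σ} {ys} e h)) φ
            (mono (force-regular φ) e (k (s • y)))

      qf⁻ : ∀ {n} {ρ : Vec Carrier n} {σ ys w} → Domain ys w → HasSigns ρ σ ys w → ∀ φ →
            ForceQ ys (qf σ φ) w → Force ρ φ w
      qf⁻ D h (t ≐ u) k = equal-atom⁻ D h t u k
      qf⁻ D h (t ≺ u) k = less-atom⁻ D h t u k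
      qf⁻ D h ⊥′      k = k
      qf⁻ {ρ = ρ} {σ} {ys} D h (φ ⇒ ψ) k e p = qf⁻ D′ h′ ψ (k e (qf⁺ D′ h′ φ p))
        where
        D′ = domain-mono {ρ = ys} e D
        h′ = hasSigns-mono {ρ = ρ} {σ} {ys} e h
      qf⁻ {ρ = ρ} {σ} {ys} {w} D h (∀′ φ) (k₋ , k₀ , k₊) x = run (force-regular φ) (signed x) λ where
          e (is-pos l)     → instantiate plus k₊ e l eq-refl
          -- Zero has no magnitude of its own; 𝟙 is supplied as an arbitrary positive element.
          e (is-zero p)    → instantiate none k₀ e 𝟙-pos p
          e (is-neg y l p) → instantiate minus k₋ e l p
        where
        instantiate : ∀ s → ForceQ ys (eliminate (qf (s ∷ σ) φ)) w → ∀ {y v} → w ⊑ v → Less 𝟘 y v →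
                      Eq x (s • y) v → Force (x ∷ ρ) φ v
        instantiate s k e l p = qf⁻ (domain-∷ {ρ = ys} l (domain-mono {ρ = ys} e D))
          (hasSigns-∷ {ρ = ρ} {σ} {ys} p (hasSigns-mono {ρ = ρ} {σ} {ys} e h)) φ
          (eliminate⁻ (qf (s ∷ σ) φ) (domain-mono {ρ = ys} e D) l
            (mono (forceQ-regular (eliminate (qf (s ∷ σ) φ))) e k))

    value-scalar : ∀ f {w} → Eq (value [] f) (κ (scalar f)) w
    value-scalar (cst a) = eq-refl
    value-scalar null    = eq-sym κ-1
    value-scalar (f ⊞ g) = eq-trans (⊛-cong (value-scalar f) (value-scalar g)) (eq-sym (κ-* _ _ _ R.refl))
    value-scalar (k ⊠ f) = eq-trans (^-cong k (value-scalar f)) (κ-^ k)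
      where
      κ-^ : ∀ k {w} → Eq (κ (scalar f) ^ k) (κ (power _*ᶠ_ 1ᶠ (scalar f) k)) w
      κ-^ zero    = eq-sym κ-1
      κ-^ (suc k) = eq-trans (⊛-cong eq-refl (κ-^ k)) (eq-sym (κ-* _ _ _ R.refl))

    lower-less : ∀ f g → Lower f g → ∀ {w} → Less (value [] f) (value [] g) w
    lower-less f g l = less-resp (eq-sym (value-scalar f)) (eq-sym (value-scalar g)) (κ-less l)

    equal-eq : ∀ f g → Equal f g → ∀ {w} → Eq (value [] f) (value [] g) w
    equal-eq f g p = eq-trans (value-scalar f) (eq-trans (κ-cong p) (eq-sym (value-scalar g)))

    open DecisionCorrectness Lower Equal order lower-less equal-eq

    holds⇒force : ∀ φ → holds (qf [] φ) ≡ true → ∀ {w} → Force [] φ w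
    holds⇒force φ e = qf⁻ {ys = []} (λ ()) (λ ()) φ (≡.subst (λ b → Verdict b (qf [] φ)) e (verdict (qf [] φ)))

    fails⇒absurd : ∀ φ → holds (qf [] φ) ≡ false → ∀ {w} → Force [] φ w → Absurd w
    fails⇒absurd φ e k = ≡.subst (λ b → Verdict b (qf [] φ)) e (verdict (qf [] φ)) (qf⁺ {ys = []} (λ ()) (λ ()) φ k)

-- Roots in a complete ordered field

module Roots (R : CompleteOrderedField) where
  private module R = CompleteOrderedField R
  open R hiding (refl; +-assoc; +-comm)
  open OrderedField R
  open IsStrictTotalOrder isStrictTotalOrder using (irrefl) renaming (trans to lt-trans)
  open Algebra.Solver.Ring.NaturalCoefficients.Default commutativeSemiring using (solve; _:+_; _:*_; _:=_)

  infixr 8 _^_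
  _^_ : Carrier → ℕ → Carrier
  x ^ k = power _*_ 1# x k

  ≤-<-trans : ∀ {x y z} → x ≤ y → y < z → x < z
  ≤-<-trans {x} {y} p q with compare x y
  ... | tri< l _ _ = lt-trans l q
  ... | tri≈ _ e _ = <-resp (sym e) R.refl q
  ... | tri> _ _ g = ⊥-elim (p g)

  <-≤-trans : ∀ {x y z} → x < y → y ≤ z → x < z
  <-≤-trans {x} {y} {z} p q with compare y z
  ... | tri< l _ _ = lt-trans p l
  ... | tri≈ _ e _ = <-resp R.refl e p
  ... | tri> _ _ g = ⊥-elim (q g)

  *-mono-<ˡ : ∀ {x y z} → 0# < z → x < y → z * x < z * y
  *-mono-<ˡ p q = <-resp (*-comm _ _) (*-comm _ _) (*-mono-< p q)

  *-cancel-< : ∀ {x y z} → 0# < z → x * z < y * z → x < y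
  *-cancel-< {x} {y} p q with compare x y
  ... | tri< l _ _ = l
  ... | tri≈ _ e _ = ⊥-elim (irrefl (*-congʳ e) q)
  ... | tri> _ _ g = ⊥-elim (<-asym q (*-mono-< p g))

  *-mono-≤ : ∀ {x y z} → 0# < z → x ≤ y → z * x ≤ z * y
  *-mono-≤ p q l = q (*-cancel-< p (<-resp (*-comm _ _) (*-comm _ _) l))

  reciprocal : ∀ {x} → 0# < x → ∃ λ y → 0# < y × x * y ≈ 1#
  reciprocal {x} p with inverse x (<⇒≉0 p)
  ... | y , q = y , pos-inverse p q , q

  ^-pos : ∀ k {x} → 0# < x → 0# < x ^ k
  ^-pos zero    p = 0<1
  ^-pos (suc k) p = *-pos _ _ p (^-pos k p)

  ^-* : ∀ k x y → (x * y) ^ k ≈ x ^ k * y ^ k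
  ^-* zero    x y = sym (*-identityʳ 1#)
  ^-* (suc k) x y = trans (*-congˡ (^-* k x y))
    (solve 4 (λ a b c d → (a :* b) :* (c :* d) := (a :* c) :* (b :* d)) R.refl x y (x ^ k) (y ^ k))

  ^-mono : ∀ k {x y} → 0# < x → x < y → x ^ suc k < y ^ suc k
  ^-mono zero    p l = <-resp (sym (*-identityʳ _)) (sym (*-identityʳ _)) l
  ^-mono (suc k) p l = lt-trans (*-mono-< (^-pos (suc k) p) l) (*-mono-<ˡ (lt-trans p l) (^-mono k p l))

  ^-cong : ∀ k {x y} → x ≈ y → x ^ k ≈ y ^ k
  ^-cong zero    p = R.refl
  ^-cong (suc k) p = *-cong p (^-cong k p)

  ^-small : ∀ k {x} → 0# < x → x < 1# → x ^ suc k ≤ x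
  ^-small zero    p l g = irrefl (sym (*-identityʳ _)) g
  ^-small (suc k) {x} p l g = *-mono-≤ p (^-small k p l)
    (lt-trans (<-resp R.refl (*-identityʳ x) (*-mono-<ˡ p l)) g)

  ^-large : ∀ k {x} → 1# < x → x ≤ x ^ suc k
  ^-large zero    l g = irrefl (*-identityʳ _) g
  ^-large (suc k) {x} l g = *-mono-≤ (lt-trans 0<1 l) (^-large k l)
    (lt-trans g (<-resp (*-identityʳ x) R.refl (*-mono-<ˡ (lt-trans 0<1 l) l)))

  -- u = 2b / (1 + b), the harmonic mean of 1 and b.
  square-below : ∀ {b} → 1# < b → ∃ λ u → 1# < u × u * u < b
  square-below {b} l = u , 1<u , u²<b
    where
    b>0 = lt-trans 0<1 l
    d = 1# + b
    d>0 : 0# < d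
    d>0 = +-pos 0<1 b>0
    i = proj₁ (reciprocal d>0)
    i>0 = proj₁ (proj₂ (reciprocal d>0))
    di : d * i ≈ 1#
    di = proj₂ (proj₂ (reciprocal d>0))
    u = (b + b) * i
    1<u : 1# < u
    1<u = <-resp di R.refl (*-mono-< i>0 (+-mono-< 1# b b l))
    h = b - 1#
    b≈1+h : 1# + h ≈ b
    b≈1+h = add-difference 1# b
    d² : ((b + b) + (b + b)) + h * h ≈ d * d
    d² = trans (+-congʳ (+-cong (+-cong e e) (+-cong e e))) (trans
      (solve 2 (λ o h → ((o :* (o :+ h) :+ o :* (o :+ h)) :+ (o :* (o :+ h) :+ o :* (o :+ h))) :+ h :* h
                      := (o :+ (o :+ h)) :* (o :+ (o :+ h))) R.refl 1# h)
      (*-cong (+-congˡ b≈1+h) (+-congˡ b≈1+h)))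
      where
      e : b ≈ 1# * (1# + h)
      e = trans (sym b≈1+h) (sym (*-identityˡ _))
    4b<d² : (b + b) + (b + b) < d * d
    4b<d² = <-resp (+-identityˡ _) (trans (R.+-comm _ _) d²)
      (+-mono-< 0# (h * h) _ (*-pos h h (difference-pos l) (difference-pos l)))
    u²<b : u * u < b
    u²<b = <-resp
      (solve 2 (λ b i → ((b :+ b) :+ (b :+ b)) :* (b :* (i :* i)) := ((b :+ b) :* i) :* ((b :+ b) :* i)) R.refl b i)
      (trans (solve 3 (λ b d i → (d :* d) :* (b :* (i :* i)) := b :* ((d :* i) :* (d :* i))) R.refl b d i)
        (trans (*-congˡ (trans (*-cong di di) (*-identityʳ 1#))) (*-identityʳ b)))
      (*-mono-< (*-pos _ _ b>0 (*-pos _ _ i>0 i>0)) 4b<d²)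

  -- Continuity of powers at 1 from the right. With u² < b and, inductively, t ≤ u and t^k < u, one
  -- gets t · t^k < t · u ≤ u² < b; the bound t ≤ b is carried along for this induction.
  power-below : ∀ k {b} → 1# < b → ∃ λ t → 1# < t × t ≤ b × t ^ k < b
  power-below zero    {b} l = b , l , irrefl R.refl , l
  power-below (suc k) {b} l with square-below l
  ... | u , 1<u , u²<b with power-below k 1<u
  ...   | t , 1<t , t≤u , tᵏ<u =
    t , 1<t , (λ b<t → t≤u (lt-trans (lt-trans u<u² u²<b) b<t)) ,
    lt-trans (*-mono-<ˡ (lt-trans 0<1 1<t) tᵏ<u) (≤-<-trans
      (λ g → *-mono-≤ (lt-trans 0<1 1<u) t≤u (<-resp R.refl (*-comm t u) g)) u²<b)
    where
    u<u² : u < u * u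
    u<u² = <-resp (*-identityʳ u) R.refl (*-mono-<ˡ (lt-trans 0<1 1<u) 1<u)

  -- Let s be the supremum of the positive x with x^n ≤ a. If s^n < a, choose t > 1 with t^n < a /
  -- s^n: then t · s still belongs to the set. If s^n > a, choose t > 1 with t^n < s^n / a: then s /
  -- t is a smaller upper bound.
  root-exists : ∀ k {a} → 0# < a → ∃ λ y → 0# < y × y ^ suc k ≈ a
  root-exists k {a} a>0 = s , s>0 , is-root
    where
    n = suc k

    Small : Carrier → Set
    Small x = 0# < x × x ^ n ≤ a

    1^ : ∀ k → 1# ^ k ≈ 1#
    1^ zero    = R.refl
    1^ (suc k) = trans (*-identityˡ _) (1^ k)

    small : ∃ Small
    small with compare a 1#
    ... | tri< l _ _ = a , a>0 , ^-small k a>0 l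
    ... | tri≈ _ e _ = 1# , 0<1 , irrefl (trans e (sym (1^ n)))
    ... | tri> _ _ g = 1# , 0<1 , λ l → <-asym g (<-resp R.refl (1^ n) l)

    -- Any x beyond 1 + a exceeds 1, hence x^n ≥ x > a.
    bound : UpperBound Small (1# + a)
    bound x (_ , p) l = p (<-≤-trans (lt-trans a<1+a l) (^-large k x>1))
      where
      a<1+a : a < 1# + a
      a<1+a = <-resp (+-identityˡ a) R.refl (+-mono-< 0# 1# a 0<1)
      x>1 : 1# < x
      x>1 = lt-trans (<-resp (+-identityˡ _) (R.+-comm _ _) (+-mono-< 0# a 1# a>0)) l

    sup = supremum Small small (1# + a , bound)
    s = proj₁ sup

    s>0 : 0# < s
    s>0 = <-≤-trans (proj₁ (proj₂ small)) (proj₁ (proj₂ sup) _ (proj₂ small))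

    is-root : s ^ n ≈ a
    is-root with compare (s ^ n) a
    ... | tri≈ _ e _ = e
    ... | tri< l _ _ = ⊥-elim (proj₁ (proj₂ sup) (t * s) (*-pos _ _ t>0 s>0 , power-small) s<ts)
      where
      sⁿ>0 = ^-pos n s>0
      i = reciprocal sⁿ>0
      b>1 : 1# < a * proj₁ i
      b>1 = <-resp (proj₂ (proj₂ i)) R.refl (*-mono-< (proj₁ (proj₂ i)) l)
      below = power-below n b>1
      t = proj₁ below
      t>0 = lt-trans 0<1 (proj₁ (proj₂ below))
      s<ts : s < t * s
      s<ts = <-resp (*-identityˡ s) R.refl (*-mono-< s>0 (proj₁ (proj₂ below)))
      power-small : (t * s) ^ n ≤ a
      power-small g = <-asym g (<-resp (sym (^-* n t s))
        (trans (*-assoc _ _ _) (trans (*-congˡ (trans (*-comm _ _) (proj₂ (proj₂ i)))) (*-identityʳ a)))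
        (*-mono-< sⁿ>0 (proj₂ (proj₂ (proj₂ below)))))
    ... | tri> _ _ g = ⊥-elim (proj₂ (proj₂ sup) r upper r<s)
      where
      i = reciprocal a>0
      b>1 : 1# < s ^ n * proj₁ i
      b>1 = <-resp (proj₂ (proj₂ i)) R.refl (*-mono-< (proj₁ (proj₂ i)) g)
      below = power-below n b>1
      t = proj₁ below
      t>0 = lt-trans 0<1 (proj₁ (proj₂ below))
      j = reciprocal t>0
      r = s * proj₁ j
      r>0 = *-pos _ _ s>0 (proj₁ (proj₂ j))
      rt≈s : r * t ≈ s
      rt≈s = trans (*-assoc _ _ _) (trans (*-congˡ (trans (*-comm _ _) (proj₂ (proj₂ j)))) (*-identityʳ s))
      r<s : r < s
      r<s = <-resp (*-identityʳ r) rt≈s (*-mono-<ˡ r>0 (proj₁ (proj₂ below)))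
      a<rⁿ : a < r ^ n
      a<rⁿ = *-cancel-< (^-pos n t>0) (<-resp (*-comm _ _)
        (trans (trans (*-assoc _ _ _) (trans (*-congˡ (trans (*-comm _ _) (proj₂ (proj₂ i)))) (*-identityʳ _)))
          (trans (^-cong n (sym rt≈s)) (^-* n r t)))
        (*-mono-< a>0 (proj₂ (proj₂ (proj₂ below)))))
      upper : UpperBound Small r
      upper x (_ , p) r<x = p (lt-trans a<rⁿ (^-mono k r>0 r<x))

-- The reals as a model; truth is the verdict of the elimination

module RealModel {R : CompleteOrderedField} (F : Subfield R) where
  private module R = CompleteOrderedField R
  open R using (_≈_; _<_; _+_; _*_; -_; _-_; _÷_; 0#; 1#; 0<1; _≟_; _<?_)
  open Subfield F
  open Elements F
  open OrderedField R
  open Roots R using (root-exists; reciprocal)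
  open IsStrictTotalOrder R.isStrictTotalOrder using (irrefl) renaming (trans to lt-trans)
  open Algebra.Properties.Ring R.ring using (-1*x≈-x)

  -- A single world with empty absurdity, where forcing is Tarski truth. The atoms are stable
  -- because the order of the reals is decidable.
  frame : Frame
  frame = record
    { worlds = record
      { World = ⊤ ; _⊑_ = λ _ _ → ⊤ ; ⊑-refl = tt ; ⊑-trans = λ _ _ → tt
      ; Absurd = λ _ → ⊥ ; absurd-mono = λ _ a → a }
    ; Carrier = R.Carrier
    ; Eq = λ x y _ → x ≈ y
    ; Less = λ x y _ → x < y
    ; eq-regular = λ {x} {y} → record { mono = λ _ p → p ; stable = λ d → decidable-stable (x ≟ y) (λ n → d tt (λ _ → n)) }
    ; less-regular = λ {x} {y} → record { mono = λ _ p → p ; stable = λ d → decidable-stable (x <? y) (λ n → d tt (λ _ → n)) }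
    ; eq-refl = R.refl ; eq-sym = R.sym ; eq-trans = R.trans
    ; less-resp = <-resp }

  open Frame frame

  now : ∀ {P : ⊤ → Set} → P tt → ◇ P tt
  now p _ k = k tt p

  trichotomy : ∀ x y → x < y ⊎ x ≈ y ⊎ y < x
  trichotomy x y with R.compare x y
  ... | tri< l _ _ = inj₁ l
  ... | tri≈ _ e _ = inj₂ (inj₁ e)
  ... | tri> _ _ g = inj₂ (inj₂ g)

  sign : ∀ {x y} → x + y ≈ 0# → ∀ z → x * z + y * z ≈ 0#
  sign {x} {y} p z = R.trans (R.sym (R.distribʳ z x y)) (R.trans (R.*-congʳ p) (R.zeroˡ z))

  model : StarModel F frame
  model = record
    { 𝟘 = 0# ; 𝟙 = 1# ; κ = ⌊_⌋ ; _⊹_ = _+_ ; _⊛_ = _*_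
    ; ⊹-cong = R.+-cong ; ⊛-cong = R.*-cong
    ; ⊹-assoc = R.+-assoc ; ⊹-comm = R.+-comm ; ⊹-identity = R.+-identityʳ
    ; ⊹-inverse = λ x → now (- x , R.-‿inverseʳ x)
    ; less-irrefl = irrefl R.refl ; less-trans = lt-trans
    ; compare = λ x y → now (trichotomy x y)
    ; ⊹-less = λ z → R.+-mono-< _ _ z
    ; ⊛-pos = R.*-pos _ _
    ; ⊛-assoc⁺ = λ _ _ _ → R.*-assoc _ _ _ ; ⊛-comm⁺ = λ _ _ → R.*-comm _ _
    ; 𝟙-pos = 0<1 ; ⊛-identity⁺ = λ _ → R.*-identityʳ _
    ; ⊛-inverse⁺ = λ p → now (reciprocal p)
    ; ⊛-less⁺ = λ _ _ p → *-mono-< p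
    ; root = λ k p → now (root-exists k p)
    ; ⊛-signˡ = λ z p → sign p z
    ; ⊛-signʳ = λ z p → R.trans (R.+-cong (R.*-comm _ _) (R.*-comm _ _)) (sign p z)
    ; κ-+ = λ _ _ _ p → p ; κ-* = λ _ _ _ p → p ; κ-pos = λ _ p → p
    ; κ-distribʳ = λ a b d p x → R.trans (R.*-congʳ p) (R.distribʳ x _ _)
    ; κ-distribˡ = λ a x y → R.distribˡ _ x y }

  open Structures model

  quotient : ∀ x y → Quotient x y (x ÷ y) tt
  quotient x y with y ≟ 0#
  ... | yes y≈0 = inj₁ (y≈0 , R.refl)
  ... | no  y≉0 = inj₂ (apart , R.trans (R.*-assoc _ _ _)
    (R.trans (R.*-congˡ (R.trans (R.*-comm _ _) (proj₂ (R.inverse y y≉0)))) (R.*-identityʳ x)))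
    where
    apart : Apart y tt
    apart with R.compare 0# y
    ... | tri< l _ _ = inj₁ l
    ... | tri≈ _ e _ = ⊥-elim (y≉0 (R.sym e))
    ... | tri> _ _ g = inj₂ g

  module Agreement {L : Language} (S : Structure frame L) (I : Interpretation R L)
    (values : ∀ {n} (ρ : Vec R.Carrier n) t → Forcing.Value S ρ t (Truth.value I ρ t) tt) where
    open Forcing S hiding (Value)
    open Truth I

    mutual
      holds⇒force : ∀ {n} {ρ : Vec R.Carrier n} φ → Holds ρ φ → Force ρ φ tt
      holds⇒force (t ≐ u) h = same-value⁺ eq-regular (λ p q r → R.trans (R.sym p) (R.trans r q)) t u
        (values _ t) (values _ u) h
      holds⇒force (t ≺ u) h = same-value⁺ less-regular less-resp t u (values _ t) (values _ u) h
      holds⇒force ⊥′      h = h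
      holds⇒force (φ ⇒ ψ) h _ p = holds⇒force ψ (h (force⇒holds φ p))
      holds⇒force (∀′ φ)  h x = holds⇒force φ (h x)

      force⇒holds : ∀ {n} {ρ : Vec R.Carrier n} φ → Force ρ φ tt → Holds ρ φ
      force⇒holds (t ≐ u) h = h tt (values _ t) (values _ u)
      force⇒holds (t ≺ u) h = h tt (values _ t) (values _ u)
      force⇒holds ⊥′      h = h
      force⇒holds (φ ⇒ ψ) h p = force⇒holds ψ (h tt (holds⇒force φ p))
      force⇒holds (∀′ φ)  h x = force⇒holds φ (h x)

  add-values : ∀ {n} (ρ : Vec R.Carrier n) t → Forcing.Value additiveStructure ρ t (Truth.value (addReals F) ρ t) tt
  add-values ρ (# i)         = R.refl
  add-values ρ (con `0)      = R.refl
  add-values ρ (con `1)      = R.refl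
  add-values ρ (app₁ a t)    = _ , add-values ρ t , R.refl
  add-values ρ (app₂ `+ t u) = _ , _ , add-values ρ t , add-values ρ u , R.refl
  add-values ρ (app₂ `- t u) = _ , _ , add-values ρ t , add-values ρ u , R.+-congˡ (-1*x≈-x _)

  mult-values : ∀ {n} (ρ : Vec R.Carrier n) t →
                Forcing.Value multiplicativeStructure ρ t (Truth.value (multReals F) ρ t) tt
  mult-values ρ (# i)         = R.refl
  mult-values ρ (con `0)      = R.refl
  mult-values ρ (con `1)      = R.refl
  mult-values ρ (app₁ a t)    = _ , mult-values ρ t , R.refl
  mult-values ρ (app₂ `× t u) = _ , _ , mult-values ρ t , mult-values ρ u , R.refl
  mult-values ρ (app₂ `÷ t u) = _ , _ , mult-values ρ t , mult-values ρ u , quotient _ _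

  private
    module Add  = Agreement additiveStructure (addReals F) add-values
    module Mult = Agreement multiplicativeStructure (multReals F) mult-values

  -- The verdict is a Boolean, and a negative one would refute in the reals a sentence that is true
  -- there.
  add-true⇒holds : ∀ φ → Tadd F φ → AddQE.holds F (AddQE.qf F φ) ≡ true
  add-true⇒holds φ t with AddQE.holds F (AddQE.qf F φ) in e
  ... | true  = refl
  ... | false = ⊥-elim (AddQE.fails⇒absurd F model φ e (Add.holds⇒force φ t))

  mult-true⇒holds : ∀ φ → Tmult F φ → MultQE.holds F (MultQE.qf F [] φ) ≡ true
  mult-true⇒holds φ t with MultQE.holds F (MultQE.qf F [] φ) in e
  ... | true  = refl
  ... | false = ⊥-elim (MultQE.fails⇒absurd F model φ e (Mult.holds⇒force φ t))

-- Both theories being complete, by quantifier elimination, truth in the reals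
-- is truth in every model.
module _ {R : CompleteOrderedField} (F : Subfield R) {K : Frame} (M : StarModel F K) where
  open Structures M
  open Forcing combined using (Force)

  true⇒forced : ∀ {τ} → T[ F ] τ → ∀ {w} → Force [] τ w
  true⇒forced (add {σ} t) = force-translate⁺ (add⊆combined F) combined σ
    (AddQE.holds⇒force F M σ (RealModel.add-true⇒holds F σ t))
  true⇒forced (mult {σ} t) = force-translate⁺ (mult⊆combined F) combined σ
    (MultQE.holds⇒force F M σ (RealModel.mult-true⇒holds F σ t))

-- Derived rules of natural deduction

extend : ∀ {L n m} → Term L m → (Fin n → Term L m) → Fin (suc n) → Term L m
extend t σ zero    = t
extend t σ (suc i) = σ i

lift-[] : ∀ {L n m} (σ : Fin n → Term L m) (t : Term L m) (φ : Formula L (suc n)) →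
          subst (lift σ) φ [ t ] ≡ subst (extend t σ) φ
lift-[] σ t φ = ≡.trans (subst-∘ (single t) (lift σ) φ)
  (subst-cong (λ { zero → refl ; (suc i) → single-wkTerm t (σ i) }) φ)

module _ {L : Language} {T : Theory L} {n} {Γ : List (Formula L n)} where

  ∧-E₁ : ∀ {φ ψ} → T ∣ Γ ⊢ φ ∧′ ψ → T ∣ Γ ⊢ φ
  ∧-E₁ d = raa (⇒-E (⊢-weaken d there) (⇒-I (⇒-I (⇒-E (hyp (there (there (here refl)))) (hyp (there (here refl)))))))

  ∧-E₂ : ∀ {φ ψ} → T ∣ Γ ⊢ φ ∧′ ψ → T ∣ Γ ⊢ ψ
  ∧-E₂ d = raa (⇒-E (⊢-weaken d there) (⇒-I (hyp (there (here refl)))))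

  -- Keeps repeated instantiation a single simultaneous substitution, so that instances of concrete
  -- axioms compute to the expected formulas.
  ∀-E* : ∀ {m} {σ : Fin m → Term L n} {φ : Formula L (suc m)} → T ∣ Γ ⊢ subst σ (∀′ φ) →
         ∀ t → T ∣ Γ ⊢ subst (extend t σ) φ
  ∀-E* {σ = σ} {φ} d t = ≡.subst (T ∣ Γ ⊢_) (lift-[] σ t φ) (∀-E d t)

  ≐-sym : ∀ {t u} → T ∣ Γ ⊢ t ≐ u → T ∣ Γ ⊢ u ≐ t
  ≐-sym {t} {u} d = ≡.subst (λ s → T ∣ Γ ⊢ u ≐ s) (single-wkTerm u t)
    (≐-E (# zero ≐ wkTerm t) d (≡.subst (λ s → T ∣ Γ ⊢ t ≐ s) (≡.sym (single-wkTerm t t)) (≐-I t)))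

  ≐-trans : ∀ {s t u} → T ∣ Γ ⊢ s ≐ t → T ∣ Γ ⊢ t ≐ u → T ∣ Γ ⊢ s ≐ u
  ≐-trans {s} {t} {u} d e = ≡.subst (λ r → T ∣ Γ ⊢ r ≐ u) (single-wkTerm u s)
    (≐-E (wkTerm s ≐ # zero) e (≡.subst (λ r → T ∣ Γ ⊢ r ≐ t) (≡.sym (single-wkTerm t s)) d))

  ≺-respˡ : ∀ {s t u} → T ∣ Γ ⊢ s ≐ t → T ∣ Γ ⊢ s ≺ u → T ∣ Γ ⊢ t ≺ u
  ≺-respˡ {s} {t} {u} d e = ≡.subst (λ r → T ∣ Γ ⊢ t ≺ r) (single-wkTerm t u)
    (≐-E (# zero ≺ wkTerm u) d (≡.subst (λ r → T ∣ Γ ⊢ s ≺ r) (≡.sym (single-wkTerm s u)) e))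

  ≺-respʳ : ∀ {s t u} → T ∣ Γ ⊢ t ≐ u → T ∣ Γ ⊢ s ≺ t → T ∣ Γ ⊢ s ≺ u
  ≺-respʳ {s} {t} {u} d e = ≡.subst (λ r → T ∣ Γ ⊢ r ≺ u) (single-wkTerm u s)
    (≐-E (wkTerm s ≺ # zero) d (≡.subst (λ r → T ∣ Γ ⊢ r ≺ t) (≡.sym (single-wkTerm t s)) e))

  app₂-congˡ : ∀ {f s t u} → T ∣ Γ ⊢ s ≐ t → T ∣ Γ ⊢ app₂ f s u ≐ app₂ f t u
  app₂-congˡ {f} {s} {t} {u} d =
    ≡.subst₂ (λ r q → T ∣ Γ ⊢ app₂ f r q ≐ app₂ f t q) (single-wkTerm t s) (single-wkTerm t u)
      (≐-E (app₂ f (wkTerm s) (wkTerm u) ≐ app₂ f (# zero) (wkTerm u)) d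
        (≡.subst (λ r → T ∣ Γ ⊢ app₂ f r (substTerm (single s) (wkTerm u)) ≐ app₂ f s (substTerm (single s) (wkTerm u)))
          (≡.sym (single-wkTerm s s)) (≐-I _)))

  app₂-congʳ : ∀ {f s t u} → T ∣ Γ ⊢ s ≐ t → T ∣ Γ ⊢ app₂ f u s ≐ app₂ f u t
  app₂-congʳ {f} {s} {t} {u} d =
    ≡.subst₂ (λ r q → T ∣ Γ ⊢ app₂ f q r ≐ app₂ f q t) (single-wkTerm t s) (single-wkTerm t u)
      (≐-E (app₂ f (wkTerm u) (wkTerm s) ≐ app₂ f (wkTerm u) (# zero)) d
        (≡.subst (λ r → T ∣ Γ ⊢ app₂ f (substTerm (single s) (wkTerm u)) r ≐ app₂ f (substTerm (single s) (wkTerm u)) s)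
          (≡.sym (single-wkTerm s s)) (≐-I _)))

-- The generic model of a theory

-- The generic model of T: closed terms with countably many new constants;
-- worlds are finite lists of assumptions.
module Generic {L : Language} (T : Theory L) where
  open Language

  L⁺ : Language
  L⁺ = record { Fun₀ = Fun₀ L ⊎ ℕ ; Fun₁ = Fun₁ L ; Fun₂ = Fun₂ L }

  embed : Translation L L⁺
  embed = record { fun₀ = inj₁ ; fun₁ = id ; fun₂ = id }

  data T⁺ : Theory L⁺ where
    embedded : ∀ {τ} → T τ → T⁺ (translate embed τ)

  new : ∀ {n} → ℕ → Term L⁺ n
  new k = con (inj₂ k)

  -- One more than the largest index of a new constant, or 0 if there is none. So `bound φ ≤ k` says
  -- that the new constants of φ have indices below k, and then `new k` is fresh.
  boundTerm : ∀ {n} → Term L⁺ n → ℕ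
  boundTerm (# i)          = 0
  boundTerm (con (inj₁ _)) = 0
  boundTerm (con (inj₂ k)) = suc k
  boundTerm (app₁ f t)     = boundTerm t
  boundTerm (app₂ f t u)   = boundTerm t ℕ.⊔ boundTerm u

  bound : ∀ {n} → Formula L⁺ n → ℕ
  bound (t ≐ u) = boundTerm t ℕ.⊔ boundTerm u
  bound (t ≺ u) = boundTerm t ℕ.⊔ boundTerm u
  bound ⊥′      = 0
  bound (φ ⇒ ψ) = bound φ ℕ.⊔ bound ψ
  bound (∀′ φ)  = bound φ

  bounds : ∀ {n} → List (Formula L⁺ n) → ℕ
  bounds []      = 0
  bounds (φ ∷ Γ) = bound φ ℕ.⊔ bounds Γ

  bound-∈ : ∀ {n} {φ : Formula L⁺ n} {Γ} → φ ∈ Γ → bound φ ℕ.≤ bounds Γ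
  bound-∈ {Γ = φ ∷ Γ} (here refl) = ℕ.m≤m⊔n (bound φ) (bounds Γ)
  bound-∈ {Γ = φ ∷ Γ} (there p)   = ℕ.≤-trans (bound-∈ p) (ℕ.m≤n⊔m (bound φ) (bounds Γ))

  module Self = Replacement {L⁺} {L⁺} id id
  open Self using (Constants; term; form)

  FixesL : ∀ {m} → Constants m → Set
  FixesL κ = ∀ k → κ (inj₁ k) ≡ con (inj₁ k)

  FixesBelow : ∀ {m} → ℕ → Constants m → Set
  FixesBelow b κ = ∀ k → k ℕ.< b → κ (inj₂ k) ≡ new k

  module _ {b : ℕ} where

    term-fixes : ∀ {n m} (σ : Fin n → Term L⁺ m) {κ} → FixesL κ → FixesBelow b κ →
                 ∀ t → boundTerm t ℕ.≤ b → term σ κ t ≡ substTerm σ t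
    term-fixes σ f g (# i)          p = refl
    term-fixes σ f g (con (inj₁ k)) p = f k
    term-fixes σ f g (con (inj₂ k)) p = g k p
    term-fixes σ f g (app₁ h t)     p = ≡.cong (app₁ h) (term-fixes σ f g t p)
    term-fixes σ f g (app₂ h t u)   p = ≡.cong₂ (app₂ h)
      (term-fixes σ f g t (ℕ.m⊔n≤o⇒m≤o _ _ p)) (term-fixes σ f g u (ℕ.m⊔n≤o⇒n≤o (boundTerm t) _ p))

    form-fixes : ∀ {n m} (σ : Fin n → Term L⁺ m) {κ} → FixesL κ → FixesBelow b κ →
                 ∀ φ → bound φ ℕ.≤ b → form σ κ φ ≡ subst σ φ
    form-fixes σ f g (t ≐ u) p = ≡.cong₂ _≐_
      (term-fixes σ f g t (ℕ.m⊔n≤o⇒m≤o _ _ p)) (term-fixes σ f g u (ℕ.m⊔n≤o⇒n≤o (boundTerm t) _ p))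
    form-fixes σ f g (t ≺ u) p = ≡.cong₂ _≺_
      (term-fixes σ f g t (ℕ.m⊔n≤o⇒m≤o _ _ p)) (term-fixes σ f g u (ℕ.m⊔n≤o⇒n≤o (boundTerm t) _ p))
    form-fixes σ f g ⊥′      p = refl
    form-fixes σ f g (φ ⇒ ψ) p = ≡.cong₂ _⇒_
      (form-fixes σ f g φ (ℕ.m⊔n≤o⇒m≤o _ _ p)) (form-fixes σ f g ψ (ℕ.m⊔n≤o⇒n≤o (bound φ) _ p))
    form-fixes σ f g (∀′ φ)  p = ≡.cong ∀′
      (form-fixes (lift σ) (λ k → ≡.cong wkTerm (f k)) (λ k q → ≡.cong wkTerm (g k q)) φ p)

  fixesL-wk : ∀ {m} {κ : Constants m} → FixesL κ → FixesL (wkTerm ∘ κ)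
  fixesL-wk f k = ≡.cong wkTerm (f k)

  fixesL-axiom : ∀ {m} {κ : Constants m} {Δ τ} → FixesL κ → T⁺ τ → T⁺ ∣ Δ ⊢ form (λ ()) κ τ
  fixesL-axiom {κ = κ} {Δ} f (embedded {τ} a) = ≡.subst (T⁺ ∣ Δ ⊢_) (≡.sym (≡.trans
      (form-translate embed (λ ()) κ τ) (≡.trans
      (Replacement.form-cong id id (λ ()) f τ)
      (≡.trans (≡.sym (form-translate embed (λ ()) con τ)) (form-con (λ ()) (translate embed τ))))))
    (axiom (embedded a))

  -- A fresh constant is as good as a variable: putting `# zero` for it throughout the derivation
  -- changes neither the assumptions nor φ, in which it does not occur.
  generalise : ∀ {Γ} {φ : Formula L⁺ 1} k → bounds Γ ℕ.≤ k → bound φ ℕ.≤ k →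
               T⁺ ∣ Γ ⊢ φ [ new k ] → T⁺ ∣ Γ ⊢ ∀′ φ
  generalise {Γ} {φ} k Γ≤k φ≤k d = ∀-I (≡.subst (T⁺ ∣ map wk Γ ⊢_) result
    (Self.Transport.transport FixesL (λ {_} {κ} → fixesL-wk {κ = κ}) fixesL-axiom d {σ = λ ()} {κ} (λ _ → refl) assumption))
    where
    κ : Constants 1
    κ (inj₁ j) = con (inj₁ j)
    κ (inj₂ j) with j ℕ.≟ k
    ... | yes _ = # zero
    ... | no  _ = new j

    κ-k : κ (inj₂ k) ≡ # zero
    κ-k with k ℕ.≟ k
    ... | yes _   = refl
    ... | no  k≢k = ⊥-elim (k≢k refl)

    κ-below : FixesBelow k κ
    κ-below j j<k with j ℕ.≟ k
    ... | yes j≡k = ⊥-elim (ℕ.<⇒≢ j<k j≡k)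
    ... | no  _   = refl

    assumption : ∀ {γ} → γ ∈ Γ → form (λ ()) κ γ ∈ map wk Γ
    assumption {γ} p = ≡.subst (_∈ map wk Γ)
      (≡.sym (≡.trans (form-fixes (λ ()) (λ _ → refl) κ-below γ (ℕ.≤-trans (bound-∈ p) Γ≤k)) (subst-cong (λ ()) γ)))
      (∈-map⁺ wk p)

    result : form (λ ()) κ (φ [ new k ]) ≡ φ
    result = ≡.trans (Self.form-subst (λ ()) κ (single (new k)) φ) (≡.trans
      (Self.form-cong (λ { zero → κ-k }) (λ _ → refl) φ) (≡.trans
      (form-fixes #_ (λ _ → refl) κ-below φ φ≤k) (subst-id (λ _ → refl) φ)))

  frame : Frame
  frame = record
    { worlds = record
      { World = List (Sentence L⁺) ; _⊑_ = λ Γ Δ → ∀ {φ} → φ ∈ Γ → φ ∈ Δ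
      ; ⊑-refl = id ; ⊑-trans = λ e e′ → e′ ∘ e
      ; Absurd = λ Γ → T⁺ ∣ Γ ⊢ ⊥′ ; absurd-mono = λ e d → ⊢-weaken d e }
    ; Carrier = Term L⁺ 0
    ; Eq = λ t u Γ → T⁺ ∣ Γ ⊢ t ≐ u
    ; Less = λ t u Γ → T⁺ ∣ Γ ⊢ t ≺ u
    -- The double negation is applied in the world extended by the negated atom; there, deriving the
    -- atom is inconsistent, and `raa` discharges the extra assumption.
    ; eq-regular = record { mono = λ e d → ⊢-weaken d e
                          ; stable = λ d → raa (d there (λ e → ⇒-E (hyp (e (here refl))))) }
    ; less-regular = record { mono = λ e d → ⊢-weaken d e
                            ; stable = λ d → raa (d there (λ e → ⇒-E (hyp (e (here refl))))) }
    ; eq-refl = ≐-I _ ; eq-sym = ≐-sym ; eq-trans = ≐-trans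
    ; less-resp = λ p q d → ≺-respʳ q (≺-respˡ p d) }

  open Frame frame

  -- If every witness made the world inconsistent, then so would a fresh constant. Generalising over
  -- it derives `∀′ (¬′ φ)`, which `∃′ φ` denies.
  fresh-witness : ∀ {Γ} {φ : Formula L⁺ 1} → T⁺ ∣ Γ ⊢ ∃′ φ → ◇ (λ Δ → ∃ λ y → T⁺ ∣ Δ ⊢ φ [ y ]) Γ
  fresh-witness {φ = φ} d {Δ} e k = ⇒-E (⊢-weaken d e)
    (generalise n (ℕ.m≤m⊔n (bounds Δ) (bound (¬′ φ))) (ℕ.m≤n⊔m (bounds Δ) (bound (¬′ φ)))
      (⇒-I (k there (new n , hyp (here refl)))))
    where n = bounds Δ ℕ.⊔ bound (¬′ φ)

  ∃-E : ∀ {Γ m} {σ : Fin m → Term L⁺ 0} {φ} → T⁺ ∣ Γ ⊢ subst σ (∃′ φ) →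
        ◇ (λ Δ → ∃ λ y → T⁺ ∣ Δ ⊢ subst (extend y σ) φ) Γ
  ∃-E {σ = σ} {φ} d = ◇-map (fresh-witness d) λ { {Δ} _ (y , p) → y , ≡.subst (T⁺ ∣ Δ ⊢_) (lift-[] σ y φ) p }

  ∨-E : ∀ {Γ φ ψ} → T⁺ ∣ Γ ⊢ φ ∨′ ψ → ◇ (λ Δ → T⁺ ∣ Δ ⊢ φ ⊎ T⁺ ∣ Δ ⊢ ψ) Γ
  ∨-E d e k = k id (inj₂ (⇒-E (⊢-weaken d e) (⇒-I (k there (inj₁ (hyp (here refl)))))))

  T-axiom : ∀ {Γ : List (Sentence L⁺)} {τ} → T τ → T⁺ ∣ Γ ⊢ subst (λ ()) (translate embed τ)
  T-axiom a = axiom (embedded a)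

  -- The new constants of a finished derivation are all replaced by one constant of L; `default`
  -- provides it.
  conservative : Fun₀ L → ∀ {φ} → T⁺ ⊢ translate embed φ → T ⊢ φ
  conservative default {φ} d = ≡.subst (T ⊢_) (restrict {κ = κ} (λ ()) (λ _ → refl) φ)
    (Back.Transport.transport Good (λ g k → ≡.cong wkTerm (g k)) good-axiom d {σ = λ ()} {κ} (λ _ → refl) (λ ()))
    where
    module Back = Replacement {L⁺} {L} id id

    κ : Back.Constants 0
    κ (inj₁ k) = con k
    κ (inj₂ _) = con default

    Good : ∀ {m} → Back.Constants m → Set
    Good κ = ∀ k → κ (inj₁ k) ≡ con k

    back : ∀ {m} (σ : Fin 0 → Term L m) {κ} → Good κ → ∀ φ → Back.form σ κ (translate embed φ) ≡ subst σ φ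
    back σ {κ} g φ = ≡.trans (form-translate embed σ κ φ)
      (≡.trans (Replacement.form-cong id id (λ _ → refl) g φ) (form-con σ φ))

    restrict : ∀ {κ} (σ : Fin 0 → Term L 0) → Good κ → ∀ φ → Back.form σ κ (translate embed φ) ≡ φ
    restrict σ g φ = ≡.trans (back σ g φ) (subst-id (λ ()) φ)

    good-axiom : ∀ {m} {κ : Back.Constants m} {Δ τ} → Good κ → T⁺ τ → T ∣ Δ ⊢ Back.form (λ ()) κ τ
    good-axiom {Δ = Δ} g (embedded {τ} a) = ≡.subst (T ∣ Δ ⊢_) (≡.sym (back (λ ()) g τ)) (axiom a)

-- From T[F] to T[F]*: forcing of ring formulas is derivability

module GenericModel {R : CompleteOrderedField} (F : Subfield R) where
  open Generic T[ F ]*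
  open Frame frame
  infixl 6 _⊹_
  infixl 7 _⊛_
  _⊹_ _⊛_ : ∀ {n} → Term L⁺ n → Term L⁺ n → Term L⁺ n
  _⊹_ = app₂ `+
  _⊛_ = app₂ `×

  O : ∀ {n} → Term L⁺ n
  O = con (inj₁ (inj₁ `0))

  I : ∀ {n} → Term L⁺ n
  I = con (inj₁ (inj₁ `1))

  instance₁ : ∀ {Γ φ} → T[ F ]* (∀′ φ) → ∀ x → T⁺ ∣ Γ ⊢ subst (extend x (λ ())) (translate embed φ)
  instance₁ {φ = φ} a x = ∀-E* {φ = translate embed φ} (T-axiom a) x

  instance₂ : ∀ {Γ φ} → T[ F ]* (∀′ (∀′ φ)) → ∀ x y →
              T⁺ ∣ Γ ⊢ subst (extend y (extend x (λ ()))) (translate embed φ)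
  instance₂ {φ = φ} a x y = ∀-E* {φ = translate embed φ} (instance₁ a x) y

  instance₃ : ∀ {Γ φ} → T[ F ]* (∀′ (∀′ (∀′ φ))) → ∀ x y z →
              T⁺ ∣ Γ ⊢ subst (extend z (extend y (extend x (λ ())))) (translate embed φ)
  instance₃ {φ = φ} a x y z = ∀-E* {φ = translate embed φ} (instance₂ a x y) z

  instance-∃ : ∀ {Γ φ} → T[ F ]* (∀′ (∃′ φ)) → ∀ x →
               ◇ (λ Δ → ∃ λ y → T⁺ ∣ Δ ⊢ subst (extend y (extend x (λ ()))) (translate embed φ)) Γ
  instance-∃ {φ = φ} a x = ∃-E {φ = translate embed φ} (instance₁ a x)

  infixl 9 _∙⊢_
  _∙⊢_ : ∀ {Γ} {φ ψ : Sentence L⁺} → T⁺ ∣ Γ ⊢ φ ⇒ ψ → T⁺ ∣ Γ ⊢ φ → T⁺ ∣ Γ ⊢ ψ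
  _∙⊢_ = ⇒-E

  pow-power : ∀ k {n} (σ : Fin (suc n) → Term L⁺ 0) →
              substTerm σ (translateTerm embed (pow F (# zero) k)) ≡ power _⊛_ I (σ zero) k
  pow-power zero    σ = refl
  pow-power (suc k) σ = ≡.cong (σ zero ⊛_) (pow-power k σ)

  model : StarModel F frame
  model = record
    { 𝟘 = O ; 𝟙 = I ; κ = λ a → con (inj₁ (inj₂ a)) ; _⊹_ = _⊹_ ; _⊛_ = _⊛_
    ; ⊹-cong = λ p q → ≐-trans (app₂-congˡ p) (app₂-congʳ q)
    ; ⊛-cong = λ p q → ≐-trans (app₂-congˡ p) (app₂-congʳ q)
    ; ⊹-assoc = instance₃ +-assoc ; ⊹-comm = instance₂ +-comm ; ⊹-identity = instance₁ +-identity
    ; ⊹-inverse = instance-∃ +-inverse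
    ; less-irrefl = λ {x} d → instance₁ <-irrefl x ∙⊢ d
    ; less-trans = λ {x} {y} {z} d e → instance₃ <-trans x y z ∙⊢ d ∙⊢ e
    ; compare = λ x y → ◇-bind (∨-E (instance₂ <-total x y)) λ where
        _ (inj₁ d) e k → k id (inj₁ (⊢-weaken d e))
        _ (inj₂ d)     → ◇-map (∨-E d) (λ _ → inj₂)
    ; ⊹-less = λ {x} {y} z d → instance₃ +-mono x y z ∙⊢ d
    ; ⊛-pos = λ {x} {y} p q → instance₂ ×-closed x y ∙⊢ p ∙⊢ q
    ; ⊛-assoc⁺ = λ {x} {y} {z} p q r → instance₃ ×-assoc x y z ∙⊢ p ∙⊢ q ∙⊢ r
    ; ⊛-comm⁺ = λ {x} {y} p q → instance₂ ×-comm x y ∙⊢ p ∙⊢ q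
    ; 𝟙-pos = T-axiom 1-pos
    ; ⊛-identity⁺ = λ {x} p → instance₁ ×-identity x ∙⊢ p
    ; ⊛-inverse⁺ = λ {x} p → ◇-map (instance-∃ ×-inverse x) λ { e (y , d) →
        let d′ = d ∙⊢ ⊢-weaken p e in y , ∧-E₁ d′ , ∧-E₂ d′ }
    ; ⊛-less⁺ = λ {x} {y} {z} p q r l → instance₃ ×-mono x y z ∙⊢ p ∙⊢ q ∙⊢ r ∙⊢ l
    ; root = λ k {x} p → ◇-map (instance-∃ (×-divisible k) x) λ { {Δ} e (y , d) →
        let d′ = d ∙⊢ ⊢-weaken p e in
        y , ∧-E₁ d′ , ≡.subst (λ t → T⁺ ∣ Δ ⊢ y ⊛ t ≐ x) (pow-power k (extend y (extend x (λ ())))) (∧-E₂ d′) }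
    ; ⊛-signˡ = λ {x} {y} z p → instance₃ ×-signˡ x y z ∙⊢ p
    ; ⊛-signʳ = λ {x} {y} z p → instance₃ ×-signʳ x y z ∙⊢ p
    ; κ-+ = λ a b d p → T-axiom (c-+ a b d p)
    ; κ-* = λ a b d p → T-axiom (c-× a b d p)
    ; κ-pos = λ a p → T-axiom (c-pos a p)
    ; κ-distribʳ = λ a b d p → instance₁ (c-distribʳ a b d p)
    ; κ-distribˡ = λ a → instance₂ (c-distribˡ a) }

  open Structures model using (combined)

  ringStructure : Structure frame ringLanguage
  ringStructure = reduct (ring⊆combined F) combined

  open Forcing ringStructure hiding (Value)
  private module A = Forcing ringStructure

  generic : ∀ {n} → Formula ringLanguage n → Formula L⁺ n
  generic φ = translate embed (translate (ring⊆star F) φ)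

  -- A ring term is its own value, in every world. Larger worlds are needed for quotients, which
  -- ring formulas do not contain.
  values : ∀ {n} (ρ : Vec Carrier n) t {Γ} →
           A.Value ρ t (substTerm (lookup ρ) (translateTerm embed (translateTerm (ring⊆star F) t))) Γ
  values ρ (# i)         = ≐-I _
  values ρ (con `0)      = ≐-I _
  values ρ (con `1)      = ≐-I _
  values ρ (app₂ `+ t u) = _ , _ , values ρ t , values ρ u , ≐-I _
  values ρ (app₂ `× t u) = _ , _ , values ρ t , values ρ u , ≐-I _

  subst-lookup : ∀ {n} (ρ : Vec Carrier n) x (φ : Formula L⁺ (suc n)) →
                 subst (extend x (lookup ρ)) φ ≡ subst (lookup (x ∷ ρ)) φ
  subst-lookup ρ x = subst-cong (λ { zero → refl ; (suc i) → refl })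

  mutual
    -- For ⇒ the premise is added to the world, where it is derivable and hence, by the converse,
    -- forced. For ∀ the forced instance at a fresh constant is generalised.
    force⇒derivable : ∀ {n} {ρ : Vec Carrier n} φ {Γ} → Force ρ φ Γ → T⁺ ∣ Γ ⊢ subst (lookup ρ) (generic φ)
    force⇒derivable (t ≐ u) h = h id (values _ t) (values _ u)
    force⇒derivable (t ≺ u) h = h id (values _ t) (values _ u)
    force⇒derivable ⊥′      h = h
    force⇒derivable (φ ⇒ ψ) h = ⇒-I (force⇒derivable ψ (h there (derivable⇒force φ (hyp (here refl)))))
    force⇒derivable {ρ = ρ} (∀′ φ) {Γ} h =
      generalise k (ℕ.m≤m⊔n _ _) (ℕ.m≤n⊔m (bounds Γ) _)
        (≡.subst (T⁺ ∣ Γ ⊢_)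
          (≡.sym (≡.trans (lift-[] (lookup ρ) (new k) (generic φ)) (subst-lookup ρ (new k) (generic φ))))
          (force⇒derivable φ (h (new k))))
      where k = bounds Γ ℕ.⊔ bound (subst (lift (lookup ρ)) (generic φ))

    derivable⇒force : ∀ {n} {ρ : Vec Carrier n} φ {Γ} → T⁺ ∣ Γ ⊢ subst (lookup ρ) (generic φ) → Force ρ φ Γ
    derivable⇒force (t ≐ u) d = same-value⁺ eq-regular (λ p q r → ≐-trans (≐-sym p) (≐-trans r q)) t u
      (values _ t) (values _ u) d
    derivable⇒force (t ≺ u) d = same-value⁺ less-regular less-resp t u (values _ t) (values _ u) d
    derivable⇒force ⊥′      d = d
    derivable⇒force (φ ⇒ ψ) d e p = derivable⇒force ψ (⇒-E (⊢-weaken d e) (force⇒derivable φ p))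
    derivable⇒force {ρ = ρ} (∀′ φ) {Γ} d x = derivable⇒force φ
      (≡.subst (T⁺ ∣ Γ ⊢_) (subst-lookup ρ x (generic φ)) (∀-E* {φ = generic φ} d x))

  reals⇒star : ∀ φ → T[ F ] ⊢ translate (ring⊆combined F) φ → T[ F ]* ⊢ translate (ring⊆star F) φ
  reals⇒star φ d = conservative (inj₁ `0)
    (≡.subst (T⁺ ⊢_) (subst-id (λ ()) (generic φ))
      (force⇒derivable {ρ = []} φ (force-translate⁻ (ring⊆combined F) combined φ
        (Forcing.sound combined (true⇒forced F model) d (λ ())))))

-- From T[F]* to T[F]: deriving the axioms

-- c_a is read as f_a(1).
module StarInReals {R : CompleteOrderedField} (F : Subfield R) where
  private module R = CompleteOrderedField R
  open R using (_≈_; _<_; 0#; 1#)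
  open Subfield F
  open Elements F
  open OrderedField R
  open Roots R using (root-exists; reciprocal)
  open IsStrictTotalOrder R.isStrictTotalOrder using (irrefl) renaming (trans to lt-trans)
  open Algebra.Properties.Ring R.ring using (-1*x≈-x; +-inverseʳ-unique)

  operation : RingOp → AddOp ⊎ MultOp
  operation `+ = inj₁ `+
  operation `× = inj₂ `×

  open Replacement {starLanguage F} {combinedLanguage F} (λ ()) operation

  ι : ∀ {n} → Constants n
  ι (inj₁ k) = con k
  ι (inj₂ a) = app₁ a (con `1)

  -- The truth of the axiom with `∃′` and `∧′` unfolded to their negative definitions. When x is not
  -- positive the implication is vacuous, and 0 serves as witness.
  exists-inverse : ∀ x → ¬ (∀ y → (0# < x → (0# < y → ¬ (x R.* y ≈ 1#)) → ⊥) → ⊥)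
  exists-inverse x k with R.compare 0# x
  ... | tri< l _ _ = let y , y>0 , e = reciprocal l in k y (λ _ n → n y>0 e)
  ... | tri≈ n _ _ = k 0# (λ l → ⊥-elim (n l))
  ... | tri> n _ _ = k 0# (λ l → ⊥-elim (n l))

  multPower : ∀ {n} → Term (multLanguage F) n → ℕ → Term (multLanguage F) n
  multPower t zero    = con `1
  multPower t (suc k) = app₂ `× t (multPower t k)

  pow-translate : ∀ {n m} (σ : Fin n → Term (combinedLanguage F) m) (κ : Constants m) → κ (inj₁ `1) ≡ con `1 →
                  ∀ t u → term σ κ t ≡ translateTerm (mult⊆combined F) u → ∀ k →
                  term σ κ (pow F t k) ≡ translateTerm (mult⊆combined F) (multPower u k)
  pow-translate σ κ e t u p zero    = e
  pow-translate σ κ e t u p (suc k) = ≡.cong₂ (app₂ (inj₂ `×)) p (pow-translate σ κ e t u p k)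

  value-power : ∀ {n} (ρ : Vec R.Carrier n) t k → Truth.value (multReals F) ρ (multPower t k)
                ≡ power R._*_ 1# (Truth.value (multReals F) ρ t) k
  value-power ρ t zero    = refl
  value-power ρ t (suc k) = ≡.cong (Truth.value (multReals F) ρ t R.*_) (value-power ρ t k)

  exists-root : ∀ k x → ¬ (∀ y → (0# < x → (0# < y → ¬ (power R._*_ 1# y (suc k) ≈ x)) → ⊥) → ⊥)
  exists-root k x h with R.compare 0# x
  ... | tri< l _ _ = let y , y>0 , e = root-exists k l in h y (λ _ n → n y>0 e)
  ... | tri≈ n _ _ = h 0# (λ l → ⊥-elim (n l))
  ... | tri> n _ _ = h 0# (λ l → ⊥-elim (n l))

  total : ∀ x y → ¬ (x < y) → ¬ (x ≈ y) → y < x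
  total x y n m with R.compare x y
  ... | tri< l _ _ = ⊥-elim (n l)
  ... | tri≈ _ e _ = ⊥-elim (m e)
  ... | tri> _ _ g = g

  private
    infixl 7 _✚_
    infixl 8 _✱_
    _✚_ : ∀ {n} → Term (addLanguage F) n → Term (addLanguage F) n → Term (addLanguage F) n
    _✚_ = app₂ `+
    _✱_ : ∀ {n} → Term (multLanguage F) n → Term (multLanguage F) n → Term (multLanguage F) n
    _✱_ = app₂ `×

    v₀ : ∀ {L n} → Term L (suc n)
    v₀ = # zero
    v₁ : ∀ {L n} → Term L (suc (suc n))
    v₁ = # suc zero
    v₂ : ∀ {L n} → Term L (suc (suc (suc n)))
    v₂ = # suc (suc zero)
    O I : ∀ {n} → Term (multLanguage F) n
    O = con `0
    I = con `1

    Tm⁺ : ℕ → Set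
    Tm⁺ = Term (combinedLanguage F)

    infixl 7 _⊹_
    infixl 8 _⊛_
    _⊹_ _⊛_ : ∀ {n} → Tm⁺ n → Tm⁺ n → Tm⁺ n
    _⊹_ = app₂ (inj₁ `+)
    _⊛_ = app₂ (inj₂ `×)

  module _ {n} {Γ : List (Formula (combinedLanguage F) n)} where

    -- The bridge between the languages: by `Tmult` the product c_a × x is f_a(x), and f_a is a
    -- symbol of the additive language too. Distributivity, which mixes + and ×, is thereby reduced
    -- to `Tadd`.
    scalar-⊛ : ∀ a → T[ F ] ∣ Γ ⊢ ∀′ (app₁ a (con `1) ⊛ v₀ ≐ app₁ a v₀)
    scalar-⊛ a = axiom (mult {σ = ∀′ (app₁ a I ✱ v₀ ≐ app₁ a v₀)} λ x → R.*-congʳ (R.*-identityʳ ⌊ a ⌋))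

    negation : T[ F ] ∣ Γ ⊢ ∀′ (∀′ (v₁ ⊹ v₀ ≐ con `0 ⇒ v₀ ≐ app₁ -1ᶠ v₁))
    negation = axiom (add {σ = ∀′ (∀′ (v₁ ✚ v₀ ≐ con `0 ⇒ v₀ ≐ app₁ -1ᶠ v₁))} λ x y p → R.trans (+-inverseʳ-unique x y p) (R.sym (-1*x≈-x x)))

    negation-inverse : T[ F ] ∣ Γ ⊢ ∀′ (v₀ ⊹ app₁ -1ᶠ v₀ ≐ con `0)
    negation-inverse = axiom (add {σ = ∀′ (v₀ ✚ app₁ -1ᶠ v₀ ≐ con `0)} λ x → R.trans (R.+-congˡ (-1*x≈-x x)) (R.-‿inverseʳ x))

    negation-⊛ˡ : T[ F ] ∣ Γ ⊢ ∀′ (∀′ (app₁ -1ᶠ v₁ ⊛ v₀ ≐ app₁ -1ᶠ (v₁ ⊛ v₀)))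
    negation-⊛ˡ = axiom (mult {σ = ∀′ (∀′ (app₁ -1ᶠ v₁ ✱ v₀ ≐ app₁ -1ᶠ (v₁ ✱ v₀)))} λ x y → R.*-assoc _ x y)

    negation-⊛ʳ : T[ F ] ∣ Γ ⊢ ∀′ (∀′ (v₀ ⊛ app₁ -1ᶠ v₁ ≐ app₁ -1ᶠ (v₀ ⊛ v₁)))
    negation-⊛ʳ = axiom (mult {σ = ∀′ (∀′ (v₀ ✱ app₁ -1ᶠ v₁ ≐ app₁ -1ᶠ (v₀ ✱ v₁)))} λ x y → R.trans (R.sym (R.*-assoc y _ x))
      (R.trans (R.*-congʳ (R.*-comm y _)) (R.*-assoc _ y x)))

  axioms : ∀ {τ} → T[ F ]* τ → T[ F ] ⊢ form (λ ()) ι τ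
  axioms +-assoc    = axiom (add {σ = ∀′ (∀′ (∀′ ((v₂ ✚ v₁) ✚ v₀ ≐ v₂ ✚ (v₁ ✚ v₀))))} λ x y z → R.+-assoc x y z)
  axioms +-comm     = axiom (add {σ = ∀′ (∀′ (v₁ ✚ v₀ ≐ v₀ ✚ v₁))} λ x y → R.+-comm x y)
  axioms +-identity = axiom (add {σ = ∀′ (v₀ ✚ con `0 ≐ v₀)} λ x → R.+-identityʳ x)
  axioms +-inverse  = axiom (add {σ = ∀′ (∃′ (v₁ ✚ v₀ ≐ con `0))} λ x k → k (R.- x) (R.-‿inverseʳ x))
  axioms <-irrefl   = axiom (add {σ = ∀′ (¬′ (v₀ ≺ v₀))} λ x l → irrefl R.refl l)
  axioms <-trans    = axiom (add {σ = ∀′ (∀′ (∀′ (v₂ ≺ v₁ ⇒ v₁ ≺ v₀ ⇒ v₂ ≺ v₀)))} λ x y z l m → lt-trans l m)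
  axioms <-total    = axiom (add {σ = ∀′ (∀′ (v₁ ≺ v₀ ∨′ v₁ ≐ v₀ ∨′ v₀ ≺ v₁))} total)
  axioms +-mono     = axiom (add {σ = ∀′ (∀′ (∀′ (v₂ ≺ v₁ ⇒ v₂ ✚ v₀ ≺ v₁ ✚ v₀)))} λ x y z l → R.+-mono-< x y z l)
  axioms ×-closed   = axiom (mult {σ = ∀′ (∀′ (O ≺ v₁ ⇒ O ≺ v₀ ⇒ O ≺ v₁ ✱ v₀))} λ x y → R.*-pos x y)
  axioms ×-assoc    = axiom (mult {σ = ∀′ (∀′ (∀′ (O ≺ v₂ ⇒ O ≺ v₁ ⇒ O ≺ v₀ ⇒ (v₂ ✱ v₁) ✱ v₀ ≐ v₂ ✱ (v₁ ✱ v₀))))} λ x y z _ _ _ → R.*-assoc x y z)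
  axioms ×-comm     = axiom (mult {σ = ∀′ (∀′ (O ≺ v₁ ⇒ O ≺ v₀ ⇒ v₁ ✱ v₀ ≐ v₀ ✱ v₁))} λ x y _ _ → R.*-comm x y)
  axioms 1-pos      = axiom (mult {σ = O ≺ I} R.0<1)
  axioms ×-identity = axiom (mult {σ = ∀′ (O ≺ v₀ ⇒ v₀ ✱ I ≐ v₀)} λ x _ → R.*-identityʳ x)
  axioms ×-inverse  = axiom (mult {σ = ∀′ (∃′ (O ≺ v₁ ⇒ (O ≺ v₀ ∧′ v₁ ✱ v₀ ≐ I)))} exists-inverse)
  axioms ×-mono     = axiom (mult {σ = ∀′ (∀′ (∀′ (O ≺ v₂ ⇒ O ≺ v₁ ⇒ O ≺ v₀ ⇒ v₂ ≺ v₁ ⇒ v₂ ✱ v₀ ≺ v₁ ✱ v₀)))} λ x y z _ _ p l → *-mono-< p l)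
  -- For a variable k the powers do not compute, so the image of `pow` is identified with
  -- `multPower` by an explicit equation.
  axioms (×-divisible k) = ≡.subst (λ t → T[ F ] ⊢ ∀′ (∃′ (con `0 ≺ v₁ ⇒ (con `0 ≺ v₀ ∧′ v₀ ⊛ t ≐ v₁))))
    (≡.sym (pow-translate _ _ refl v₀ v₀ refl k))
    (≡.subst (T[ F ] ⊢_) (subst-id (λ ()) (translate (mult⊆combined F) (divisible k)))
      (axiom (mult {σ = divisible k} (λ x h → exists-root k x λ y p → h y λ l n → p l λ m e → n m
        (R.trans (R.*-congˡ (R.reflexive (value-power (y ∷ x ∷ []) v₀ k))) e)))))
    where
    divisible : ℕ → Sentence (multLanguage F)
    divisible k = ∀′ (∃′ (con `0 ≺ v₁ ⇒ (con `0 ≺ v₀ ∧′ app₂ `× v₀ (multPower v₀ k) ≐ v₁)))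
  axioms ×-signˡ = ∀-I (∀-I (∀-I (⇒-I (≐-trans
    (app₂-congʳ (≐-trans
      (app₂-congˡ (⇒-E (∀-E (∀-E negation v₂) v₁) (hyp (here refl))))
      (∀-E (∀-E negation-⊛ˡ v₂) v₀)))
    (∀-E negation-inverse (v₂ ⊛ v₀))))))
  axioms ×-signʳ = ∀-I (∀-I (∀-I (⇒-I (≐-trans
    (app₂-congʳ (≐-trans
      (app₂-congʳ (⇒-E (∀-E (∀-E negation v₂) v₁) (hyp (here refl))))
      (∀-E (∀-E negation-⊛ʳ v₂) v₀)))
    (∀-E negation-inverse (v₀ ⊛ v₂))))))
  axioms (c-+ a b d p) = axiom (add {σ = app₁ d (con `1) ≐ app₁ a (con `1) ✚ app₁ b (con `1)} (R.trans (R.*-congʳ p) (R.distribʳ 1# ⌊ a ⌋ ⌊ b ⌋)))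
  axioms (c-× a b d p) = axiom (mult {σ = app₁ d I ≐ app₁ a I ✱ app₁ b I} (R.trans (R.*-identityʳ ⌊ d ⌋) (R.trans p
    (R.sym (R.*-cong (R.*-identityʳ ⌊ a ⌋) (R.*-identityʳ ⌊ b ⌋))))))
  axioms (c-pos a p) = axiom (mult {σ = O ≺ app₁ a I} (<-resp R.refl (R.sym (R.*-identityʳ ⌊ a ⌋)) p))
  axioms (c-distribʳ a b d p) = ∀-I (≐-trans (∀-E (scalar-⊛ d) v₀) (≐-trans (∀-E sum v₀)
    (≐-sym (≐-trans (app₂-congˡ (∀-E (scalar-⊛ a) v₀)) (app₂-congʳ (∀-E (scalar-⊛ b) v₀))))))
    where
    sum : ∀ {n} {Γ : List (Formula (combinedLanguage F) n)} → T[ F ] ∣ Γ ⊢ ∀′ (app₁ d v₀ ≐ app₁ a v₀ ⊹ app₁ b v₀)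
    sum = axiom (add {σ = ∀′ (app₁ d v₀ ≐ app₁ a v₀ ✚ app₁ b v₀)} λ x → R.trans (R.*-congʳ p) (R.distribʳ x ⌊ a ⌋ ⌊ b ⌋))
  axioms (c-distribˡ a) = ∀-I (∀-I (≐-trans (∀-E (scalar-⊛ a) (v₁ ⊹ v₀))
    (≐-trans (∀-E (∀-E sum v₁) v₀)
    (≐-sym (≐-trans (app₂-congˡ (∀-E (scalar-⊛ a) v₁)) (app₂-congʳ (∀-E (scalar-⊛ a) v₀)))))))
    where
    sum : ∀ {n} {Γ : List (Formula (combinedLanguage F) n)} → T[ F ] ∣ Γ ⊢ ∀′ (∀′ (app₁ a (v₁ ⊹ v₀) ≐ app₁ a v₁ ⊹ app₁ a v₀))
    sum = axiom (add {σ = ∀′ (∀′ (app₁ a (v₁ ✚ v₀) ≐ app₁ a v₁ ✚ app₁ a v₀))} λ x y → R.distribˡ ⌊ a ⌋ x y)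

  Reads : ∀ {n} → Constants n → Set
  Reads κ = ∀ k → κ k ≡ ι k

  substTerm-ι : ∀ {n m} (σ : Fin n → Term (combinedLanguage F) m) k → substTerm σ (ι k) ≡ ι k
  substTerm-ι σ (inj₁ k) = refl
  substTerm-ι σ (inj₂ a) = refl

  axioms-anywhere : ∀ {n} {κ : Constants n} {Δ τ} → Reads κ → T[ F ]* τ → T[ F ] ∣ Δ ⊢ form (λ ()) κ τ
  axioms-anywhere {Δ = Δ} {τ} e a = ≡.subst (T[ F ] ∣ Δ ⊢_)
    (≡.trans (subst-form (λ ()) (λ ()) ι τ)
      (form-cong (λ ()) (λ k → ≡.trans (substTerm-ι (λ ()) k) (≡.sym (e k))) τ))
    (⊢-subst (λ ()) (axioms a) (λ ()))

  term-ring : ∀ {n m} (σ : Fin n → Term (combinedLanguage F) m) {κ} → Reads κ →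
              ∀ t → term σ κ (translateTerm (ring⊆star F) t) ≡ substTerm σ (translateTerm (ring⊆combined F) t)
  term-ring σ e (# i)         = refl
  term-ring σ e (con k)       = e (inj₁ k)
  term-ring σ e (app₂ `+ t u) = ≡.cong₂ (app₂ (inj₁ `+)) (term-ring σ e t) (term-ring σ e u)
  term-ring σ e (app₂ `× t u) = ≡.cong₂ (app₂ (inj₂ `×)) (term-ring σ e t) (term-ring σ e u)

  reads-wk : ∀ {n} {κ : Constants n} → Reads κ → Reads (wkTerm ∘ κ)
  reads-wk e k = ≡.trans (≡.cong wkTerm (e k)) (substTerm-ι _ k)

  form-ring : ∀ {n m} (σ : Fin n → Term (combinedLanguage F) m) {κ} → Reads κ →
              ∀ φ → form σ κ (translate (ring⊆star F) φ) ≡ subst σ (translate (ring⊆combined F) φ)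
  form-ring σ e (t ≐ u) = ≡.cong₂ _≐_ (term-ring σ e t) (term-ring σ e u)
  form-ring σ e (t ≺ u) = ≡.cong₂ _≺_ (term-ring σ e t) (term-ring σ e u)
  form-ring σ e ⊥′      = refl
  form-ring σ e (φ ⇒ ψ) = ≡.cong₂ _⇒_ (form-ring σ e φ) (form-ring σ e ψ)
  form-ring σ {κ} e (∀′ φ) = ≡.cong ∀′ (form-ring (lift σ) (reads-wk {κ = κ} e) φ)

  star⇒reals : ∀ φ → T[ F ]* ⊢ translate (ring⊆star F) φ → T[ F ] ⊢ translate (ring⊆combined F) φ
  star⇒reals φ d = ≡.subst (T[ F ] ⊢_)
    (≡.trans (form-ring (λ ()) (λ _ → refl) φ) (subst-id (λ ()) (translate (ring⊆combined F) φ)))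
    (Transport.transport Reads (λ {_} {κ} → λ e → reads-wk {κ = κ} e) axioms-anywhere d {σ = λ ()} {ι} (λ _ → refl) (λ ()))

theorem4p3 : (ℝ : CompleteOrderedField) (F : Subfield ℝ) (φ : Sentence ringLanguage) →
    (T[ F ] ⊢ translate (ring⊆combined F) φ) ⇔ (T[ F ]* ⊢ translate (ring⊆star F) φ)
theorem4p3 ℝ F φ = mk⇔ (GenericModel.reals⇒star F φ) (StarInReals.star⇒reals F φ)
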